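{- Let $n\ge 1$ and $0\le k\le n/2$ be integers, and put $p=k/n$. Endow the slice $\binom{[n]}{k}$ with the uniform measure. The set $\{\chi_B : B\in\mathcal{B}_{n,d}\text{ for some } d\le k\}$ (each polynomial $\chi_B$ being restricted to a function on $\binom{[n]}{k}$) is an orthogonal basis for the vector space of functions $\binom{[n]}{k}\to\mathbb{R}$, and for every $d\le k$ and $B=b_1,\dots,b_d\in\mathcal{B}_{n,d}$, $$\|\chi_B\|^2=c_B\,2^d\,\frac{k^{\underline{d}}\,(n-k)^{\underline{d}}}{n^{\underline{2d}}}=c_B\,(2p(1-p))^d\left(1\pm O_p\!\left(\frac{d^2}{n}\right)\right),$$ where $c_B=\prod_{i=1}^d\frac{(b_i-2(i-1))(b_i-2(i-1)-1)}{2}$.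
   Context: The slice is $\binom{[n]}{k}=\{(x_1,\dots,x_n)\in\{0,1\}^n:\sum_i x_i=k\}$. For functions $f,g$ on the slice, $\langle f,g\rangle=\mathbb{E}[fg]$ and $\|f\|^2=\mathbb{E}[f^2]$, with expectation over the uniform distribution on the slice. Write $[n]=\{1,\dots,n\}$. For an integer $0\le d\le n/2$, $\mathcal{S}_{n,d}$ is the set of sequences $S=s_1,\dots,s_d$ of distinct elements of $[n]$. For disjoint $A,B\in\mathcal{S}_{n,d}$ (no common elements), let $\chi_{A,B}=\prod_{i=1}^d (x_{a_i}-x_{b_i})$, and write $A<B$ if $a_i<b_i$ for all $i\in[d]$ ($A$ need not be increasing). A top set of length $d$ is an increasing sequence $B\in\mathcal{S}_{n,d}$ for which there exists a sequence $A\in\mathcal{S}_{n,d}$ disjoint from $B$ with $A<B$. $\mathcal{B}_{n,d}$ is the set of top sets of length $d$. For $B\in\mathcal{B}_{n,d}$, define $$\chi_B=\sum_{A\in\mathcal{S}_{n,d}:\ A\cap B=\emptyset,\ A<B}\chi_{A,B}$$ (so $\chi_\emptyset=1$). Falling powers: $n^{\underline{k}}=n(n-1)\cdots(n-k+1)$ ($k$ factors). The notation $X=Y(1\pm O_p(d^2/n))$ means that there is a constant $C_p$ depending only on $p$ such that $(1-C_p d^2/n)Y\le X\le(1+C_p d^2/n)Y$. -}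

module Defs where

open import Algebra.Bundles using (CommutativeRing; Semiring)
import Algebra.Definitions.RawSemiring as RawSemiringDefs
open import Data.Fin as Fin using (Fin; toℕ)
import Data.Fin.Properties as Fin
open import Data.Integer as ℤ using (ℤ; +_)
open import Data.Irrelevant using ([_])
open import Data.List as List using (List; []; _∷_)
open import Data.List.Membership.Propositional using (_∈_)
import Data.List.Relation.Unary.Unique.Propositional as ListUnique
open import Data.Maybe using (Maybe; just; nothing)
open import Data.Nat as ℕ using (ℕ; zero; suc)
import Data.Nat.Properties as ℕ
open import Data.Product using (Σ; ∃; _×_; _,_)
open import Data.Rational as ℚ using (ℚ; 0ℚ; 1ℚ; ½)
import Data.Rational.Properties as ℚ
open import Data.Rational.Solver using (module +-*-Solver)
open import Data.Refinement as Refinement using (Refinement-syntax; value)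
open import Data.Vec as Vec using (Vec; lookup)
open import Data.Vec.Functional using (Vector)
open import Data.Vec.Relation.Unary.AllPairs using (allPairs?)
open import Data.Vec.Relation.Unary.Unique.Propositional using (Unique)
open import Level using (0ℓ)
open import Relation.Binary.PropositionalEquality
  using (_≡_; _≢_; refl; sym; cong; subst; module ≡-Reasoning)
open import Relation.Nullary using (Dec; yes; no)
open import Relation.Nullary.Decidable using (_×-dec_; ¬?; map′)

-- Null families of rationals.  The index type is abstract so that the
-- same lemmas serve sequences (for equality of reals) and double
-- sequences (for the Cauchy condition).

module NullFamilies {I : Set} (_≽_ : I → ℕ → Set)
                    (≽-down : ∀ {i M N} → i ≽ N → M ℕ.≤ N → i ≽ M) where

  Null : (I → ℚ) → Set
  Null z = ∀ ε → 0ℚ ℚ.< ε → ∃ λ N → ∀ i → i ≽ N → ℚ.∣ z i ∣ ℚ.< ε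

  EventuallyBounded : (I → ℚ) → Set
  EventuallyBounded w = ∃ λ M → 0ℚ ℚ.< M × (∃ λ N → ∀ i → i ≽ N → ℚ.∣ w i ∣ ℚ.≤ M)

  null-resp : ∀ {z z′} → (∀ i → z i ≡ z′ i) → Null z → Null z′
  null-resp eq nz ε ε>0 with nz ε ε>0
  ... | N , small = N , λ i i≽N → subst (λ q → ℚ.∣ q ∣ ℚ.< ε) (eq i) (small i i≽N)

  null-0 : Null (λ _ → 0ℚ)
  null-0 ε ε>0 = 0 , λ _ _ → ε>0

  null-neg : ∀ {z} → Null z → Null (λ i → ℚ.- z i)
  null-neg {z} nz ε ε>0 with nz ε ε>0
  ... | N , small = N , λ i i≽N → subst (ℚ._< ε) (sym (ℚ.∣-p∣≡∣p∣ (z i))) (small i i≽N)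

  null-+ : ∀ {z w} → Null z → Null w → Null (λ i → z i ℚ.+ w i)
  null-+ {z} {w} nz nw ε ε>0
    with nz (½ ℚ.* ε) half>0 | nw (½ ℚ.* ε) half>0
    where
    half>0 : 0ℚ ℚ.< ½ ℚ.* ε
    half>0 = subst (ℚ._< ½ ℚ.* ε) (ℚ.*-zeroʳ ½) (ℚ.*-monoʳ-<-pos ½ ε>0)
  ... | N , zsmall | M , wsmall = N ℕ.⊔ M , λ i i≽ →
    ℚ.≤-<-trans (ℚ.∣p+q∣≤∣p∣+∣q∣ (z i) (w i))
      (subst (ℚ.∣ z i ∣ ℚ.+ ℚ.∣ w i ∣ ℚ.<_) halves
        (ℚ.+-mono-< (zsmall i (≽-down i≽ (ℕ.m≤m⊔n N M)))
                    (wsmall i (≽-down i≽ (ℕ.m≤n⊔m N M)))))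
    where
    open +-*-Solver
    halves : ½ ℚ.* ε ℚ.+ ½ ℚ.* ε ≡ ε
    halves = solve 1 (λ e → con ½ :* e :+ con ½ :* e := e) refl ε

  null-* : ∀ {w z} → EventuallyBounded w → Null z → Null (λ i → w i ℚ.* z i)
  null-* {w} {z} (M , M>0 , K , bound) nz ε ε>0 with nz δ δ>0
    where
    instance
      M-pos : ℚ.Positive M
      M-pos = ℚ.positive M>0
      M-nz : ℚ.NonZero M
      M-nz = ℚ.pos⇒nonZero M
      1/M-pos : ℚ.Positive (ℚ.1/ M)
      1/M-pos = ℚ.1/pos⇒pos M
    δ : ℚ
    δ = ℚ.1/ M ℚ.* ε
    δ>0 : 0ℚ ℚ.< δ
    δ>0 = subst (ℚ._< δ) (ℚ.*-zeroʳ (ℚ.1/ M)) (ℚ.*-monoʳ-<-pos (ℚ.1/ M) ε>0)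
  ... | N , small = K ℕ.⊔ N , λ i i≽ →
    ℚ.≤-<-trans
      (subst (ℚ._≤ M ℚ.* ℚ.∣ z i ∣) (sym (ℚ.∣p*q∣≡∣p∣*∣q∣ (w i) (z i)))
        (ℚ.*-monoʳ-≤-nonNeg ℚ.∣ z i ∣ {{ℚ.∣-∣-nonNeg (z i)}}
          (bound i (≽-down i≽ (ℕ.m≤m⊔n K N)))))
      (subst (M ℚ.* ℚ.∣ z i ∣ ℚ.<_) Mδ≡ε
        (ℚ.*-monoʳ-<-pos M (small i (≽-down i≽ (ℕ.m≤n⊔m K N)))))
    where
    instance
      M-pos′ : ℚ.Positive M
      M-pos′ = ℚ.positive M>0
      M-nz′ : ℚ.NonZero M
      M-nz′ = ℚ.pos⇒nonZero M
    open ≡-Reasoning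
    Mδ≡ε : M ℚ.* (ℚ.1/ M ℚ.* ε) ≡ ε
    Mδ≡ε = begin
      M ℚ.* (ℚ.1/ M ℚ.* ε) ≡⟨ ℚ.*-assoc M (ℚ.1/ M) ε ⟨
      M ℚ.* ℚ.1/ M ℚ.* ε   ≡⟨ cong (ℚ._* ε) (ℚ.*-inverseʳ M) ⟩
      1ℚ ℚ.* ε             ≡⟨ ℚ.*-identityˡ ε ⟩
      ε                    ∎

module Seq = NullFamilies {ℕ} (λ n N → N ℕ.≤ n) (λ N≤n M≤N → ℕ.≤-trans M≤N N≤n)

module DoubleSeq = NullFamilies {ℕ × ℕ} (λ (m , n) N → N ℕ.≤ m × N ℕ.≤ n)
  (λ (N≤m , N≤n) M≤N → ℕ.≤-trans M≤N N≤m , ℕ.≤-trans M≤N N≤n)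

-- The real numbers: Cauchy sequences of rationals, with the equality
-- "the difference tends to 0" (a setoid, there being no quotients).

IsCauchy : (ℕ → ℚ) → Set
IsCauchy s = ∀ ε → 0ℚ ℚ.< ε →
  ∃ λ N → ∀ m n → N ℕ.≤ m → N ℕ.≤ n → ℚ.∣ s m ℚ.- s n ∣ ℚ.< ε

record ℝ : Set where
  constructor mkℝ
  field
    seq    : ℕ → ℚ
    cauchy : IsCauchy seq
open ℝ public

infix 4 _≈_ _≤_

record _≈_ (x y : ℝ) : Set where
  no-eta-equality
  constructor mk≈
  field
    un≈ : ∀ ε → 0ℚ ℚ.< ε →
      ∃ λ N → ∀ n → N ℕ.≤ n → ℚ.∣ seq x n ℚ.- seq y n ∣ ℚ.< ε
open _≈_ public

record _≤_ (x y : ℝ) : Set where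
  no-eta-equality
  constructor mk≤
  field
    un≤ : ∀ ε → 0ℚ ℚ.< ε →
      ∃ λ N → ∀ n → N ℕ.≤ n → seq x n ℚ.≤ seq y n ℚ.+ ε
open _≤_ public

differences : (ℕ → ℚ) → ℕ × ℕ → ℚ
differences s (m , n) = s m ℚ.- s n

abstract

  cauchy⇒null : ∀ {s} → IsCauchy s → DoubleSeq.Null (differences s)
  cauchy⇒null c ε ε>0 with c ε ε>0
  ... | N , close = N , λ (m , n) (N≤m , N≤n) → close m n N≤m N≤n

  null⇒cauchy : ∀ {s} → DoubleSeq.Null (differences s) → IsCauchy s
  null⇒cauchy c ε ε>0 with c ε ε>0
  ... | N , close = N , λ m n N≤m N≤n → close (m , n) (N≤m , N≤n)

  cauchy⇒bounded : ∀ {s} → IsCauchy s → Seq.EventuallyBounded s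
  cauchy⇒bounded {s} c with c 1ℚ (ℚ.positive⁻¹ 1ℚ)
  ... | N , close = 1ℚ ℚ.+ ℚ.∣ s N ∣ , M>0 , N , λ n N≤n →
      ℚ.≤-trans
        (subst (λ q → ℚ.∣ q ∣ ℚ.≤ ℚ.∣ s n ℚ.- s N ∣ ℚ.+ ℚ.∣ s N ∣) (cancel (s n) (s N))
          (ℚ.∣p+q∣≤∣p∣+∣q∣ (s n ℚ.- s N) (s N)))
        (ℚ.+-monoˡ-≤ ℚ.∣ s N ∣ (ℚ.<⇒≤ (close n N N≤n ℕ.≤-refl)))
    where
    open +-*-Solver
    cancel : ∀ a b → (a ℚ.- b) ℚ.+ b ≡ a
    cancel = solve 2 (λ a b → (a :- b) :+ b := a) refl
    M>0 : 0ℚ ℚ.< 1ℚ ℚ.+ ℚ.∣ s N ∣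
    M>0 = ℚ.+-mono-<-≤ (ℚ.positive⁻¹ 1ℚ) (ℚ.0≤∣p∣ (s N))

  bounded-fst : ∀ {s} → Seq.EventuallyBounded s → DoubleSeq.EventuallyBounded (λ (m , _) → s m)
  bounded-fst (M , M>0 , N , bound) = M , M>0 , N , λ (m , _) (N≤m , _) → bound m N≤m

  bounded-snd : ∀ {s} → Seq.EventuallyBounded s → DoubleSeq.EventuallyBounded (λ (_ , n) → s n)
  bounded-snd (M , M>0 , N , bound) = M , M>0 , N , λ (_ , n) (_ , N≤n) → bound n N≤n

  const-cauchy : ∀ q → IsCauchy (λ _ → q)
  const-cauchy q = null⇒cauchy {λ _ → q}
    (DoubleSeq.null-resp {λ _ → 0ℚ} {λ _ → q ℚ.- q}
      (λ _ → sym (ℚ.+-inverseʳ q)) DoubleSeq.null-0)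

  +-cauchy : ∀ {s t} → IsCauchy s → IsCauchy t → IsCauchy (λ n → s n ℚ.+ t n)
  +-cauchy {s} {t} cs ct = null⇒cauchy {λ n → s n ℚ.+ t n}
    (DoubleSeq.null-resp
      {λ i → differences s i ℚ.+ differences t i} {differences (λ n → s n ℚ.+ t n)}
      (λ (m , n) → rearrange (s m) (s n) (t m) (t n))
      (DoubleSeq.null-+ {differences s} {differences t}
        (cauchy⇒null {s} cs) (cauchy⇒null {t} ct)))
    where
    open +-*-Solver
    rearrange : ∀ a b c d → (a ℚ.- b) ℚ.+ (c ℚ.- d) ≡ (a ℚ.+ c) ℚ.- (b ℚ.+ d)
    rearrange = solve 4 (λ a b c d → (a :- b) :+ (c :- d) := (a :+ c) :- (b :+ d)) refl

  neg-cauchy : ∀ {s} → IsCauchy s → IsCauchy (λ n → ℚ.- s n)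
  neg-cauchy {s} cs = null⇒cauchy {λ n → ℚ.- s n}
    (DoubleSeq.null-resp {λ i → ℚ.- differences s i} {differences (λ n → ℚ.- s n)}
      (λ (m , n) → rearrange (s m) (s n))
      (DoubleSeq.null-neg {differences s} (cauchy⇒null {s} cs)))
    where
    open +-*-Solver
    rearrange : ∀ a b → ℚ.- (a ℚ.- b) ≡ (ℚ.- a) ℚ.- (ℚ.- b)
    rearrange = solve 2 (λ a b → :- (a :- b) := (:- a) :- (:- b)) refl

  *-cauchy : ∀ {s t} → IsCauchy s → IsCauchy t → IsCauchy (λ n → s n ℚ.* t n)
  *-cauchy {s} {t} cs ct = null⇒cauchy {λ n → s n ℚ.* t n}
    (DoubleSeq.null-resp {λ i → sΔt i ℚ.+ tΔs i} {differences (λ n → s n ℚ.* t n)}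
      (λ (m , n) → rearrange (s m) (s n) (t m) (t n))
      (DoubleSeq.null-+ {sΔt} {tΔs}
        (DoubleSeq.null-* {λ (m , _) → s m} {differences t}
          (bounded-fst {s} (cauchy⇒bounded {s} cs)) (cauchy⇒null {t} ct))
        (DoubleSeq.null-* {λ (_ , n) → t n} {differences s}
          (bounded-snd {t} (cauchy⇒bounded {t} ct)) (cauchy⇒null {s} cs))))
    where
    sΔt tΔs : ℕ × ℕ → ℚ
    sΔt (m , n) = s m ℚ.* (t m ℚ.- t n)
    tΔs (m , n) = t n ℚ.* (s m ℚ.- s n)
    open +-*-Solver
    rearrange : ∀ a b c d →
      a ℚ.* (c ℚ.- d) ℚ.+ d ℚ.* (a ℚ.- b) ≡ a ℚ.* c ℚ.- b ℚ.* d
    rearrange = solve 4 (λ a b c d →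
      a :* (c :- d) :+ d :* (a :- b) := a :* c :- b :* d) refl

fromℚ : ℚ → ℝ
fromℚ q = mkℝ (λ _ → q) (const-cauchy q)

0ℝ 1ℝ : ℝ
0ℝ = fromℚ 0ℚ
1ℝ = fromℚ 1ℚ

infixl 6 _+_ _-_
infixl 7 _*_
infix  8 -_

_+_ : ℝ → ℝ → ℝ
x + y = mkℝ (λ n → seq x n ℚ.+ seq y n) (+-cauchy {seq x} {seq y} (cauchy x) (cauchy y))

-_ : ℝ → ℝ
- x = mkℝ (λ n → ℚ.- seq x n) (neg-cauchy {seq x} (cauchy x))

_-_ : ℝ → ℝ → ℝ
x - y = x + (- y)

_*_ : ℝ → ℝ → ℝ
x * y = mkℝ (λ n → seq x n ℚ.* seq y n) (*-cauchy {seq x} {seq y} (cauchy x) (cauchy y))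

gap : ℝ → ℝ → ℕ → ℚ
gap x y n = seq x n ℚ.- seq y n

abstract

  pointwise⇒≈ : ∀ {x y} → (∀ n → seq x n ≡ seq y n) → x ≈ y
  pointwise⇒≈ {x} {y} eq = mk≈ (Seq.null-resp {λ _ → 0ℚ} {gap x y}
    (λ n → sym (subst (λ q → seq x n ℚ.- q ≡ 0ℚ) (eq n) (ℚ.+-inverseʳ (seq x n))))
    Seq.null-0)

  ≈-refl : ∀ {x} → x ≈ x
  ≈-refl = pointwise⇒≈ (λ _ → refl)

  ≈-sym : ∀ {x y} → x ≈ y → y ≈ x
  ≈-sym {x} {y} x≈y = mk≈ (Seq.null-resp {λ n → ℚ.- gap x y n} {gap y x}
    (λ n → rearrange (seq x n) (seq y n)) (Seq.null-neg {gap x y} (un≈ x≈y)))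
    where
    open +-*-Solver
    rearrange : ∀ a b → ℚ.- (a ℚ.- b) ≡ b ℚ.- a
    rearrange = solve 2 (λ a b → :- (a :- b) := b :- a) refl

  ≈-trans : ∀ {x y z} → x ≈ y → y ≈ z → x ≈ z
  ≈-trans {x} {y} {z} x≈y y≈z = mk≈ (Seq.null-resp
    {λ n → gap x y n ℚ.+ gap y z n} {gap x z}
    (λ n → rearrange (seq x n) (seq y n) (seq z n))
    (Seq.null-+ {gap x y} {gap y z} (un≈ x≈y) (un≈ y≈z)))
    where
    open +-*-Solver
    rearrange : ∀ a b c → (a ℚ.- b) ℚ.+ (b ℚ.- c) ≡ a ℚ.- c
    rearrange = solve 3 (λ a b c → (a :- b) :+ (b :- c) := a :- c) refl

  +-cong : ∀ {x y u v} → x ≈ y → u ≈ v → x + u ≈ y + v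
  +-cong {x} {y} {u} {v} x≈y u≈v = mk≈ (Seq.null-resp
    {λ n → gap x y n ℚ.+ gap u v n} {gap (x + u) (y + v)}
    (λ n → rearrange (seq x n) (seq y n) (seq u n) (seq v n))
    (Seq.null-+ {gap x y} {gap u v} (un≈ x≈y) (un≈ u≈v)))
    where
    open +-*-Solver
    rearrange : ∀ a b c d → (a ℚ.- b) ℚ.+ (c ℚ.- d) ≡ (a ℚ.+ c) ℚ.- (b ℚ.+ d)
    rearrange = solve 4 (λ a b c d → (a :- b) :+ (c :- d) := (a :+ c) :- (b :+ d)) refl

  -‿cong : ∀ {x y} → x ≈ y → - x ≈ - y
  -‿cong {x} {y} x≈y = mk≈ (Seq.null-resp {λ n → ℚ.- gap x y n} {gap (- x) (- y)}
    (λ n → rearrange (seq x n) (seq y n)) (Seq.null-neg {gap x y} (un≈ x≈y)))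
    where
    open +-*-Solver
    rearrange : ∀ a b → ℚ.- (a ℚ.- b) ≡ (ℚ.- a) ℚ.- (ℚ.- b)
    rearrange = solve 2 (λ a b → :- (a :- b) := (:- a) :- (:- b)) refl

  *-cong : ∀ {x y u v} → x ≈ y → u ≈ v → x * u ≈ y * v
  *-cong {x} {y} {u} {v} x≈y u≈v = mk≈ (Seq.null-resp
    {λ n → xΔuv n ℚ.+ vΔxy n} {gap (x * u) (y * v)}
    (λ n → rearrange (seq x n) (seq y n) (seq u n) (seq v n))
    (Seq.null-+ {xΔuv} {vΔxy}
      (Seq.null-* {seq x} {gap u v} (cauchy⇒bounded {seq x} (cauchy x)) (un≈ u≈v))
      (Seq.null-* {seq v} {gap x y} (cauchy⇒bounded {seq v} (cauchy v)) (un≈ x≈y))))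
    where
    xΔuv vΔxy : ℕ → ℚ
    xΔuv n = seq x n ℚ.* gap u v n
    vΔxy n = seq v n ℚ.* gap x y n
    open +-*-Solver
    rearrange : ∀ a b c d →
      a ℚ.* (c ℚ.- d) ℚ.+ d ℚ.* (a ℚ.- b) ≡ a ℚ.* c ℚ.- b ℚ.* d
    rearrange = solve 4 (λ a b c d →
      a :* (c :- d) :+ d :* (a :- b) := a :* c :- b :* d) refl

ℝ-commutativeRing : CommutativeRing 0ℓ 0ℓ
ℝ-commutativeRing = record
  { Carrier = ℝ ; _≈_ = _≈_ ; _+_ = _+_ ; _*_ = _*_ ; -_ = -_ ; 0# = 0ℝ ; 1# = 1ℝ
  ; isCommutativeRing = record
    { isRing = record
      { +-isAbelianGroup = record
        { isGroup = record
          { isMonoid = record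
            { isSemigroup = record
              { isMagma = record
                { isEquivalence = record
                  { refl = ≈-refl ; sym = ≈-sym ; trans = ≈-trans }
                ; ∙-cong = +-cong }
              ; assoc = λ x y z → pointwise⇒≈ (λ n → ℚ.+-assoc (seq x n) (seq y n) (seq z n)) }
            ; identity =
                (λ x → pointwise⇒≈ (λ n → ℚ.+-identityˡ (seq x n)))
              , (λ x → pointwise⇒≈ (λ n → ℚ.+-identityʳ (seq x n))) }
          ; inverse =
              (λ x → pointwise⇒≈ (λ n → ℚ.+-inverseˡ (seq x n)))
            , (λ x → pointwise⇒≈ (λ n → ℚ.+-inverseʳ (seq x n)))
          ; ⁻¹-cong = -‿cong }
        ; comm = λ x y → pointwise⇒≈ (λ n → ℚ.+-comm (seq x n) (seq y n)) }
      ; *-cong = *-cong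
      ; *-assoc = λ x y z → pointwise⇒≈ (λ n → ℚ.*-assoc (seq x n) (seq y n) (seq z n))
      ; *-identity =
          (λ x → pointwise⇒≈ (λ n → ℚ.*-identityˡ (seq x n)))
        , (λ x → pointwise⇒≈ (λ n → ℚ.*-identityʳ (seq x n)))
      ; distrib =
          (λ x y z → pointwise⇒≈ (λ n → ℚ.*-distribˡ-+ (seq x n) (seq y n) (seq z n)))
        , (λ x y z → pointwise⇒≈ (λ n → ℚ.*-distribʳ-+ (seq x n) (seq y n) (seq z n))) }
    ; *-comm = λ x y → pointwise⇒≈ (λ n → ℚ.*-comm (seq x n) (seq y n)) } }

module ℝ-Ops = RawSemiringDefs (Semiring.rawSemiring (CommutativeRing.semiring ℝ-commutativeRing))
module ℚ-Ops = RawSemiringDefs (Semiring.rawSemiring (CommutativeRing.semiring ℚ.+-*-commutativeRing))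

∑ : {A : Set} → List A → (A → ℝ) → ℝ
∑ xs f = ℝ-Ops.sum (λ i → f (List.lookup xs i))

-- Total division with value 0 at denominator 0; the denominators that
-- occur below (|slice|, n and n P 2d) are nonzero when 1 ≤ n, d ≤ k and
-- 2k ≤ n.
infixl 7 _÷_

_÷_ : ℕ → ℕ → ℚ
a ÷ zero  = 0ℚ
a ÷ suc b = + a ℚ./ suc b

fromℕ : ℕ → ℝ
fromℕ a = fromℚ (a ÷ 1)

allVecs : {A : Set} → List A → ∀ d → List (Vec A d)
allVecs xs zero    = Vec.[] ∷ []
allVecs xs (suc d) = List.cartesianProductWith Vec._∷_ xs (allVecs xs d)

Slice : ℕ → ℕ → Set
Slice n k = [ x ∈ Vec (Fin 2) n ∣ Vec.sum (Vec.map toℕ x) ≡ k ]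

toSlice : ∀ {n} k → Vec (Fin 2) n → Maybe (Slice n k)
toSlice k x with Vec.sum (Vec.map toℕ x) ℕ.≟ k
... | yes eq = just (x Refinement., [ eq ])
... | no  _  = nothing

-- Every point of the slice occurs in this list exactly once.
slicePoints : ∀ n k → List (Slice n k)
slicePoints n k = List.mapMaybe (toSlice k) (allVecs (List.allFin 2) n)

module _ {n k : ℕ} where

  coordinates : Slice n k → Vector ℝ n
  coordinates x i = fromℕ (toℕ (lookup (value x) i))

  restrict : (Vector ℝ n → ℝ) → (Slice n k → ℝ)
  restrict f x = f (coordinates x)

  𝔼 : (Slice n k → ℝ) → ℝ
  𝔼 f = fromℚ (1 ÷ List.length (slicePoints n k)) * ∑ (slicePoints n k) f

  ⟨_,_⟩ : (f g : Slice n k → ℝ) → ℝ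
  ⟨ f , g ⟩ = 𝔼 (λ x → f x * g x)

  ‖_‖² : (Slice n k → ℝ) → ℝ
  ‖ f ‖² = 𝔼 (λ x → f x * f x)

  module _ {I : Set} (e : I → (Slice n k → ℝ)) where

    LinearlyIndependent : Set
    LinearlyIndependent = (is : List I) → ListUnique.Unique is → (c : I → ℝ) →
      (∀ x → ∑ is (λ i → c i * e i x) ≈ 0ℝ) → ∀ {i} → i ∈ is → c i ≈ 0ℝ

    Spanning : Set
    Spanning = (f : Slice n k → ℝ) →
      Σ (List I) λ is → Σ (I → ℝ) λ c → ∀ x → f x ≈ ∑ is (λ i → c i * e i x)

    Orthogonal : Set
    Orthogonal = ∀ {i j} → i ≢ j → ⟨ e i , e j ⟩ ≈ 0ℝ

    IsOrthogonalBasis : Set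
    IsOrthogonalBasis = LinearlyIndependent × Spanning × Orthogonal

-- The element j of [n] = {1,…,n} is represented by the
-- element of Fin n with toℕ equal to j - 1.

module _ {n d : ℕ} where

  Disjoint : (A B : Vec (Fin n) d) → Set
  Disjoint A B = ∀ i j → lookup A i ≢ lookup B j

  infix 4 _≺_

  _≺_ : (A B : Vec (Fin n) d) → Set
  A ≺ B = ∀ i → lookup A i Fin.< lookup B i

  Increasing : Vec (Fin n) d → Set
  Increasing B = ∀ i j → i Fin.< j → lookup B i Fin.< lookup B j

  record Below (B A : Vec (Fin n) d) : Set where
    constructor mkBelow
    field
      distinct : Unique A
      disjoint : Disjoint A B
      smaller  : A ≺ B

  below? : ∀ B A → Dec (Below B A)
  below? B A = map′
    (λ (u , a , b) → mkBelow u a b)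
    (λ (mkBelow u a b) → u , a , b)
    (allPairs? (λ a b → ¬? (a Fin.≟ b)) A
      ×-dec Fin.all? (λ i → Fin.all? (λ j → ¬? (lookup A i Fin.≟ lookup B j)))
      ×-dec Fin.all? (λ i → lookup A i Fin.<? lookup B i))

  IsTopSet : Vec (Fin n) d → Set
  IsTopSet B = Increasing B × ∃ (Below B)

TopSet : ℕ → ℕ → Set
TopSet n d = [ B ∈ Vec (Fin n) d ∣ IsTopSet B ]

-- The top sets B ∈ 𝓑_{n,d} for some d ≤ k.  All proofs are irrelevant,
-- so two elements are equal iff their underlying sequences are.
record TopSetUpTo (n k : ℕ) : Set where
  constructor mkTopSetUpTo
  field
    d      : ℕ
    .d≤k   : d ℕ.≤ k
    topSet : TopSet n d

module _ {n d : ℕ} where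

  χ₂ : (A B : Vec (Fin n) d) → Vector ℝ n → ℝ
  χ₂ A B x = ℝ-Ops.product (λ i → x (lookup A i) - x (lookup B i))

  χ : TopSet n d → Vector ℝ n → ℝ
  χ B x = ∑ (List.filter (below? (value B)) (allVecs (List.allFin n) d))
            (λ A → χ₂ A (value B) x)

  -- (b - 2m)(b - 2m - 1)/2 with b = bᵢ ∈ [n] and m = i - 1.
  c-factor : TopSet n d → Fin d → ℚ
  c-factor B i = ((b ℤ.- + 2 ℤ.* m) ℤ.* (b ℤ.- + 2 ℤ.* m ℤ.- + 1)) ℚ./ 2
    where
    b m : ℤ
    b = + suc (toℕ (lookup (value B) i))
    m = + toℕ i

  c : TopSet n d → ℚ
  c B = ℚ-Ops.product (c-factor B)

χ-family : ∀ n k → TopSetUpTo n k → (Slice n k → ℝ)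
χ-family n k B = restrict (χ (TopSetUpTo.topSet B))

infix 4 _≈_[1±_]

_≈_[1±_] : ℝ → ℝ → ℝ → Set
X ≈ Y [1± δ ] = ((1ℝ - δ) * Y ≤ X) × (X ≤ (1ℝ + δ) * Y)

{-# OPTIONS --safe #-}
module Submission where

-- On 0/1 points, summing out the last element of A turns χ_B into a product over the elements b of B.
-- If s ones, z zeros and j elements of B precede b, its factor is s - j when x_b = 0 and -(z - j) when
-- x_b = 1: where χ_{A,B} ≠ 0 exactly one of x_{a_i}, x_{b_i} is 1, so the already used coordinates
-- contribute j ones and j zeros. Splitting the slice by its last coordinate, the inner products
-- then satisfy a Pascal-type recursion with solution 0 for B ≠ B' and 2^d c_B binom(n-2d, k-d) for B = B'.
-- The same splitting solves for the expansion of an arbitrary function, which gives spanning, and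
-- independence follows from orthogonality and positive norms.
-- For the asymptotics, kl/n² decreases when k, l, n are replaced by k-i, l-i, n-2i, whence the norm is at
-- most (n+1)/(n+1-2d) times (2p(1-p))^d c_B; a Bernoulli estimate gives the lower bound 1 - d²/k.

import Defs
open Defs using (allVecs; Increasing; Below; mkBelow; below?)
open import Algebra.Bundles using (CommutativeRing; Semiring)
import Algebra.Definitions.RawSemiring as RawSemiringDefs
import Algebra.Properties.CommutativeMonoid.Sum as CommutativeMonoidSum
import Algebra.Properties.CommutativeSemigroup as CommutativeSemigroupProperties
open import Data.Bool as Bool using (Bool; true; false; if_then_else_)
open import Data.Fin as Fin using (Fin; toℕ; inject₁)
import Data.Fin.Properties as Fin
open import Data.Integer as ℤ using (ℤ; +_)
import Data.Integer.Properties as ℤ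
open import Data.Integer.Tactic.RingSolver using (solve-∀)
open import Data.Irrelevant using ([_])
open import Data.List as List using (List; []; _∷_)
open import Data.List.Membership.Propositional using (_∈_)
open import Data.List.Membership.Propositional.Properties using (∈-filter⁻)
open import Data.List.Relation.Unary.All as ListAll using ([]; _∷_)
open import Data.List.Relation.Unary.AllPairs using ([]; _∷_)
open import Data.List.Relation.Unary.Any using (here; there)
import Data.List.Relation.Unary.Unique.Propositional as ListUnique
open import Data.Maybe using (Maybe; just; nothing; maybe)
open import Data.Nat as ℕ using (ℕ; zero; suc; z≤n; s≤s)
open import Data.Nat.Combinatorics.Base using (_P′_)
import Data.Nat.Properties as ℕ
import Data.Nat.Tactic.RingSolver as ℕRing
open import Data.Product using (Σ; ∃; ∃₂; _×_; _,_; proj₁; proj₂)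
open import Data.Rational as ℚ using (ℚ; 0ℚ; 1ℚ)
import Data.Rational.Properties as ℚ
open import Data.Rational.Solver using (module +-*-Solver)
open import Data.Rational.Unnormalised as ℚᵘ using (mkℚᵘ; *≡*)
import Data.Rational.Unnormalised.Properties as ℚᵘ
open import Data.Refinement as Refinement using (value)
open import Data.Sum using (_⊎_; inj₁; inj₂)
open import Data.Unit using (⊤; tt)
open import Data.Vec as Vec using (Vec; []; _∷_; lookup; _∷ʳ_; initLast)
import Data.Vec.Properties as Vec
open import Data.Vec.Functional using (Vector)
open import Data.Vec.Relation.Unary.All as All using (All; []; _∷_)
import Data.Vec.Relation.Unary.All.Properties as All
open import Data.Vec.Relation.Unary.AllPairs using ([]; _∷_)
open import Data.Vec.Relation.Unary.Unique.Propositional using (Unique)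
open import Function using (_∘_; id)
open import Level using (0ℓ)
open import Relation.Binary.PropositionalEquality as ≡ using (_≡_)
import Relation.Binary.Reasoning.Setoid as SetoidReasoning
open import Relation.Nullary using (Dec; yes; no; does; ¬_; ¬?; contradiction; recompute; _→-dec_; _×-dec_)

-- Sums over lists

-- The number of top sets is never compared with the dimension binom(n,k). Spanning is proved for
-- the larger family indexed by all 2^n Boolean vectors, where each step divides by n + 1 - 2j. This
-- works because a character vanishes at every point having fewer ones, or fewer zeros, than its set
-- has elements, so it is identically 0 once 2j > n. The ballot condition `Top` gives the Gram
-- recursion its closed form: it keeps n - 2j a natural number at every stage, so that it can serve
-- as the upper index of a binomial coefficient. Since χ_B is integral at 0/1 points, the character
-- computations stay in ℤ; ℝ enters only with the coefficients of an expansion or of a linear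
-- relation.

module ListSum (R : CommutativeRing 0ℓ 0ℓ) where
  open CommutativeRing R
  open RawSemiringDefs (Semiring.rawSemiring semiring) public using (sum; product)
  open CommutativeSemigroupProperties +-commutativeSemigroup using () renaming (interchange to +-interchange)
  open import Relation.Binary.Reasoning.Setoid setoid

  -- Recursion on the list itself, because `∑` runs over positions; `sum-lookup` is the bridge. The
  -- ring is a parameter since the same laws serve ℤ, where the values are computed, and ℝ, where
  -- the theorem is stated.
  sumOver : {A : Set} → List A → (A → Carrier) → Carrier
  sumOver []       f = 0#
  sumOver (x ∷ xs) f = f x + sumOver xs f

  module _ {A : Set} where

    sum-lookup : ∀ (xs : List A) f → sum (λ i → f (List.lookup xs i)) ≡ sumOver xs f
    sum-lookup []       f = ≡.refl
    sum-lookup (x ∷ xs) f = ≡.cong (λ e → f x + e) (sum-lookup xs f)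

    sumOver-cong : ∀ (xs : List A) {f g} → (∀ x → f x ≈ g x) → sumOver xs f ≈ sumOver xs g
    sumOver-cong []       eq = refl
    sumOver-cong (x ∷ xs) eq = +-cong (eq x) (sumOver-cong xs eq)

    sumOver-0 : ∀ (xs : List A) → sumOver xs (λ _ → 0#) ≈ 0#
    sumOver-0 []       = refl
    sumOver-0 (x ∷ xs) = trans (+-identityˡ _) (sumOver-0 xs)

    sumOver-+ : ∀ (xs : List A) f g → sumOver xs (λ x → f x + g x) ≈ sumOver xs f + sumOver xs g
    sumOver-+ []       f g = sym (+-identityˡ 0#)
    sumOver-+ (x ∷ xs) f g = trans (+-congˡ (sumOver-+ xs f g)) (+-interchange (f x) (g x) _ _)

    sumOver-*ˡ : ∀ (xs : List A) c f → sumOver xs (λ x → c * f x) ≈ c * sumOver xs f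
    sumOver-*ˡ []       c f = sym (zeroʳ c)
    sumOver-*ˡ (x ∷ xs) c f = trans (+-congˡ (sumOver-*ˡ xs c f)) (sym (distribˡ c _ _))

    sumOver-*ʳ : ∀ (xs : List A) c f → sumOver xs (λ x → f x * c) ≈ sumOver xs f * c
    sumOver-*ʳ xs c f = trans (sumOver-cong xs (λ x → *-comm (f x) c))
      (trans (sumOver-*ˡ xs c f) (*-comm c _))

    sumOver-++ : ∀ (xs ys : List A) f → sumOver (xs List.++ ys) f ≈ sumOver xs f + sumOver ys f
    sumOver-++ []       ys f = sym (+-identityˡ _)
    sumOver-++ (x ∷ xs) ys f = trans (+-congˡ (sumOver-++ xs ys f)) (sym (+-assoc _ _ _))

  module _ {A : Set} where

    sumOver-swap : {B : Set} (xs : List A) (ys : List B) (f : A → B → Carrier) →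
      sumOver xs (λ x → sumOver ys (f x)) ≈ sumOver ys (λ y → sumOver xs (λ x → f x y))
    sumOver-swap []       ys f = sym (sumOver-0 ys)
    sumOver-swap (x ∷ xs) ys f =
      trans (+-congˡ (sumOver-swap xs ys f)) (sym (sumOver-+ ys (f x) _))

    sumOver-map : {B : Set} (h : A → B) (xs : List A) (f : B → Carrier) →
      sumOver (List.map h xs) f ≈ sumOver xs (f ∘ h)
    sumOver-map h []       f = refl
    sumOver-map h (x ∷ xs) f = +-congˡ (sumOver-map h xs f)

    sumOver-mapMaybe : {B : Set} (h : A → Maybe B) (xs : List A) (f : B → Carrier) →
      sumOver (List.mapMaybe h xs) f ≈ sumOver xs (maybe f 0# ∘ h)
    sumOver-mapMaybe h []       f = refl
    sumOver-mapMaybe h (x ∷ xs) f with h x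
    ... | just y  = +-congˡ (sumOver-mapMaybe h xs f)
    ... | nothing = trans (sumOver-mapMaybe h xs f) (sym (+-identityˡ _))

    sumOver-filter : {P : A → Set} (P? : ∀ x → Dec (P x)) (xs : List A) (f : A → Carrier) →
      sumOver (List.filter P? xs) f ≈ sumOver xs (λ x → if does (P? x) then f x else 0#)
    sumOver-filter P? []       f = refl
    sumOver-filter P? (x ∷ xs) f with does (P? x)
    ... | true  = +-congˡ (sumOver-filter P? xs f)
    ... | false = trans (sumOver-filter P? xs f) (sym (+-identityˡ _))

    sumOver-tabulate : ∀ {n} (h : Fin n → A) f → sumOver (List.tabulate h) f ≈ sum (f ∘ h)
    sumOver-tabulate {zero}  h f = refl
    sumOver-tabulate {suc n} h f = +-congˡ (sumOver-tabulate (h ∘ Fin.suc) f)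

  module _ {A : Set} where

    sumOver-product : {B C : Set} (h : A → B → C) (xs : List A) (ys : List B) (f : C → Carrier) →
      sumOver (List.cartesianProductWith h xs ys) f ≈ sumOver xs (λ x → sumOver ys (f ∘ h x))
    sumOver-product h []       ys f = refl
    sumOver-product h (x ∷ xs) ys f =
      trans (sumOver-++ (List.map (h x) ys) _ f)
        (+-cong (sumOver-map (h x) ys f) (sumOver-product h xs ys f))

  module _ {A : Set} where

    -- `allVecs` attaches the new entry in front, whereas the induction on B removes its largest
    -- element, which stands last.
    sumOver-∷ʳ : ∀ (xs : List A) d (f : Vec A (suc d) → Carrier) →
      sumOver (allVecs xs (suc d)) f
        ≈ sumOver (allVecs xs d) (λ V → sumOver xs (λ a → f (V Vec.∷ʳ a)))
    sumOver-∷ʳ xs zero f = begin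
      sumOver (allVecs xs 1) f
        ≈⟨ sumOver-product Vec._∷_ xs (allVecs xs 0) f ⟩
      sumOver xs (λ a → f (a Vec.∷ Vec.[]) + 0#)
        ≈⟨ sumOver-cong xs (λ a → +-identityʳ _) ⟩
      sumOver xs (λ a → f (a Vec.∷ Vec.[]))
        ≈⟨ +-identityʳ _ ⟨
      sumOver xs (λ a → f (a Vec.∷ Vec.[])) + 0# ∎
    sumOver-∷ʳ xs (suc d) f = begin
      sumOver (allVecs xs (suc (suc d))) f
        ≈⟨ sumOver-product Vec._∷_ xs (allVecs xs (suc d)) f ⟩
      sumOver xs (λ a → sumOver (allVecs xs (suc d)) (λ V → f (a Vec.∷ V)))
        ≈⟨ sumOver-cong xs (λ a → sumOver-∷ʳ xs d (λ V → f (a Vec.∷ V))) ⟩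
      sumOver xs (λ a → sumOver (allVecs xs d) (λ V → sumOver xs (λ b → f (a Vec.∷ (V Vec.∷ʳ b)))))
        ≈⟨ sumOver-product Vec._∷_ xs (allVecs xs d) (λ V → sumOver xs (λ b → f (V Vec.∷ʳ b))) ⟨
      sumOver (allVecs xs (suc d)) (λ V → sumOver xs (λ a → f (V Vec.∷ʳ a))) ∎

    -- Reversal permutes all vectors of a given length. It reconciles points listed from the first
    -- coordinate with characters read from the last one.
    sumOver-reverse : ∀ (xs : List A) d (f : Vec A d → Carrier) →
      sumOver (allVecs xs d) f ≈ sumOver (allVecs xs d) (f ∘ Vec.reverse)
    sumOver-reverse xs zero    f = refl
    sumOver-reverse xs (suc d) f = begin
      sumOver (allVecs xs (suc d)) f
        ≈⟨ sumOver-∷ʳ xs d f ⟩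
      sumOver (allVecs xs d) (λ V → sumOver xs (λ a → f (V Vec.∷ʳ a)))
        ≈⟨ sumOver-reverse xs d _ ⟩
      sumOver (allVecs xs d) (λ V → sumOver xs (λ a → f (Vec.reverse V Vec.∷ʳ a)))
        ≈⟨ sumOver-cong (allVecs xs d) (λ V → sumOver-cong xs (λ a →
             reflexive (≡.cong f (≡.sym (Vec.reverse-∷ a V))))) ⟩
      sumOver (allVecs xs d) (λ V → sumOver xs (λ a → f (Vec.reverse (a Vec.∷ V))))
        ≈⟨ sumOver-swap xs (allVecs xs d) (λ a V → f (Vec.reverse (a Vec.∷ V))) ⟨
      sumOver xs (λ a → sumOver (allVecs xs d) (λ V → f (Vec.reverse (a Vec.∷ V))))
        ≈⟨ sumOver-product Vec._∷_ xs (allVecs xs d) (f ∘ Vec.reverse) ⟨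
      sumOver (allVecs xs (suc d)) (f ∘ Vec.reverse) ∎

open ≡ using (_≢_; refl; sym; trans; cong; cong₂; subst; module ≡-Reasoning)

-- Binomial coefficients

binomial : ℕ → ℕ → ℕ
binomial n       zero    = 1
binomial zero    (suc k) = 0
binomial (suc n) (suc k) = binomial n k ℕ.+ binomial n (suc k)

-- The two identities are proved together: absorption at `n` is Pascal's rule followed by the shift
-- at `n`, and the shift at `suc n` uses absorption at `n`. Subtraction in ℤ lets them hold for k >
-- n as well.
binomial-shift : ∀ n k →
  + suc k ℤ.* + binomial n (suc k) ≡ (+ n ℤ.- + k) ℤ.* + binomial n k
binomial-absorb : ∀ n k →
  + suc k ℤ.* + binomial (suc n) (suc k) ≡ + suc n ℤ.* + binomial n k

binomial-shift zero    zero    = refl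
binomial-shift zero    (suc k) = trans (ℤ.*-zeroʳ (+ suc (suc k))) (sym (ℤ.*-zeroʳ (+ 0 ℤ.- + suc k)))
binomial-shift (suc n) zero    = trans (binomial-absorb n 0) (lemma (+ suc n))
  where
  lemma : ∀ a → a ℤ.* + 1 ≡ (a ℤ.- + 0) ℤ.* + 1
  lemma = solve-∀
binomial-shift (suc n) (suc k) = begin
  + suc (suc k) ℤ.* + binomial (suc n) (suc (suc k))
    ≡⟨ binomial-absorb n (suc k) ⟩
  + suc n ℤ.* + b₁
    ≡⟨ split (+ suc n) (+ suc k) (+ b₁) ⟩
  + suc k ℤ.* + b₁ ℤ.+ (+ suc n ℤ.- + suc k) ℤ.* + b₁
    ≡⟨ cong (ℤ._+ (+ suc n ℤ.- + suc k) ℤ.* + b₁) (binomial-shift n k) ⟩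
  (+ n ℤ.- + k) ℤ.* + b₀ ℤ.+ (+ suc n ℤ.- + suc k) ℤ.* + b₁
    ≡⟨ merge (+ n) (+ k) (+ b₀) (+ b₁) ⟩
  (+ suc n ℤ.- + suc k) ℤ.* + binomial (suc n) (suc k) ∎
  where
  open ≡-Reasoning
  b₀ = binomial n k
  b₁ = binomial n (suc k)
  split : ∀ a b c → a ℤ.* c ≡ b ℤ.* c ℤ.+ (a ℤ.- b) ℤ.* c
  split = solve-∀
  merge : ∀ a b c d → (a ℤ.- b) ℤ.* c ℤ.+ (+ 1 ℤ.+ a ℤ.- (+ 1 ℤ.+ b)) ℤ.* d
    ≡ (+ 1 ℤ.+ a ℤ.- (+ 1 ℤ.+ b)) ℤ.* (c ℤ.+ d)
  merge = solve-∀
binomial-absorb n k = begin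
  + suc k ℤ.* (+ b₀ ℤ.+ + b₁)
    ≡⟨ ℤ.*-distribˡ-+ (+ suc k) (+ b₀) (+ b₁) ⟩
  + suc k ℤ.* + b₀ ℤ.+ + suc k ℤ.* + b₁
    ≡⟨ cong (λ a → + suc k ℤ.* + b₀ ℤ.+ a) (binomial-shift n k) ⟩
  + suc k ℤ.* + b₀ ℤ.+ (+ n ℤ.- + k) ℤ.* + b₀
    ≡⟨ merge (+ n) (+ k) (+ b₀) ⟩
  + suc n ℤ.* + b₀ ∎
  where
  open ≡-Reasoning
  b₀ = binomial n k
  b₁ = binomial n (suc k)
  merge : ∀ a b c → (+ 1 ℤ.+ b) ℤ.* c ℤ.+ (a ℤ.- b) ℤ.* c ≡ (+ 1 ℤ.+ a) ℤ.* c
  merge = solve-∀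

-- binomial m (s - d), with value 0 for s < d.
shifted : ℕ → ℕ → ℕ → ℕ
shifted zero    m s       = binomial m s
shifted (suc d) m zero    = 0
shifted (suc d) m (suc s) = shifted d m s

shifted-pascal₀ : ∀ d m → shifted d (suc m) 0 ≡ shifted d m 0
shifted-pascal₀ zero    m = refl
shifted-pascal₀ (suc d) m = refl

shifted-pascal : ∀ d m s → shifted d (suc m) (suc s) ≡ shifted d m (suc s) ℕ.+ shifted d m s
shifted-pascal zero    m s       = ℕ.+-comm (binomial m s) (binomial m (suc s))
shifted-pascal (suc d) m zero    = trans (shifted-pascal₀ d m) (sym (ℕ.+-identityʳ _))
shifted-pascal (suc d) m (suc s) = shifted-pascal d m s

-- Up to sign this is the boundary case s = -1 of `shifted-shift`: either `d` is 0 or the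
-- coefficient is.
shifted-shift₀ : ∀ d m → + d ℤ.* + shifted d m 0 ≡ + 0
shifted-shift₀ zero    m = refl
shifted-shift₀ (suc d) m = ℤ.*-zeroʳ (+ suc d)

shifted-shift : ∀ d m s →
  (+ suc s ℤ.- + d) ℤ.* + shifted d m (suc s) ≡ (+ m ℤ.- (+ s ℤ.- + d)) ℤ.* + shifted d m s
shifted-shift zero m s = begin
  (+ suc s ℤ.- + 0) ℤ.* + binomial m (suc s) ≡⟨ cong (ℤ._* + binomial m (suc s)) (ℤ.+-identityʳ (+ suc s)) ⟩
  + suc s ℤ.* + binomial m (suc s)           ≡⟨ binomial-shift m s ⟩
  (+ m ℤ.- + s) ℤ.* + binomial m s           ≡⟨ cong (λ a → (+ m ℤ.- a) ℤ.* + binomial m s) (ℤ.+-identityʳ (+ s)) ⟨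
  (+ m ℤ.- (+ s ℤ.- + 0)) ℤ.* + binomial m s ∎
  where open ≡-Reasoning
shifted-shift (suc d) m zero = begin
  (+ 1 ℤ.- + suc d) ℤ.* + shifted d m 0     ≡⟨ lemma (+ d) (+ shifted d m 0) ⟩
  ℤ.- (+ d ℤ.* + shifted d m 0)             ≡⟨ cong ℤ.-_ (shifted-shift₀ d m) ⟩
  + 0                                       ≡⟨ ℤ.*-zeroʳ (+ m ℤ.- (+ 0 ℤ.- + suc d)) ⟨
  (+ m ℤ.- (+ 0 ℤ.- + suc d)) ℤ.* + 0 ∎
  where
  open ≡-Reasoning
  lemma : ∀ a b → (+ 1 ℤ.- (+ 1 ℤ.+ a)) ℤ.* b ≡ ℤ.- (a ℤ.* b)
  lemma = solve-∀
shifted-shift (suc d) m (suc s) = begin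
  (+ suc (suc s) ℤ.- + suc d) ℤ.* + shifted d m (suc s)
    ≡⟨ cong (ℤ._* + shifted d m (suc s)) (cancel (+ suc s) (+ d)) ⟩
  (+ suc s ℤ.- + d) ℤ.* + shifted d m (suc s)
    ≡⟨ shifted-shift d m s ⟩
  (+ m ℤ.- (+ s ℤ.- + d)) ℤ.* + shifted d m s
    ≡⟨ cong (λ a → (+ m ℤ.- a) ℤ.* + shifted d m s) (cancel (+ s) (+ d)) ⟨
  (+ m ℤ.- (+ suc s ℤ.- + suc d)) ℤ.* + shifted d m s ∎
  where
  open ≡-Reasoning
  cancel : ∀ a b → (+ 1 ℤ.+ a) ℤ.- (+ 1 ℤ.+ b) ≡ a ℤ.- b
  cancel = solve-∀

shifted-absorb : ∀ d m s →
  (+ suc s ℤ.- + d) ℤ.* + shifted d (suc m) (suc s) ≡ + suc m ℤ.* + shifted d m s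
shifted-absorb d m s = begin
  (+ suc s ℤ.- + d) ℤ.* + shifted d (suc m) (suc s)
    ≡⟨ cong (λ a → (+ suc s ℤ.- + d) ℤ.* + a) (shifted-pascal d m s) ⟩
  (+ suc s ℤ.- + d) ℤ.* (+ g₁ ℤ.+ + g₀)
    ≡⟨ ℤ.*-distribˡ-+ (+ suc s ℤ.- + d) (+ g₁) (+ g₀) ⟩
  (+ suc s ℤ.- + d) ℤ.* + g₁ ℤ.+ (+ suc s ℤ.- + d) ℤ.* + g₀
    ≡⟨ cong (ℤ._+ (+ suc s ℤ.- + d) ℤ.* + g₀) (shifted-shift d m s) ⟩
  (+ m ℤ.- (+ s ℤ.- + d)) ℤ.* + g₀ ℤ.+ (+ suc s ℤ.- + d) ℤ.* + g₀
    ≡⟨ merge (+ m) (+ s) (+ d) (+ g₀) ⟩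
  + suc m ℤ.* + g₀ ∎
  where
  open ≡-Reasoning
  g₀ = shifted d m s
  g₁ = shifted d m (suc s)
  merge : ∀ m s d g → (m ℤ.- (s ℤ.- d)) ℤ.* g ℤ.+ (+ 1 ℤ.+ s ℤ.- d) ℤ.* g ≡ (+ 1 ℤ.+ m) ℤ.* g
  merge = solve-∀

-- The Gram matrix of the characters

ones : ∀ {n} → Vec (Fin 2) n → ℕ
ones x = Vec.sum (Vec.map toℕ x)

pattern 0# = Fin.zero
pattern 1# = Fin.suc Fin.zero

card : ∀ {n} → Vec Bool n → ℕ
card []          = 0
card (false ∷ S) = card S
card (true  ∷ S) = suc (card S)

-- The factor contributed to χ_B by an element of B at a coordinate with value 0 (resp. 1) that is
-- preceded by n coordinates, of which o equal 1, and by j elements of B.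
factor₀ factor₁ : ℕ → ℕ → ℕ → ℤ
factor₀ n o j = + o ℤ.- + j
factor₁ n o j = + o ℤ.+ + j ℤ.- + n

-- Both vectors are read backwards: their heads belong to the last coordinate.
character : ∀ {n} → Vec (Fin 2) n → Vec Bool n → ℤ
character []           []          = + 1
character (_ ∷ x)      (false ∷ S) = character x S
character {suc n} (0# ∷ x) (true ∷ S) = factor₀ n (ones x) (card S) ℤ.* character x S
character {suc n} (1# ∷ x) (true ∷ S) = factor₁ n (ones x) (card S) ℤ.* character x S

-- The sum over the points with s ones, defined by splitting off the head bit, so that inner
-- products satisfy a Pascal-type recursion by computation.
levelSum : ∀ n → ℕ → (Vec (Fin 2) n → ℤ) → ℤ
levelSum zero    zero    f = f []
levelSum zero    (suc s) f = + 0
levelSum (suc n) zero    f = levelSum n zero (f ∘ (0# ∷_))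
levelSum (suc n) (suc s) f = levelSum n (suc s) (f ∘ (0# ∷_)) ℤ.+ levelSum n s (f ∘ (1# ∷_))

-- The equation is demanded only on the level itself: there a multiplier depending on the point
-- through `ones` is constant, which is how `factor₀` and `factor₁` leave the sum.
levelSum-scale : ∀ n s a {f g} → (∀ x → ones x ≡ s → f x ≡ a ℤ.* g x) →
  levelSum n s f ≡ a ℤ.* levelSum n s g
levelSum-scale zero    zero    a eq = eq [] refl
levelSum-scale zero    (suc s) a eq = sym (ℤ.*-zeroʳ a)
levelSum-scale (suc n) zero    a eq = levelSum-scale n zero a (eq ∘ (0# ∷_))
levelSum-scale (suc n) (suc s) a eq = trans
  (cong₂ ℤ._+_ (levelSum-scale n (suc s) a (eq ∘ (0# ∷_)))
               (levelSum-scale n s a (λ x e → eq (1# ∷ x) (cong suc e))))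
  (sym (ℤ.*-distribˡ-+ a _ _))

levelSum-cong : ∀ n s {f g} → (∀ x → ones x ≡ s → f x ≡ g x) → levelSum n s f ≡ levelSum n s g
levelSum-cong n s eq = trans
  (levelSum-scale n s (+ 1) (λ x e → trans (eq x e) (sym (ℤ.*-identityˡ _)))) (ℤ.*-identityˡ _)

-- The ballot condition: each initial segment of [n] contains at least as many elements outside the
-- set as inside it. Tails of the vector are initial segments of [n].
Top : ∀ {n} → Vec Bool n → Set
Top []                = ⊤
Top {suc n} S@(_ ∷ T) = Top T × card S ℕ.+ card S ℕ.≤ suc n

top⇒2card≤n : ∀ {n} (S : Vec Bool n) → Top S → card S ℕ.+ card S ℕ.≤ n
top⇒2card≤n []      _       = z≤n
top⇒2card≤n (_ ∷ S) (_ , p) = p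

-- This is 2^d c_B. Leaving out the halves keeps it an integer; here b = n + 1 and the number of
-- earlier elements is `card S`.
normConst : ∀ {n} → Vec Bool n → ℤ
normConst []                  = + 1
normConst (false ∷ S)         = normConst S
normConst {suc n} (true ∷ S)  =
  (+ suc n ℤ.- + 2 ℤ.* + card S) ℤ.* (+ suc n ℤ.- + 2 ℤ.* + card S ℤ.- + 1) ℤ.* normConst S

gram : ∀ {n} → ℕ → (S T : Vec Bool n) → ℤ
gram {n} s S T = levelSum n s (λ x → character x S ℤ.* character x T)

gram-comm : ∀ {n} s (S T : Vec Bool n) → gram s S T ≡ gram s T S
gram-comm {n} s S T = levelSum-cong n s (λ x _ → ℤ.*-comm (character x S) (character x T))

module _ {n : ℕ} (S T : Vec Bool n) where

  levelSum-scale₁ : ∀ s (φ : ℕ → ℤ) →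
    levelSum n s (λ x → φ (ones x) ℤ.* character x S ℤ.* character x T) ≡ φ s ℤ.* gram s S T
  levelSum-scale₁ s φ = levelSum-scale n s (φ s) {g = λ x → character x S ℤ.* character x T} (λ x e →
    trans (cong (λ o → φ o ℤ.* character x S ℤ.* character x T) e) (ℤ.*-assoc (φ s) (character x S) (character x T)))

  levelSum-scale₂ : ∀ s (φ ψ : ℕ → ℤ) →
    levelSum n s (λ x → (φ (ones x) ℤ.* character x S) ℤ.* (ψ (ones x) ℤ.* character x T)) ≡ φ s ℤ.* ψ s ℤ.* gram s S T
  levelSum-scale₂ s φ ψ = levelSum-scale n s (φ s ℤ.* ψ s) {g = λ x → character x S ℤ.* character x T} (λ x e →
    trans (cong (λ o → (φ o ℤ.* character x S) ℤ.* (ψ o ℤ.* character x T)) e) (interchange (φ s) (ψ s) (character x S) (character x T)))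
    where
    interchange : ∀ a b y z → (a ℤ.* y) ℤ.* (b ℤ.* z) ≡ (a ℤ.* b) ℤ.* (y ℤ.* z)
    interchange = solve-∀

  gram-true-true₀ :
    gram 0 (true ∷ S) (true ∷ T) ≡ factor₀ n 0 (card S) ℤ.* factor₀ n 0 (card T) ℤ.* gram 0 S T
  gram-true-true₀ = levelSum-scale₂ 0 (λ o → factor₀ n o (card S)) (λ o → factor₀ n o (card T))

  gram-true-true : ∀ s → gram (suc s) (true ∷ S) (true ∷ T)
    ≡ factor₀ n (suc s) (card S) ℤ.* factor₀ n (suc s) (card T) ℤ.* gram (suc s) S T
      ℤ.+ factor₁ n s (card S) ℤ.* factor₁ n s (card T) ℤ.* gram s S T
  gram-true-true s = cong₂ ℤ._+_
    (levelSum-scale₂ (suc s) (λ o → factor₀ n o (card S)) (λ o → factor₀ n o (card T)))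
    (levelSum-scale₂ s (λ o → factor₁ n o (card S)) (λ o → factor₁ n o (card T)))

  gram-true-false₀ : gram 0 (true ∷ S) (false ∷ T) ≡ factor₀ n 0 (card S) ℤ.* gram 0 S T
  gram-true-false₀ = levelSum-scale₁ 0 (λ o → factor₀ n o (card S))

  gram-true-false : ∀ s → gram (suc s) (true ∷ S) (false ∷ T)
    ≡ factor₀ n (suc s) (card S) ℤ.* gram (suc s) S T ℤ.+ factor₁ n s (card S) ℤ.* gram s S T
  gram-true-false s = cong₂ ℤ._+_
    (levelSum-scale₁ (suc s) (λ o → factor₀ n o (card S)))
    (levelSum-scale₁ s (λ o → factor₁ n o (card S)))

-- Here m = n - 2d. When the last coordinate is outside the set, the claim is Pascal's rule. When it
-- is inside, with j earlier elements, put α = s + 1 - j and β = m + 1 - (s - j). The two halves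
-- contribute α² binom(m+1, s+1-j) and β² binom(m+1, s-j); both α binom(m+1, s+1-j) and β binom(m+1,
-- s-j) equal (m+1) binom(m, s-j), so the total is (α + β)(m+1) binom(m, s-j) with α + β = m + 2.
gram-diagonal : ∀ {n} (S : Vec Bool n) → Top S → ∀ m s → n ≡ card S ℕ.+ card S ℕ.+ m →
  gram s S S ≡ normConst S ℤ.* + shifted (card S) m s
gram-diagonal []          _           m zero    refl = refl
gram-diagonal []          _           m (suc s) refl = refl
-- m = 0 would mean 2|S| = n + 1, against the ballot condition for the tail, which gives 2|S| ≤ n.
gram-diagonal {suc n} (false ∷ S) (top , _) zero s eq =
  contradiction (ℕ.≤-trans (ℕ.≤-reflexive (trans eq (ℕ.+-identityʳ _))) (top⇒2card≤n S top))
    (ℕ.<⇒≱ (ℕ.n<1+n n))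
gram-diagonal {suc n} (false ∷ S) (top , _) (suc m) zero eq = begin
  gram 0 S S                                  ≡⟨ gram-diagonal S top m 0 n≡ ⟩
  normConst S ℤ.* + shifted (card S) m 0       ≡⟨ cong (λ a → normConst S ℤ.* + a) (shifted-pascal₀ (card S) m) ⟨
  normConst S ℤ.* + shifted (card S) (suc m) 0 ∎
  where
  open ≡-Reasoning
  n≡ : n ≡ card S ℕ.+ card S ℕ.+ m
  n≡ = ℕ.suc-injective (trans eq (ℕ.+-suc _ m))
gram-diagonal {suc n} (false ∷ S) (top , _) (suc m) (suc s) eq = begin
  gram (suc s) S S ℤ.+ gram s S S
    ≡⟨ cong₂ ℤ._+_ (gram-diagonal S top m (suc s) n≡) (gram-diagonal S top m s n≡) ⟩
  normConst S ℤ.* + shifted (card S) m (suc s) ℤ.+ normConst S ℤ.* + shifted (card S) m s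
    ≡⟨ ℤ.*-distribˡ-+ (normConst S) (+ shifted (card S) m (suc s)) (+ shifted (card S) m s) ⟨
  normConst S ℤ.* + (shifted (card S) m (suc s) ℕ.+ shifted (card S) m s)
    ≡⟨ cong (λ a → normConst S ℤ.* + a) (shifted-pascal (card S) m s) ⟨
  normConst S ℤ.* + shifted (card S) (suc m) (suc s) ∎
  where
  open ≡-Reasoning
  n≡ : n ≡ card S ℕ.+ card S ℕ.+ m
  n≡ = ℕ.suc-injective (trans eq (ℕ.+-suc _ m))
gram-diagonal {suc n} (true ∷ S) (top , _) m s eq = go s
  where
  open ≡-Reasoning
  j = card S
  κ = normConst S
  n≡ : n ≡ j ℕ.+ j ℕ.+ suc m
  n≡ = trans (ℕ.suc-injective eq) (trans (cong (ℕ._+ m) (ℕ.+-suc j j)) (sym (ℕ.+-suc (j ℕ.+ j) m)))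
  n≡ℤ : + n ≡ + j ℤ.+ + j ℤ.+ + suc m
  n≡ℤ = cong +_ n≡
  go : ∀ s → gram s (true ∷ S) (true ∷ S)
    ≡ (+ suc n ℤ.- + 2 ℤ.* + j) ℤ.* (+ suc n ℤ.- + 2 ℤ.* + j ℤ.- + 1) ℤ.* κ ℤ.* + shifted (suc j) m s
  go zero = begin
    gram 0 (true ∷ S) (true ∷ S)
      ≡⟨ gram-true-true₀ S S ⟩
    (+ 0 ℤ.- + j) ℤ.* (+ 0 ℤ.- + j) ℤ.* gram 0 S S
      ≡⟨ cong ((+ 0 ℤ.- + j) ℤ.* (+ 0 ℤ.- + j) ℤ.*_) (gram-diagonal S top (suc m) 0 n≡) ⟩
    (+ 0 ℤ.- + j) ℤ.* (+ 0 ℤ.- + j) ℤ.* (κ ℤ.* + shifted j (suc m) 0)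
      ≡⟨ regroup (+ j) κ (+ shifted j (suc m) 0) ⟩
    + j ℤ.* κ ℤ.* (+ j ℤ.* + shifted j (suc m) 0)
      ≡⟨ cong (+ j ℤ.* κ ℤ.*_) (shifted-shift₀ j (suc m)) ⟩
    + j ℤ.* κ ℤ.* + 0
      ≡⟨ ℤ.*-zeroʳ (+ j ℤ.* κ) ⟩
    + 0
      ≡⟨ ℤ.*-zeroʳ ((+ suc n ℤ.- + 2 ℤ.* + j) ℤ.* (+ suc n ℤ.- + 2 ℤ.* + j ℤ.- + 1) ℤ.* κ) ⟨
    (+ suc n ℤ.- + 2 ℤ.* + j) ℤ.* (+ suc n ℤ.- + 2 ℤ.* + j ℤ.- + 1) ℤ.* κ ℤ.* + 0 ∎
    where
    regroup : ∀ a b c → (+ 0 ℤ.- a) ℤ.* (+ 0 ℤ.- a) ℤ.* (b ℤ.* c) ≡ a ℤ.* b ℤ.* (a ℤ.* c)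
    regroup = solve-∀
  go (suc s) = begin
    gram (suc s) (true ∷ S) (true ∷ S)
      ≡⟨ gram-true-true S S s ⟩
    α ℤ.* α ℤ.* gram (suc s) S S ℤ.+ (+ s ℤ.+ + j ℤ.- + n) ℤ.* (+ s ℤ.+ + j ℤ.- + n) ℤ.* gram s S S
      ≡⟨ cong₂ (λ a b → α ℤ.* α ℤ.* a ℤ.+ (+ s ℤ.+ + j ℤ.- + n) ℤ.* (+ s ℤ.+ + j ℤ.- + n) ℤ.* b)
           (gram-diagonal S top (suc m) (suc s) n≡) (gram-diagonal S top (suc m) s n≡) ⟩
    α ℤ.* α ℤ.* (κ ℤ.* + g₁) ℤ.+ (+ s ℤ.+ + j ℤ.- + n) ℤ.* (+ s ℤ.+ + j ℤ.- + n) ℤ.* (κ ℤ.* + g₀)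
      ≡⟨ cong (λ a → α ℤ.* α ℤ.* (κ ℤ.* + g₁) ℤ.+ (+ s ℤ.+ + j ℤ.- a) ℤ.* (+ s ℤ.+ + j ℤ.- a) ℤ.* (κ ℤ.* + g₀)) n≡ℤ ⟩
    α ℤ.* α ℤ.* (κ ℤ.* + g₁)
      ℤ.+ (+ s ℤ.+ + j ℤ.- (+ j ℤ.+ + j ℤ.+ + suc m)) ℤ.* (+ s ℤ.+ + j ℤ.- (+ j ℤ.+ + j ℤ.+ + suc m)) ℤ.* (κ ℤ.* + g₀)
      ≡⟨ regroup (+ s) (+ j) (+ suc m) κ (+ g₁) (+ g₀) ⟩
    κ ℤ.* (α ℤ.* (α ℤ.* + g₁) ℤ.+ (+ suc m ℤ.- (+ s ℤ.- + j)) ℤ.* ((+ suc m ℤ.- (+ s ℤ.- + j)) ℤ.* + g₀))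
      ≡⟨ cong (λ a → κ ℤ.* (α ℤ.* (α ℤ.* + g₁) ℤ.+ (+ suc m ℤ.- (+ s ℤ.- + j)) ℤ.* a)) (shifted-shift j (suc m) s) ⟨
    κ ℤ.* (α ℤ.* (α ℤ.* + g₁) ℤ.+ (+ suc m ℤ.- (+ s ℤ.- + j)) ℤ.* (α ℤ.* + g₁))
      ≡⟨ cong (λ a → κ ℤ.* (α ℤ.* a ℤ.+ (+ suc m ℤ.- (+ s ℤ.- + j)) ℤ.* a)) (shifted-absorb j m s) ⟩
    κ ℤ.* (α ℤ.* (+ suc m ℤ.* + g) ℤ.+ (+ suc m ℤ.- (+ s ℤ.- + j)) ℤ.* (+ suc m ℤ.* + g))
      ≡⟨ collect (+ s) (+ j) (+ suc m) κ (+ g) ⟩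
    (+ 1 ℤ.+ (+ j ℤ.+ + j ℤ.+ + suc m) ℤ.- + 2 ℤ.* + j)
      ℤ.* (+ 1 ℤ.+ (+ j ℤ.+ + j ℤ.+ + suc m) ℤ.- + 2 ℤ.* + j ℤ.- + 1) ℤ.* κ ℤ.* + g
      ≡⟨ cong (λ a → (+ 1 ℤ.+ a ℤ.- + 2 ℤ.* + j) ℤ.* (+ 1 ℤ.+ a ℤ.- + 2 ℤ.* + j ℤ.- + 1) ℤ.* κ ℤ.* + g) n≡ℤ ⟨
    (+ suc n ℤ.- + 2 ℤ.* + j) ℤ.* (+ suc n ℤ.- + 2 ℤ.* + j ℤ.- + 1) ℤ.* κ ℤ.* + g ∎
    where
    α = + suc s ℤ.- + j
    g₀ = shifted j (suc m) s
    g₁ = shifted j (suc m) (suc s)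
    g = shifted j m s
    regroup : ∀ s j m κ g₁ g₀ →
      (+ 1 ℤ.+ s ℤ.- j) ℤ.* (+ 1 ℤ.+ s ℤ.- j) ℤ.* (κ ℤ.* g₁)
        ℤ.+ (s ℤ.+ j ℤ.- (j ℤ.+ j ℤ.+ m)) ℤ.* (s ℤ.+ j ℤ.- (j ℤ.+ j ℤ.+ m)) ℤ.* (κ ℤ.* g₀)
      ≡ κ ℤ.* ((+ 1 ℤ.+ s ℤ.- j) ℤ.* ((+ 1 ℤ.+ s ℤ.- j) ℤ.* g₁) ℤ.+ (m ℤ.- (s ℤ.- j)) ℤ.* ((m ℤ.- (s ℤ.- j)) ℤ.* g₀))
    regroup = solve-∀
    collect : ∀ s j m κ g →
      κ ℤ.* ((+ 1 ℤ.+ s ℤ.- j) ℤ.* (m ℤ.* g) ℤ.+ (m ℤ.- (s ℤ.- j)) ℤ.* (m ℤ.* g))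
      ≡ (+ 1 ℤ.+ (j ℤ.+ j ℤ.+ m) ℤ.- + 2 ℤ.* j) ℤ.* (+ 1 ℤ.+ (j ℤ.+ j ℤ.+ m) ℤ.- + 2 ℤ.* j ℤ.- + 1) ℤ.* κ ℤ.* g
    collect = solve-∀

-- The two halves contribute (s+1-j) binom(m, s+1-j) and -(m-(s-j)) binom(m, s-j), which cancel by
-- `shifted-shift`: a new element makes the character orthogonal to the one it extends.
gram-true-false-same : ∀ {n} (S : Vec Bool n) → Top S → ∀ s → gram s (true ∷ S) (false ∷ S) ≡ + 0
gram-true-false-same {n} S top s = go s
  where
  open ≡-Reasoning
  j = card S
  κ = normConst S
  m = n ℕ.∸ (j ℕ.+ j)
  n≡ : n ≡ j ℕ.+ j ℕ.+ m
  n≡ = sym (ℕ.m+[n∸m]≡n (top⇒2card≤n S top))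
  go : ∀ s → gram s (true ∷ S) (false ∷ S) ≡ + 0
  go zero = begin
    gram 0 (true ∷ S) (false ∷ S)                ≡⟨ gram-true-false₀ S S ⟩
    (+ 0 ℤ.- + j) ℤ.* gram 0 S S                 ≡⟨ cong ((+ 0 ℤ.- + j) ℤ.*_) (gram-diagonal S top m 0 n≡) ⟩
    (+ 0 ℤ.- + j) ℤ.* (κ ℤ.* + shifted j m 0)    ≡⟨ regroup (+ j) κ (+ shifted j m 0) ⟩
    ℤ.- κ ℤ.* (+ j ℤ.* + shifted j m 0)          ≡⟨ cong (ℤ.- κ ℤ.*_) (shifted-shift₀ j m) ⟩
    ℤ.- κ ℤ.* + 0                                ≡⟨ ℤ.*-zeroʳ (ℤ.- κ) ⟩
    + 0 ∎
    where
    regroup : ∀ a b c → (+ 0 ℤ.- a) ℤ.* (b ℤ.* c) ≡ ℤ.- b ℤ.* (a ℤ.* c)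
    regroup = solve-∀
  go (suc s) = begin
    gram (suc s) (true ∷ S) (false ∷ S)
      ≡⟨ gram-true-false S S s ⟩
    (+ suc s ℤ.- + j) ℤ.* gram (suc s) S S ℤ.+ (+ s ℤ.+ + j ℤ.- + n) ℤ.* gram s S S
      ≡⟨ cong₂ (λ a b → (+ suc s ℤ.- + j) ℤ.* a ℤ.+ (+ s ℤ.+ + j ℤ.- + n) ℤ.* b)
           (gram-diagonal S top m (suc s) n≡) (gram-diagonal S top m s n≡) ⟩
    (+ suc s ℤ.- + j) ℤ.* (κ ℤ.* + g₁) ℤ.+ (+ s ℤ.+ + j ℤ.- + n) ℤ.* (κ ℤ.* + g₀)
      ≡⟨ cong (λ a → (+ suc s ℤ.- + j) ℤ.* (κ ℤ.* + g₁) ℤ.+ (+ s ℤ.+ + j ℤ.- + a) ℤ.* (κ ℤ.* + g₀)) n≡ ⟩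
    (+ suc s ℤ.- + j) ℤ.* (κ ℤ.* + g₁) ℤ.+ (+ s ℤ.+ + j ℤ.- (+ j ℤ.+ + j ℤ.+ + m)) ℤ.* (κ ℤ.* + g₀)
      ≡⟨ regroup (+ s) (+ j) (+ m) κ (+ g₁) (+ g₀) ⟩
    κ ℤ.* ((+ suc s ℤ.- + j) ℤ.* + g₁ ℤ.- (+ m ℤ.- (+ s ℤ.- + j)) ℤ.* + g₀)
      ≡⟨ cong (λ a → κ ℤ.* (a ℤ.- (+ m ℤ.- (+ s ℤ.- + j)) ℤ.* + g₀)) (shifted-shift j m s) ⟩
    κ ℤ.* ((+ m ℤ.- (+ s ℤ.- + j)) ℤ.* + g₀ ℤ.- (+ m ℤ.- (+ s ℤ.- + j)) ℤ.* + g₀)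
      ≡⟨ cong (κ ℤ.*_) (ℤ.+-inverseʳ ((+ m ℤ.- (+ s ℤ.- + j)) ℤ.* + g₀)) ⟩
    κ ℤ.* + 0
      ≡⟨ ℤ.*-zeroʳ κ ⟩
    + 0 ∎
    where
    g₀ = shifted j m s
    g₁ = shifted j m (suc s)
    regroup : ∀ s j m κ g₁ g₀ →
      (+ 1 ℤ.+ s ℤ.- j) ℤ.* (κ ℤ.* g₁) ℤ.+ (s ℤ.+ j ℤ.- (j ℤ.+ j ℤ.+ m)) ℤ.* (κ ℤ.* g₀)
      ≡ κ ℤ.* ((+ 1 ℤ.+ s ℤ.- j) ℤ.* g₁ ℤ.- (m ℤ.- (s ℤ.- j)) ℤ.* g₀)
    regroup = solve-∀

-- If the tails differ, each half is a multiple of an inner product of distinct tails and vanishes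
-- by induction. Equal tails leave only a difference in the heads, which is `gram-true-false-same`.
gram-off-diagonal : ∀ {n} (S T : Vec Bool n) → Top S → Top T → S ≢ T → ∀ s → gram s S T ≡ + 0
gram-true-false-zero : ∀ {n} (S T : Vec Bool n) → Top S → Top T → ∀ s → gram s (true ∷ S) (false ∷ T) ≡ + 0

gram-off-diagonal []          []          _         _          S≢T s = contradiction refl S≢T
gram-off-diagonal (false ∷ S) (false ∷ T) (top , _) (top′ , _) S≢T zero =
  gram-off-diagonal S T top top′ (S≢T ∘ cong (false ∷_)) zero
gram-off-diagonal (false ∷ S) (false ∷ T) (top , _) (top′ , _) S≢T (suc s) =
  cong₂ ℤ._+_ (gram-off-diagonal S T top top′ (S≢T ∘ cong (false ∷_)) (suc s))
              (gram-off-diagonal S T top top′ (S≢T ∘ cong (false ∷_)) s)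
gram-off-diagonal (true ∷ S)  (false ∷ T) (top , _) (top′ , _) _   s = gram-true-false-zero S T top top′ s
gram-off-diagonal (false ∷ S) (true ∷ T)  (top , _) (top′ , _) _   s =
  trans (gram-comm s (false ∷ S) (true ∷ T)) (gram-true-false-zero T S top′ top s)
gram-off-diagonal {suc n} (true ∷ S) (true ∷ T) (top , _) (top′ , _) S≢T zero = trans (gram-true-true₀ S T)
  (trans (cong (a ℤ.*_) (gram-off-diagonal S T top top′ (S≢T ∘ cong (true ∷_)) 0)) (ℤ.*-zeroʳ a))
  where
  a = factor₀ n 0 (card S) ℤ.* factor₀ n 0 (card T)
gram-off-diagonal {suc n} (true ∷ S) (true ∷ T) (top , _) (top′ , _) S≢T (suc s) = trans (gram-true-true S T s)
  (trans (cong₂ (λ y z → a ℤ.* y ℤ.+ b ℤ.* z)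
           (gram-off-diagonal S T top top′ (S≢T ∘ cong (true ∷_)) (suc s))
           (gram-off-diagonal S T top top′ (S≢T ∘ cong (true ∷_)) s))
         (cong₂ ℤ._+_ (ℤ.*-zeroʳ a) (ℤ.*-zeroʳ b)))
  where
  a = factor₀ n (suc s) (card S) ℤ.* factor₀ n (suc s) (card T)
  b = factor₁ n s (card S) ℤ.* factor₁ n s (card T)

gram-true-false-zero {n} S T top top′ s with Vec.≡-dec Bool._≟_ S T
... | yes refl = gram-true-false-same S top s
... | no S≢T   = go s
  where
  go : ∀ s → gram s (true ∷ S) (false ∷ T) ≡ + 0
  go zero = trans (gram-true-false₀ S T)
    (trans (cong (a ℤ.*_) (gram-off-diagonal S T top top′ S≢T 0)) (ℤ.*-zeroʳ a))
    where
    a = factor₀ n 0 (card S)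
  go (suc s) = trans (gram-true-false S T s)
    (trans (cong₂ (λ y z → a ℤ.* y ℤ.+ b ℤ.* z)
             (gram-off-diagonal S T top top′ S≢T (suc s)) (gram-off-diagonal S T top top′ S≢T s))
           (cong₂ ℤ._+_ (ℤ.*-zeroʳ a) (ℤ.*-zeroʳ b)))
    where
    a = factor₀ n (suc s) (card S)
    b = factor₁ n s (card S)

-- Falling powers

module FallingPowers where
  open import Data.Nat using (_+_; _*_; _∸_; _≤_; _^_)
  open import Data.Nat.Combinatorics using (_P_)
  open import Data.Nat.Properties

  -- `_P_` tests the bound before it unfolds; the inductions need the bare recursion of `_P′_`.
  P≡P′ : ∀ {n k} → k ≤ n → n P k ≡ n P′ k
  P≡P′ {n} {k} k≤n with k ℕ.≤ᵇ n | ≤⇒≤ᵇ k≤n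
  ... | true | _ = refl

  P′-double-suc : ∀ n d → n P′ (2 * suc d) ≡ (n ∸ suc (2 * d)) * ((n ∸ 2 * d) * (n P′ (2 * d)))
  P′-double-suc n d = cong (n P′_) (cong suc (+-suc d (d + 0)))

  P′≤^ : ∀ n d → n P′ d ≤ n ^ d
  P′≤^ n zero    = ≤-refl
  P′≤^ n (suc d) = *-mono-≤ (m∸n≤m n d) (P′≤^ n d)

  P′-positive : ∀ n d → d ≤ n → 1 ≤ n P′ d
  P′-positive n zero    _   = ≤-refl
  P′-positive n (suc d) d<n = *-mono-≤ (m<n⇒0<n∸m d<n) (P′-positive n d (<⇒≤ d<n))

  -- With m = κ + l, absorb first a zero, (m+1) binom(m,κ) = (l+1) binom(m+1,κ), then a one, (m+2)
  -- binom(m+1,κ) = (κ+1) binom(m+2,κ+1). This is the passage from d to d + 1 in `shifted-falling`,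
  -- where n - 2d drops by two.
  shifted-double-absorb : ∀ d κ l →
    suc (κ + l) * (suc (suc (κ + l)) * shifted d (κ + l) (d + κ))
      ≡ suc κ * (suc l * shifted d (suc (suc (κ + l))) (suc (d + κ)))
  shifted-double-absorb d κ l = ℤ.+-injective (begin
    + (suc m * (suc (suc m) * g))
      ≡⟨ trans (ℤ.pos-* (suc m) (suc (suc m) * g)) (cong (+ suc m ℤ.*_) (ℤ.pos-* (suc (suc m)) g)) ⟩
    + suc m ℤ.* (+ suc (suc m) ℤ.* + g)
      ≡⟨ swap (+ suc m) (+ suc (suc m)) (+ g) ⟩
    + suc (suc m) ℤ.* (+ suc m ℤ.* + g)
      ≡⟨ cong (+ suc (suc m) ℤ.*_) (trans (sym (shifted-absorb d m s)) (shifted-shift d (suc m) s)) ⟩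
    + suc (suc m) ℤ.* ((+ suc m ℤ.- (+ s ℤ.- + d)) ℤ.* + g₁)
      ≡⟨ cong (λ a → + suc (suc m) ℤ.* (a ℤ.* + g₁)) (cancel₁ (+ d) (+ κ) (+ l)) ⟩
    + suc (suc m) ℤ.* (+ suc l ℤ.* + g₁)
      ≡⟨ swap (+ suc (suc m)) (+ suc l) (+ g₁) ⟩
    + suc l ℤ.* (+ suc (suc m) ℤ.* + g₁)
      ≡⟨ cong (+ suc l ℤ.*_) (shifted-absorb d (suc m) s) ⟨
    + suc l ℤ.* ((+ suc s ℤ.- + d) ℤ.* + g₂)
      ≡⟨ cong (λ a → + suc l ℤ.* (a ℤ.* + g₂)) (cancel₂ (+ d) (+ κ)) ⟩
    + suc l ℤ.* (+ suc κ ℤ.* + g₂)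
      ≡⟨ swap (+ suc l) (+ suc κ) (+ g₂) ⟩
    + suc κ ℤ.* (+ suc l ℤ.* + g₂)
      ≡⟨ trans (ℤ.pos-* (suc κ) (suc l * g₂)) (cong (+ suc κ ℤ.*_) (ℤ.pos-* (suc l) g₂)) ⟨
    + (suc κ * (suc l * g₂)) ∎)
    where
    open ≡-Reasoning
    m = κ + l
    s = d + κ
    g = shifted d m s
    g₁ = shifted d (suc m) s
    g₂ = shifted d (suc (suc m)) (suc s)
    swap : ∀ a b c → a ℤ.* (b ℤ.* c) ≡ b ℤ.* (a ℤ.* c)
    swap = solve-∀
    cancel₁ : ∀ d κ l → + 1 ℤ.+ (κ ℤ.+ l) ℤ.- ((d ℤ.+ κ) ℤ.- d) ≡ + 1 ℤ.+ l
    cancel₁ = solve-∀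
    cancel₂ : ∀ d κ → + 1 ℤ.+ (d ℤ.+ κ) ℤ.- d ≡ + 1 ℤ.+ κ
    cancel₂ = solve-∀

  private
    ∸-cancel : ∀ a b → (a + b) ∸ a ≡ b
    ∸-cancel a b = m+n∸m≡n a b

    split : ∀ {d k} → suc d ≤ k → ∃ λ κ → k ≡ d + suc κ
    split {d} {k} d<k = k ∸ suc d , trans (sym (m+[n∸m]≡n d<k)) (sym (+-suc d (k ∸ suc d)))

    total : ∀ d κ l → (d + suc κ) + (d + suc l) ≡ 2 * d + suc (suc (κ + l))
    total = ℕRing.solve-∀

  -- With l = n - k this expresses binom(n-2d, k-d) / binom(n, k), the quotient left by the uniform
  -- measure, through the falling powers of the norm formula.
  shifted-falling : ∀ d m k l → d ≤ k → d ≤ l → k + l ≡ d + d + m →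
    shifted d m k * ((k + l) P′ (2 * d)) ≡ binomial (k + l) k * ((k P′ d) * (l P′ d))
  shifted-falling zero    m k l _   _   eq = cong (λ n → binomial n k * 1) (sym eq)
  shifted-falling (suc d) m k l d<k d<l eq with split d<k | split d<l
  ... | κ , refl | ν , refl = begin
    shifted (suc d) m k * (n P′ (2 * suc d))
      ≡⟨ cong₂ (λ a b → shifted (suc d) m a * b) (+-suc d κ) (P′-double-suc n d) ⟩
    shifted d m (d + κ) * ((n ∸ suc (2 * d)) * ((n ∸ 2 * d) * (n P′ (2 * d))))
      ≡⟨ cong₂ (λ a b → shifted d m (d + κ) * (a * (b * (n P′ (2 * d))))) n∸ n∸′ ⟩
    shifted d m (d + κ) * (suc (κ + ν) * (suc (suc (κ + ν)) * (n P′ (2 * d))))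
      ≡⟨ cong (λ a → shifted d a (d + κ) * (suc (κ + ν) * (suc (suc (κ + ν)) * (n P′ (2 * d))))) m≡ ⟩
    shifted d (κ + ν) (d + κ) * (suc (κ + ν) * (suc (suc (κ + ν)) * (n P′ (2 * d))))
      ≡⟨ regroup (shifted d (κ + ν) (d + κ)) (suc (κ + ν)) (suc (suc (κ + ν))) (n P′ (2 * d)) ⟩
    suc (κ + ν) * (suc (suc (κ + ν)) * shifted d (κ + ν) (d + κ)) * (n P′ (2 * d))
      ≡⟨ cong (_* (n P′ (2 * d))) (shifted-double-absorb d κ ν) ⟩
    suc κ * (suc ν * shifted d (suc (suc (κ + ν))) (suc (d + κ))) * (n P′ (2 * d))
      ≡⟨ regroup′ (suc κ) (suc ν) (shifted d (suc (suc (κ + ν))) (suc (d + κ))) (n P′ (2 * d)) ⟩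
    suc κ * suc ν * (shifted d (suc (suc (κ + ν))) (suc (d + κ)) * (n P′ (2 * d)))
      ≡⟨ cong (λ a → suc κ * suc ν * (shifted d (suc (suc (κ + ν))) a * (n P′ (2 * d)))) (+-suc d κ) ⟨
    suc κ * suc ν * (shifted d (suc (suc (κ + ν))) k * (n P′ (2 * d)))
      ≡⟨ cong (suc κ * suc ν *_) (shifted-falling d (suc (suc (κ + ν))) k l (<⇒≤ d<k) (<⇒≤ d<l)
           (trans (total d κ ν) (cong (λ a → d + a + suc (suc (κ + ν))) (+-identityʳ d)))) ⟩
    suc κ * suc ν * (binomial n k * ((k P′ d) * (l P′ d)))
      ≡⟨ regroup″ (suc κ) (suc ν) (binomial n k) (k P′ d) (l P′ d) ⟩
    binomial n k * ((suc κ * (k P′ d)) * (suc ν * (l P′ d)))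
      ≡⟨ cong₂ (λ a b → binomial n k * ((a * (k P′ d)) * (b * (l P′ d)))) (∸-cancel d (suc κ)) (∸-cancel d (suc ν)) ⟨
    binomial n k * (((k ∸ d) * (k P′ d)) * ((l ∸ d) * (l P′ d))) ∎
    where
    open ≡-Reasoning
    n = k + l
    m≡ : m ≡ κ + ν
    m≡ = +-cancelˡ-≡ (suc d + suc d) m (κ + ν) (trans (sym eq) (rearrange d κ ν))
      where
      rearrange : ∀ d κ ν → (d + suc κ) + (d + suc ν) ≡ suc d + suc d + (κ + ν)
      rearrange = ℕRing.solve-∀
    n∸′ : n ∸ 2 * d ≡ suc (suc (κ + ν))
    n∸′ = trans (cong (_∸ 2 * d) (total d κ ν)) (∸-cancel (2 * d) _)
    n∸ : n ∸ suc (2 * d) ≡ suc (κ + ν)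
    n∸ = trans (cong (_∸ suc (2 * d)) (trans (total d κ ν) (+-suc (2 * d) _))) (∸-cancel (suc (2 * d)) _)
    regroup : ∀ a b c d → a * (b * (c * d)) ≡ b * (c * a) * d
    regroup = ℕRing.solve-∀
    regroup′ : ∀ a b c d → a * (b * c) * d ≡ a * b * (c * d)
    regroup′ = ℕRing.solve-∀
    regroup″ : ∀ a b c d e → a * b * (c * (d * e)) ≡ c * ((a * d) * (b * e))
    regroup″ = ℕRing.solve-∀

  shifted-positive : ∀ d m k → d ≤ k → k ≤ d + m → 1 ≤ shifted d m k
  shifted-positive zero    m       zero    _         _         = ≤-refl
  shifted-positive zero    (suc m) (suc k) _         (s≤s k≤m) = ≤-trans (shifted-positive zero m k z≤n k≤m) (m≤m+n _ _)
  shifted-positive (suc d) m       (suc k) (s≤s d≤k) (s≤s k≤m) = shifted-positive d m k d≤k k≤m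

  -- Bounds for the ratio of the exact norm to its approximation

  4ab≤[a+b]² : ∀ a b → 4 * (a * b) ≤ (a + b) * (a + b)
  4ab≤[a+b]² a b with ≤-total a b
  ... | inj₁ a≤b = subst (λ b → 4 * (a * b) ≤ (a + b) * (a + b)) (m+[n∸m]≡n a≤b)
    (subst (4 * (a * (a + t)) ≤_) (square a t) (m≤m+n _ (t * t)))
    where
    t = b ∸ a
    square : ∀ a t → 4 * (a * (a + t)) + t * t ≡ (a + (a + t)) * (a + (a + t))
    square = ℕRing.solve-∀
  ... | inj₂ b≤a = subst (λ a → 4 * (a * b) ≤ (a + b) * (a + b)) (m+[n∸m]≡n b≤a)
    (subst (4 * ((b + t) * b) ≤_) (square b t) (m≤m+n _ (t * t)))
    where
    t = a ∸ b
    square : ∀ b t → 4 * ((b + t) * b) + t * t ≡ ((b + t) + b) * ((b + t) + b)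
    square = ℕRing.solve-∀

  module _ (k l : ℕ) where

    private n = k + l

    -- The exact norm and (2p(1-p))^d c_B, both without the common factor 2^d c_B and cleared of
    -- denominators: multiplied by n^(2d) and by the falling power of n of length 2d.
    falling powers : ℕ → ℕ
    falling d = (k P′ d) * (l P′ d) * (n * n) ^ d
    powers  d = (k * l) ^ d * (n P′ (2 * d))

    -- With u = n - 2d, (k-d)(l-d)/u² ≤ kl/n², so the ratio falling/powers grows by at most
    -- u/(u-1) ≤ (u+1)/(u-1) when d increases by one, and these bounds telescope.
    falling-upper : ∀ d → d ≤ k → d ≤ l → falling d * (suc n ∸ 2 * d) ≤ suc n * powers d
    falling-upper zero    _   _   = ≤-reflexive (lemma n)
      where
      lemma : ∀ n → 1 * (1 + n) ≡ (1 + n) * 1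
      lemma = ℕRing.solve-∀
    falling-upper (suc d) d<k d<l with split d<k | split d<l
    ... | κ , k≡ | ν , l≡ = begin
      falling (suc d) * (suc n ∸ 2 * suc d)
        ≡⟨ cong₂ _*_ falling-suc suc-n∸ ⟩
      α * β * (n * n) * A * v
        ≤⟨ *-monoˡ-≤ v (*-monoˡ-≤ A ratio) ⟩
      k * l * (u * u) * A * v
        ≡⟨ regroup₁ (k * l) u A v ⟩
      k * l * u * v * (A * u)
        ≤⟨ *-monoʳ-≤ (k * l * u * v) (*-monoʳ-≤ A (n≤1+n u)) ⟩
      k * l * u * v * (A * suc u)
        ≡⟨ cong (λ a → k * l * u * v * (A * a)) suc-n∸′ ⟨
      k * l * u * v * (A * (suc n ∸ 2 * d))
        ≤⟨ *-monoʳ-≤ (k * l * u * v) (falling-upper d (<⇒≤ d<k) (<⇒≤ d<l)) ⟩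
      k * l * u * v * (suc n * powers d)
        ≡⟨ regroup₂ (k * l) u v (suc n) ((k * l) ^ d) (n P′ (2 * d)) ⟩
      suc n * (k * l * (k * l) ^ d * (v * (u * (n P′ (2 * d)))))
        ≡⟨ cong (λ a → suc n * (k * l * (k * l) ^ d * a)) powers-suc ⟨
      suc n * powers (suc d) ∎
      where
      open ≤-Reasoning
      α = suc κ
      β = suc ν
      v = suc (κ + ν)
      u = suc v
      A = falling d
      n≡ : n ≡ 2 * d + u
      n≡ = trans (cong₂ _+_ k≡ l≡) (total d κ ν)
      suc-n∸′ : suc n ∸ 2 * d ≡ suc u
      suc-n∸′ = trans (cong (λ a → suc a ∸ 2 * d) n≡) (trans (cong (_∸ 2 * d) (sym (+-suc (2 * d) u))) (∸-cancel (2 * d) (suc u)))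
      suc-n∸ : suc n ∸ 2 * suc d ≡ v
      suc-n∸ = trans (cong₂ (λ a b → suc a ∸ b) n≡ (cong suc (+-suc d (d + 0))))
        (trans (cong (_∸ suc (2 * d)) (+-suc (2 * d) v)) (∸-cancel (suc (2 * d)) v))
      falling-suc : falling (suc d) ≡ α * β * (n * n) * A
      falling-suc = trans
        (cong₂ (λ a b → (a * (k P′ d)) * (b * (l P′ d)) * (n * n * (n * n) ^ d))
          (trans (cong (_∸ d) k≡) (∸-cancel d α)) (trans (cong (_∸ d) l≡) (∸-cancel d β)))
        (lemma α β (k P′ d) (l P′ d) (n * n) ((n * n) ^ d))
        where
        lemma : ∀ α β p q m N → (α * p) * (β * q) * (m * N) ≡ α * β * m * (p * q * N)
        lemma = ℕRing.solve-∀
      powers-suc : n P′ (2 * suc d) ≡ v * (u * (n P′ (2 * d)))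
      powers-suc = trans (P′-double-suc n d) (cong₂ (λ a b → a * (b * (n P′ (2 * d))))
        (trans (cong (_∸ suc (2 * d)) (trans n≡ (+-suc (2 * d) v))) (∸-cancel (suc (2 * d)) v))
        (trans (cong (_∸ 2 * d) n≡) (∸-cancel (2 * d) u)))
      u≡ : u ≡ α + β
      u≡ = cong suc (sym (+-suc κ ν))
      -- Expand n = 2d + u and kl = (d + α)(d + β); what remains is 4αβ ≤ (α + β)² = u², multiplied
      -- by du + d².
      ratio : α * β * (n * n) ≤ k * l * (u * u)
      ratio = begin
        α * β * (n * n)
          ≡⟨ cong (λ a → α * β * (a * a)) n≡ ⟩
        α * β * ((2 * d + u) * (2 * d + u))
          ≡⟨ expand (α * β) d u ⟩
        α * β * (u * u) + 4 * (α * β) * (d * u + d * d)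
          ≤⟨ +-monoʳ-≤ (α * β * (u * u)) (*-monoˡ-≤ (d * u + d * d)
               (subst (λ a → 4 * (α * β) ≤ a * a) (sym u≡) (4ab≤[a+b]² α β))) ⟩
        α * β * (u * u) + u * u * (d * u + d * d)
          ≡⟨ cong (λ a → α * β * (u * u) + u * u * (d * a + d * d)) u≡ ⟩
        α * β * (u * u) + u * u * (d * (α + β) + d * d)
          ≡⟨ collect α β d (u * u) ⟩
        (d + α) * (d + β) * (u * u)
          ≡⟨ cong₂ (λ a b → a * b * (u * u)) k≡ l≡ ⟨
        k * l * (u * u) ∎
        where
        expand : ∀ a d u → a * ((2 * d + u) * (2 * d + u)) ≡ a * (u * u) + 4 * a * (d * u + d * d)
        expand = ℕRing.solve-∀
        collect : ∀ α β d w → α * β * w + w * (d * (α + β) + d * d) ≡ (d + α) * (d + β) * w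
        collect = ℕRing.solve-∀
      regroup₁ : ∀ a u A v → a * (u * u) * A * v ≡ a * u * v * (A * u)
      regroup₁ = ℕRing.solve-∀
      regroup₂ : ∀ a u v n p q → a * u * v * (n * (p * q)) ≡ n * (a * p * (v * (u * q)))
      regroup₂ = ℕRing.solve-∀

    -- For 2d ≤ n the telescoped ratio (n+1)/(n+1-2d) is at most 1 + 4d²/n: after the substitution n
    -- = 2d + w the two sides of `poly` differ only in 2dw against 4d²w.
    falling-upper′ : ∀ d → d ≤ k → d ≤ l → n * falling d ≤ (n + 4 * (d * d)) * powers d
    falling-upper′ d d≤k d≤l = *-cancelʳ-≤ _ _ (suc w) (begin
      n * falling d * suc w
        ≡⟨ *-assoc n (falling d) (suc w) ⟩
      n * (falling d * suc w)
        ≡⟨ cong (λ a → n * (falling d * a)) suc-n∸ ⟨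
      n * (falling d * (suc n ∸ 2 * d))
        ≤⟨ *-monoʳ-≤ n (falling-upper d d≤k d≤l) ⟩
      n * (suc n * powers d)
        ≡⟨ *-assoc n (suc n) (powers d) ⟨
      n * suc n * powers d
        ≤⟨ *-monoˡ-≤ (powers d) poly ⟩
      (n + 4 * (d * d)) * suc w * powers d
        ≡⟨ swap (n + 4 * (d * d)) (suc w) (powers d) ⟩
      (n + 4 * (d * d)) * powers d * suc w ∎)
      where
      open ≤-Reasoning
      w = n ∸ 2 * d
      2d≤n : 2 * d ≤ n
      2d≤n = +-mono-≤ d≤k (≤-trans (≤-reflexive (+-identityʳ d)) d≤l)
      n≡ : n ≡ 2 * d + w
      n≡ = sym (m+[n∸m]≡n 2d≤n)
      suc-n∸ : suc n ∸ 2 * d ≡ suc w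
      suc-n∸ = +-∸-assoc 1 2d≤n
      swap : ∀ a b c → a * b * c ≡ a * c * b
      swap = ℕRing.solve-∀
      expandˡ : ∀ d w → (2 * d + w) * (1 + (2 * d + w)) ≡ w * w + 2 * (d * w) + 4 * (d * d) + w + 2 * d + 2 * d * w
      expandˡ = ℕRing.solve-∀
      expandʳ : ∀ d w → w * w + 2 * (d * w) + 4 * (d * d) + w + 2 * d + 4 * (d * d) * w
        ≡ ((2 * d + w) + 4 * (d * d)) * (1 + w)
      expandʳ = ℕRing.solve-∀
      2d≤4d² : ∀ d → 2 * d ≤ 4 * (d * d)
      2d≤4d² zero    = z≤n
      2d≤4d² (suc d) = *-mono-≤ {2} {4} (s≤s (s≤s z≤n)) (m≤m*n (suc d) (suc d))
      poly : n * suc n ≤ (n + 4 * (d * d)) * suc w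
      poly = begin
        n * suc n
          ≡⟨ cong (λ a → a * suc a) n≡ ⟩
        (2 * d + w) * (1 + (2 * d + w))
          ≡⟨ expandˡ d w ⟩
        w * w + 2 * (d * w) + 4 * (d * d) + w + 2 * d + 2 * d * w
          ≤⟨ +-monoʳ-≤ (w * w + 2 * (d * w) + 4 * (d * d) + w + 2 * d) (*-monoˡ-≤ w (2d≤4d² d)) ⟩
        w * w + 2 * (d * w) + 4 * (d * d) + w + 2 * d + 4 * (d * d) * w
          ≡⟨ expandʳ d w ⟩
        ((2 * d + w) + 4 * (d * d)) * (1 + w)
          ≡⟨ cong (λ a → (a + 4 * (d * d)) * suc w) n≡ ⟨
        (n + 4 * (d * d)) * suc w ∎

    -- A Bernoulli-type induction for 1 - d²/k. Since k ≤ l, the new factor satisfies (1 - d/k)(1 -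
    -- d/l) ≥ 1 - 2d/k, and d² + 2d ≤ (d+1)².
    falling-lower : k ≤ l → ∀ d → d ≤ k → (k * l) ^ d * (k ∸ d * d) ≤ k * ((k P′ d) * (l P′ d))
    falling-lower k≤l zero    _   = ≤-reflexive (*-comm 1 k)
    falling-lower k≤l (suc d) d<k with k ℕ.≤? suc d * suc d
    -- Truncated subtraction makes the left side 0 once the bound has become vacuous.
    ... | yes k≤ = ≤-trans (≤-reflexive (trans (cong ((k * l) ^ suc d *_) (m≤n⇒m∸n≡0 k≤)) (*-zeroʳ ((k * l) ^ suc d)))) z≤n
    ... | no k≰ = begin
      k * l * E * (k ∸ suc d * suc d)
        ≡⟨ cong (k * l * E *_) (trans (cong (_∸ suc d * suc d) k≡′) (∸-cancel (suc d * suc d) e)) ⟩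
      k * l * E * e
        ≡⟨ regroup₁ (k * l) E e ⟩
      E * (k * l * e)
        ≤⟨ *-monoʳ-≤ E poly ⟩
      E * ((k ∸ d * d) * ((k ∸ d) * (l ∸ d)))
        ≡⟨ regroup₂ E (k ∸ d * d) ((k ∸ d) * (l ∸ d)) ⟩
      E * (k ∸ d * d) * ((k ∸ d) * (l ∸ d))
        ≤⟨ *-monoˡ-≤ ((k ∸ d) * (l ∸ d)) (falling-lower k≤l d (<⇒≤ d<k)) ⟩
      k * ((k P′ d) * (l P′ d)) * ((k ∸ d) * (l ∸ d))
        ≡⟨ regroup₃ k (k P′ d) (l P′ d) (k ∸ d) (l ∸ d) ⟩
      k * ((k ∸ d) * (k P′ d) * ((l ∸ d) * (l P′ d))) ∎
      where
      open ≤-Reasoning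
      E = (k * l) ^ d
      e = k ∸ suc d * suc d
      k≡′ : k ≡ suc d * suc d + e
      k≡′ = sym (m+[n∸m]≡n (<⇒≤ (≰⇒> k≰)))
      regroup₁ : ∀ a b c → a * b * c ≡ b * (a * c)
      regroup₁ = ℕRing.solve-∀
      regroup₂ : ∀ a b c → a * (b * c) ≡ a * b * c
      regroup₂ = ℕRing.solve-∀
      regroup₃ : ∀ k p q a b → k * (p * q) * (a * b) ≡ k * (a * p * (b * q))
      regroup₃ = ℕRing.solve-∀
      k∸d² : k ∸ d * d ≡ suc (2 * d) + e
      k∸d² = trans (cong (_∸ d * d) (trans k≡′ (lemma d e))) (∸-cancel (d * d) (suc (2 * d) + e))
        where
        lemma : ∀ d e → (1 + d) * (1 + d) + e ≡ d * d + (1 + 2 * d + e)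
        lemma = ℕRing.solve-∀
      poly : k * l * e ≤ (k ∸ d * d) * ((k ∸ d) * (l ∸ d))
      -- Adding f d (k+l) to both sides removes the subtractions in (k-d)(l-d): with α = k-d and β =
      -- l-d, αβ + d(k+l) = kl + d². Then f ≤ k and f = 2d + 1 + e suffice.
      poly = +-cancelʳ-≤ (f * (d * (k + l))) _ _ (begin
        k * l * e + f * (d * (k + l))
          ≤⟨ +-monoʳ-≤ (k * l * e) (*-mono-≤ (m∸n≤m k (d * d)) (*-monoʳ-≤ d (+-monoˡ-≤ l k≤l))) ⟩
        k * l * e + k * (d * (l + l))
          ≡⟨ collect k l d e ⟩
        k * l * (2 * d + e)
          ≤⟨ *-monoʳ-≤ (k * l) (n≤1+n (2 * d + e)) ⟩
        k * l * (suc (2 * d) + e)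
          ≡⟨ cong (k * l *_) k∸d² ⟨
        k * l * f
          ≤⟨ *-monoˡ-≤ f (m≤m+n (k * l) (d * d)) ⟩
        (k * l + d * d) * f
          ≡⟨ cong₂ (λ a b → (a * b + d * d) * f) k≡α l≡β ⟨
        ((d + α) * (d + β) + d * d) * f
          ≡⟨ expand d α β f ⟩
        f * (α * β) + f * (d * ((d + α) + (d + β)))
          ≡⟨ cong₂ (λ a b → f * (α * β) + f * (d * (a + b))) k≡α l≡β ⟩
        f * (α * β) + f * (d * (k + l)) ∎)
        where
        f = k ∸ d * d
        α = k ∸ d
        β = l ∸ d
        k≡α : d + α ≡ k
        k≡α = m+[n∸m]≡n (<⇒≤ d<k)
        l≡β : d + β ≡ l
        l≡β = m+[n∸m]≡n (≤-trans (<⇒≤ d<k) k≤l)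
        collect : ∀ k l d e → k * l * e + k * (d * (l + l)) ≡ k * l * (2 * d + e)
        collect = ℕRing.solve-∀
        expand : ∀ d α β f → ((d + α) * (d + β) + d * d) * f ≡ f * (α * β) + f * (d * ((d + α) + (d + β)))
        expand = ℕRing.solve-∀

    -- Beyond `falling-lower` only the crude bound `n P′ (2 * d) ≤ n ^ (2 * d)` is spent.
    falling-lower′ : k ≤ l → ∀ d → d ≤ k → (k ∸ d * d) * powers d ≤ k * falling d
    falling-lower′ k≤l d d≤k = begin
      (k ∸ d * d) * powers d
        ≡⟨ regroup (k ∸ d * d) ((k * l) ^ d) (n P′ (2 * d)) ⟩
      (k * l) ^ d * (k ∸ d * d) * (n P′ (2 * d))
        ≤⟨ *-mono-≤ (falling-lower k≤l d d≤k) (P′≤^ n (2 * d)) ⟩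
      k * ((k P′ d) * (l P′ d)) * n ^ (2 * d)
        ≡⟨ cong (k * ((k P′ d) * (l P′ d)) *_) (trans (sym (^-*-assoc n 2 d)) (cong (λ a → (n * a) ^ d) (*-identityʳ n))) ⟩
      k * ((k P′ d) * (l P′ d)) * (n * n) ^ d
        ≡⟨ *-assoc k ((k P′ d) * (l P′ d)) ((n * n) ^ d) ⟩
      k * falling d ∎
      where
      open ≤-Reasoning
      regroup : ∀ a b c → a * (b * c) ≡ b * a * c
      regroup = ℕRing.solve-∀

module ℤS = ListSum ℤ.+-*-commutativeRing
module ΣP = CommutativeMonoidSum ℤ.+-0-commutativeMonoid
module ΠP = CommutativeMonoidSum ℤ.*-1-commutativeMonoid
open ℤS using (sum; product; sumOver)

-- The product formula for χ_B

module _ {A : Set} where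

  lookup-∷ʳ-inject₁ : ∀ {d} (V : Vec A d) v i → lookup (V ∷ʳ v) (inject₁ i) ≡ lookup V i
  lookup-∷ʳ-inject₁ (_ ∷ V) v Fin.zero    = refl
  lookup-∷ʳ-inject₁ (_ ∷ V) v (Fin.suc i) = lookup-∷ʳ-inject₁ V v i

  lookup-∷ʳ-fromℕ : ∀ {d} (V : Vec A d) v → lookup (V ∷ʳ v) (Fin.fromℕ d) ≡ v
  lookup-∷ʳ-fromℕ []      v = refl
  lookup-∷ʳ-fromℕ (_ ∷ V) v = lookup-∷ʳ-fromℕ V v

  All-∷ʳ : ∀ {P : A → Set} {d} (V : Vec A d) {v} → All P V → P v → All P (V ∷ʳ v)
  All-∷ʳ []      []         p = p ∷ []
  All-∷ʳ (_ ∷ V) (p′ ∷ ps) p = p′ ∷ All-∷ʳ V ps p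

  All-∷ʳ⁻ : ∀ {P : A → Set} {d} (V : Vec A d) {v} → All P (V ∷ʳ v) → All P V × P v
  All-∷ʳ⁻ []      (p ∷ [])  = [] , p
  All-∷ʳ⁻ (_ ∷ V) (p ∷ ps) with All-∷ʳ⁻ V ps
  ... | qs , q = p ∷ qs , q

  Unique-∷ʳ : ∀ {d} (V : Vec A d) {v} → Unique V → All (v ≢_) V → Unique (V ∷ʳ v)
  Unique-∷ʳ []      []       []        = [] ∷ []
  Unique-∷ʳ (_ ∷ V) (p ∷ u) (q ∷ qs) = All-∷ʳ V p (q ∘ sym) ∷ Unique-∷ʳ V u qs

  Unique-∷ʳ⁻ : ∀ {d} (V : Vec A d) {v} → Unique (V ∷ʳ v) → Unique V × All (v ≢_) V
  Unique-∷ʳ⁻ []      _       = [] , []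
  Unique-∷ʳ⁻ (_ ∷ V) (p ∷ u) with All-∷ʳ⁻ V p | Unique-∷ʳ⁻ V u
  ... | p′ , q | u′ , qs = p′ ∷ u′ , (q ∘ sym) ∷ qs

last-or-inject₁ : ∀ {d} (P : Fin (suc d) → Set) → (∀ i → P (inject₁ i)) → P (Fin.fromℕ d) → ∀ i → P i
last-or-inject₁ {zero}  P p q Fin.zero    = q
last-or-inject₁ {suc d} P p q Fin.zero    = p Fin.zero
last-or-inject₁ {suc d} P p q (Fin.suc i) = last-or-inject₁ (P ∘ Fin.suc) (p ∘ Fin.suc) q i

module _ {n : ℕ} where

  increasing-∷ʳ⁻ : ∀ {d} (B : Vec (Fin n) d) b → Increasing (B ∷ʳ b) →
    Increasing B × (∀ i → lookup B i Fin.< b)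
  increasing-∷ʳ⁻ {d} B b inc =
    (λ i j i<j → subst₂< (lookup-∷ʳ-inject₁ B b i) (lookup-∷ʳ-inject₁ B b j)
      (inc (inject₁ i) (inject₁ j) (≡.subst₂ ℕ._<_ (sym (Fin.toℕ-inject₁ i)) (sym (Fin.toℕ-inject₁ j)) i<j)))
    , λ i → subst₂< (lookup-∷ʳ-inject₁ B b i) (lookup-∷ʳ-fromℕ B b)
      (inc (inject₁ i) (Fin.fromℕ d)
        (≡.subst₂ ℕ._<_ (sym (Fin.toℕ-inject₁ i)) (sym (Fin.toℕ-fromℕ d)) (Fin.toℕ<n i)))
    where
    subst₂< : ∀ {a a′ b b′ : Fin n} → a ≡ a′ → b ≡ b′ → a Fin.< b → a′ Fin.< b′
    subst₂< refl refl a<b = a<b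

  increasing⇒unique : ∀ {d} (B : Vec (Fin n) d) → Increasing B → Unique B
  increasing⇒unique []      _   = []
  increasing⇒unique (b ∷ B) inc =
    All.lookup⁻ (λ i → Fin.<⇒≢ (inc Fin.zero (Fin.suc i) (s≤s z≤n)))
    ∷ increasing⇒unique B (λ i j i<j → inc (Fin.suc i) (Fin.suc j) (s≤s i<j))

  below-∷ʳ⁻ : ∀ {d} (B A : Vec (Fin n) d) b a → Below (B ∷ʳ b) (A ∷ʳ a) →
    Below B A × a Fin.< b × All (a ≢_) A × All (a ≢_) B
  below-∷ʳ⁻ {d} B A b a (mkBelow unique disjoint smaller) =
    mkBelow (proj₁ (Unique-∷ʳ⁻ A unique))
      (λ i j eq → disjoint (inject₁ i) (inject₁ j)
        (trans (lookup-∷ʳ-inject₁ A a i) (trans eq (sym (lookup-∷ʳ-inject₁ B b j)))))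
      (λ i → ≡.subst₂ Fin._<_ (lookup-∷ʳ-inject₁ A a i) (lookup-∷ʳ-inject₁ B b i) (smaller (inject₁ i)))
    , ≡.subst₂ Fin._<_ (lookup-∷ʳ-fromℕ A a) (lookup-∷ʳ-fromℕ B b) (smaller (Fin.fromℕ d))
    , proj₂ (Unique-∷ʳ⁻ A unique)
    , All.lookup⁻ (λ j eq → disjoint (Fin.fromℕ d) (inject₁ j)
        (trans (lookup-∷ʳ-fromℕ A a) (trans eq (sym (lookup-∷ʳ-inject₁ B b j)))))

  below-∷ʳ : ∀ {d} (B A : Vec (Fin n) d) b a → (∀ i → lookup B i Fin.< b) →
    Below B A → a Fin.< b → All (a ≢_) A → All (a ≢_) B → Below (B ∷ʳ b) (A ∷ʳ a)
  below-∷ʳ {d} B A b a B<b (mkBelow unique disjoint smaller) a<b a∉A a∉B =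
    mkBelow (Unique-∷ʳ A unique a∉A)
      (λ i j eq → last-or-inject₁ (λ i → ∀ j → lookup (A ∷ʳ a) i ≢ lookup (B ∷ʳ b) j)
        (λ i → last-or-inject₁ (λ j → lookup (A ∷ʳ a) (inject₁ i) ≢ lookup (B ∷ʳ b) j)
          (λ j eq → disjoint i j (trans (sym (lookup-∷ʳ-inject₁ A a i)) (trans eq (lookup-∷ʳ-inject₁ B b j))))
          (λ eq → Fin.<⇒≢ (Fin.<-trans {i = lookup A i} {j = lookup B i} {k = b} (smaller i) (B<b i))
            (trans (sym (lookup-∷ʳ-inject₁ A a i)) (trans eq (lookup-∷ʳ-fromℕ B b)))))
        (last-or-inject₁ (λ j → lookup (A ∷ʳ a) (Fin.fromℕ d) ≢ lookup (B ∷ʳ b) j)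
          (λ j eq → All.lookup⁺ a∉B j (trans (sym (lookup-∷ʳ-fromℕ A a)) (trans eq (lookup-∷ʳ-inject₁ B b j))))
          (λ eq → Fin.<⇒≢ a<b (trans (sym (lookup-∷ʳ-fromℕ A a)) (trans eq (lookup-∷ʳ-fromℕ B b)))))
        i j eq)
      (last-or-inject₁ (λ i → lookup (A ∷ʳ a) i Fin.< lookup (B ∷ʳ b) i)
        (λ i → ≡.subst₂ Fin._<_ (sym (lookup-∷ʳ-inject₁ A a i)) (sym (lookup-∷ʳ-inject₁ B b i)) (smaller i))
        (≡.subst₂ Fin._<_ (sym (lookup-∷ʳ-fromℕ A a)) (sym (lookup-∷ʳ-fromℕ B b)) a<b))

-- Sums over the elements that avoid given sequences

⟦_⟧ : ∀ {P : Set} → Dec P → ℤ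
⟦ P? ⟧ = if does P? then + 1 else + 0

⟦⟧-yes : ∀ {P : Set} (P? : Dec P) → P → ⟦ P? ⟧ ≡ + 1
⟦⟧-yes (yes _) _ = refl
⟦⟧-yes (no ¬p) p = contradiction p ¬p

⟦⟧-no : ∀ {P : Set} (P? : Dec P) → ¬ P → ⟦ P? ⟧ ≡ + 0
⟦⟧-no (yes p) ¬p = contradiction p ¬p
⟦⟧-no (no _)  _  = refl

⟦⟧-cong : ∀ {P Q : Set} (P? : Dec P) (Q? : Dec Q) → (P → Q) → (Q → P) → ⟦ P? ⟧ ≡ ⟦ Q? ⟧
⟦⟧-cong (yes p) Q? f g = sym (⟦⟧-yes Q? (f p))
⟦⟧-cong (no ¬p) Q? f g = sym (⟦⟧-no Q? (¬p ∘ g))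

sum-cong : ∀ {n} {f g : Vector ℤ n} → (∀ i → f i ≡ g i) → sum f ≡ sum g
sum-cong = ΣP.sum-cong-≗

sum-- : ∀ {n} (f g : Vector ℤ n) → sum (λ i → f i ℤ.- g i) ≡ sum f ℤ.- sum g
sum-- {zero}  f g = refl
sum-- {suc n} f g = trans (cong (λ e → (f Fin.zero ℤ.- g Fin.zero) ℤ.+ e) (sum-- (f ∘ Fin.suc) (g ∘ Fin.suc)))
  (lemma (f Fin.zero) (g Fin.zero) (sum (f ∘ Fin.suc)) (sum (g ∘ Fin.suc)))
  where
  lemma : ∀ a b c d → (a ℤ.- b) ℤ.+ (c ℤ.- d) ≡ (a ℤ.+ c) ℤ.- (b ℤ.+ d)
  lemma = solve-∀

sum-zero : ∀ {n} (f : Vector ℤ n) → (∀ i → f i ≡ + 0) → sum f ≡ + 0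
sum-zero {n} f eq = trans (sum-cong eq) (ΣP.sum-replicate-zero n)

sum-δ : ∀ {n} (v : Fin n) (h : Vector ℤ n) → sum (λ a → ⟦ a Fin.≟ v ⟧ ℤ.* h a) ≡ h v
sum-δ {suc n} Fin.zero h = begin
  + 1 ℤ.* h Fin.zero ℤ.+ sum {n} (λ a → + 0 ℤ.* h (Fin.suc a))
    ≡⟨ cong₂ ℤ._+_ (ℤ.*-identityˡ (h Fin.zero)) (sum-zero {n} _ (λ a → ℤ.*-zeroˡ (h (Fin.suc a)))) ⟩
  h Fin.zero ℤ.+ + 0
    ≡⟨ ℤ.+-identityʳ (h Fin.zero) ⟩
  h Fin.zero ∎
  where open ≡-Reasoning
sum-δ {suc n} (Fin.suc v) h = begin
  + 0 ℤ.* h Fin.zero ℤ.+ sum {n} (λ a → ⟦ a Fin.≟ v ⟧ ℤ.* h (Fin.suc a))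
    ≡⟨ cong₂ ℤ._+_ (ℤ.*-zeroˡ (h Fin.zero)) (sum-δ v (h ∘ Fin.suc)) ⟩
  + 0 ℤ.+ h (Fin.suc v)
    ≡⟨ ℤ.+-identityˡ (h (Fin.suc v)) ⟩
  h (Fin.suc v) ∎
  where open ≡-Reasoning

module _ {n : ℕ} where

  -- The indicator of a ∉ V as a product of factors 1 - [a = v], so that a restricted sum can be
  -- expanded one forbidden entry at a time.
  avoids : ∀ {d} → Fin n → Vec (Fin n) d → ℤ
  avoids a []      = + 1
  avoids a (v ∷ V) = (+ 1 ℤ.- ⟦ a Fin.≟ v ⟧) ℤ.* avoids a V

  avoids-yes : ∀ {d} a (V : Vec (Fin n) d) → All (a ≢_) V → avoids a V ≡ + 1
  avoids-yes a []      []        = refl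
  avoids-yes a (v ∷ V) (p ∷ ps) =
    cong₂ (λ e f → (+ 1 ℤ.- e) ℤ.* f) (⟦⟧-no (a Fin.≟ v) p) (avoids-yes a V ps)

  avoids-no : ∀ {d} a (V : Vec (Fin n) d) → ¬ All (a ≢_) V → avoids a V ≡ + 0
  avoids-no a []      ¬p = contradiction [] ¬p
  avoids-no a (v ∷ V) ¬p with a Fin.≟ v
  ... | yes _  = refl
  ... | no a≢v = trans (ℤ.*-identityˡ (avoids a V)) (avoids-no a V (¬p ∘ (a≢v ∷_)))

  -- Forbidding v subtracts its term weighted by `avoids v V`; distinctness makes this weight 1, so
  -- each forbidden entry is subtracted exactly once.
  sum-avoiding : ∀ {d} (V : Vec (Fin n) d) → Unique V → (w g : Fin n → ℤ) →
    sum (λ a → w a ℤ.* avoids a V ℤ.* g a)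
      ≡ sum (λ a → w a ℤ.* g a) ℤ.- sum (λ i → w (lookup V i) ℤ.* g (lookup V i))
  sum-avoiding [] _ w g = trans
    (sum-cong {n} {g = λ a → w a ℤ.* g a} (λ a → cong (ℤ._* g a) (ℤ.*-identityʳ (w a)))) (sym (ℤ.+-identityʳ (sum (λ a → w a ℤ.* g a))))
  sum-avoiding (v ∷ V) (v∉V ∷ u) w g = begin
    sum (λ a → w a ℤ.* ((+ 1 ℤ.- ⟦ a Fin.≟ v ⟧) ℤ.* avoids a V) ℤ.* g a)
      ≡⟨ sum-cong (λ a → expand (w a) ⟦ a Fin.≟ v ⟧ (avoids a V) (g a)) ⟩
    sum (λ a → w a ℤ.* avoids a V ℤ.* g a ℤ.- ⟦ a Fin.≟ v ⟧ ℤ.* (w a ℤ.* avoids a V ℤ.* g a))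
      ≡⟨ sum-- (λ a → w a ℤ.* avoids a V ℤ.* g a) (λ a → ⟦ a Fin.≟ v ⟧ ℤ.* (w a ℤ.* avoids a V ℤ.* g a)) ⟩
    sum (λ a → w a ℤ.* avoids a V ℤ.* g a) ℤ.- sum (λ a → ⟦ a Fin.≟ v ⟧ ℤ.* (w a ℤ.* avoids a V ℤ.* g a))
      ≡⟨ cong₂ ℤ._-_ (sum-avoiding V u w g) (sum-δ v (λ a → w a ℤ.* avoids a V ℤ.* g a)) ⟩
    (total ℤ.- rest) ℤ.- w v ℤ.* avoids v V ℤ.* g v
      ≡⟨ cong (λ e → (total ℤ.- rest) ℤ.- w v ℤ.* e ℤ.* g v) (avoids-yes v V v∉V) ⟩
    (total ℤ.- rest) ℤ.- w v ℤ.* + 1 ℤ.* g v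
      ≡⟨ collect total rest (w v) (g v) ⟩
    total ℤ.- (w v ℤ.* g v ℤ.+ rest) ∎
    where
    open ≡-Reasoning
    total = sum (λ a → w a ℤ.* g a)
    rest = sum (λ i → w (lookup V i) ℤ.* g (lookup V i))
    expand : ∀ w e v g → w ℤ.* ((+ 1 ℤ.- e) ℤ.* v) ℤ.* g ≡ w ℤ.* v ℤ.* g ℤ.- e ℤ.* (w ℤ.* v ℤ.* g)
    expand = solve-∀
    collect : ∀ t r w g → (t ℤ.- r) ℤ.- w ℤ.* + 1 ℤ.* g ≡ t ℤ.- (w ℤ.* g ℤ.+ r)
    collect = solve-∀

  -- Used with the entries of A as `V` and those of B as `W`. All of them lie below `b` and the two
  -- sequences are disjoint, so the forbidden terms appear with weight 1.
  sum-avoiding₂ : ∀ {d e} (V : Vec (Fin n) d) (W : Vec (Fin n) e) (b : Fin n) → Unique V → Unique W →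
    (∀ i → All (lookup W i ≢_) V) → (∀ i → lookup V i Fin.< b) → (∀ i → lookup W i Fin.< b) →
    (g : Fin n → ℤ) →
    sum (λ a → ⟦ a Fin.<? b ⟧ ℤ.* avoids a V ℤ.* avoids a W ℤ.* g a)
      ≡ sum (λ a → ⟦ a Fin.<? b ⟧ ℤ.* g a) ℤ.- sum (g ∘ lookup V) ℤ.- sum (g ∘ lookup W)
  sum-avoiding₂ V W b uV uW W∉V V<b W<b g = begin
    sum (λ a → ⟦ a Fin.<? b ⟧ ℤ.* avoids a V ℤ.* avoids a W ℤ.* g a)
      ≡⟨ sum-avoiding W uW (λ a → ⟦ a Fin.<? b ⟧ ℤ.* avoids a V) g ⟩
    sum (λ a → ⟦ a Fin.<? b ⟧ ℤ.* avoids a V ℤ.* g a)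
      ℤ.- sum (λ i → ⟦ lookup W i Fin.<? b ⟧ ℤ.* avoids (lookup W i) V ℤ.* g (lookup W i))
      ≡⟨ cong₂ ℤ._-_ (sum-avoiding V uV (λ a → ⟦ a Fin.<? b ⟧) g)
           (sum-cong (λ i → trans (cong₂ (λ y z → y ℤ.* z ℤ.* g (lookup W i))
             (⟦⟧-yes (lookup W i Fin.<? b) (W<b i)) (avoids-yes (lookup W i) V (W∉V i)))
             (ℤ.*-identityˡ (g (lookup W i))))) ⟩
    sum (λ a → ⟦ a Fin.<? b ⟧ ℤ.* g a) ℤ.- sum (λ i → ⟦ lookup V i Fin.<? b ⟧ ℤ.* g (lookup V i))
      ℤ.- sum (g ∘ lookup W)
      ≡⟨ cong (λ y → sum (λ a → ⟦ a Fin.<? b ⟧ ℤ.* g a) ℤ.- y ℤ.- sum (g ∘ lookup W))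
           (sum-cong (λ i → trans (cong (ℤ._* g (lookup V i)) (⟦⟧-yes (lookup V i Fin.<? b) (V<b i)))
             (ℤ.*-identityˡ (g (lookup V i))))) ⟩
    sum (λ a → ⟦ a Fin.<? b ⟧ ℤ.* g a) ℤ.- sum (g ∘ lookup V) ℤ.- sum (g ∘ lookup W) ∎
    where open ≡-Reasoning

  -- The earlier a_i satisfy a_i < b_i < b and thus avoid `b` automatically; appending the pair only
  -- adds conditions on `a`. Hence the sum over `a` can be carried out for a fixed A.
  below-indicator : ∀ {d} (B A : Vec (Fin n) d) b a → (∀ i → lookup B i Fin.< b) →
    ⟦ below? (B ∷ʳ b) (A ∷ʳ a) ⟧
      ≡ ⟦ below? B A ⟧ ℤ.* (⟦ a Fin.<? b ⟧ ℤ.* avoids a A ℤ.* avoids a B)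
  below-indicator B A b a B<b = go (below? (B ∷ʳ b) (A ∷ʳ a)) (below? B A) (a Fin.<? b)
    (All.all? (λ v → ¬? (a Fin.≟ v)) A) (All.all? (λ v → ¬? (a Fin.≟ v)) B)
    where
    go : (P? : Dec (Below (B ∷ʳ b) (A ∷ʳ a))) (Q? : Dec (Below B A)) (R? : Dec (a Fin.< b)) →
      Dec (All (a ≢_) A) → Dec (All (a ≢_) B) →
      ⟦ P? ⟧ ≡ ⟦ Q? ⟧ ℤ.* (⟦ R? ⟧ ℤ.* avoids a A ℤ.* avoids a B)
    go (yes p) Q? R? _ _ with below-∷ʳ⁻ B A b a p
    ... | q , a<b , a∉A , a∉B rewrite ⟦⟧-yes Q? q | ⟦⟧-yes R? a<b | avoids-yes a A a∉A | avoids-yes a B a∉B = refl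
    go (no ¬p) (no _)  R?      _         _         = sym (ℤ.*-zeroˡ (⟦ R? ⟧ ℤ.* avoids a A ℤ.* avoids a B))
    go (no ¬p) (yes q) (no _)  _         _         = refl
    go (no ¬p) (yes q) (yes r) (no a∈A)  _         rewrite avoids-no a A a∈A = refl
    go (no ¬p) (yes q) (yes r) (yes a∉A) (no a∈B)
      rewrite avoids-no a B a∈B | ℤ.*-zeroʳ (+ 1 ℤ.* avoids a A) = refl
    go (no ¬p) (yes q) (yes r) (yes a∉A) (yes a∉B) = contradiction (below-∷ʳ B A b a B<b q r a∉A a∉B) ¬p

-- Where ∏ (uᵢ - vᵢ) ≠ 0, exactly one of the bits uᵢ, vᵢ is 1, so uᵢ + vᵢ may be replaced by 1.
product-differences : ∀ {d} (u v : Vector ℤ d) t →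
  (∀ i → u i ℤ.* u i ≡ u i) → (∀ i → v i ℤ.* v i ≡ v i) →
  product (λ i → u i ℤ.- v i) ℤ.* (sum (λ i → u i ℤ.- t) ℤ.+ sum (λ i → v i ℤ.- t))
    ≡ product (λ i → u i ℤ.- v i) ℤ.* (+ d ℤ.* (+ 1 ℤ.- + 2 ℤ.* t))
product-differences {zero}  u v t _ _ = refl
product-differences {suc d} u v t u² v² = begin
  (u₀ ℤ.- v₀) ℤ.* P ℤ.* ((u₀ ℤ.- t ℤ.+ U) ℤ.+ (v₀ ℤ.- t ℤ.+ V))
    ≡⟨ expand u₀ v₀ t P U V ⟩
  P ℤ.* ((u₀ ℤ.* u₀ ℤ.- v₀ ℤ.* v₀) ℤ.- + 2 ℤ.* t ℤ.* (u₀ ℤ.- v₀)) ℤ.+ (u₀ ℤ.- v₀) ℤ.* (P ℤ.* (U ℤ.+ V))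
    ≡⟨ cong₂ (λ y z → P ℤ.* ((y ℤ.- z) ℤ.- + 2 ℤ.* t ℤ.* (u₀ ℤ.- v₀)) ℤ.+ (u₀ ℤ.- v₀) ℤ.* (P ℤ.* (U ℤ.+ V)))
         (u² Fin.zero) (v² Fin.zero) ⟩
  P ℤ.* ((u₀ ℤ.- v₀) ℤ.- + 2 ℤ.* t ℤ.* (u₀ ℤ.- v₀)) ℤ.+ (u₀ ℤ.- v₀) ℤ.* (P ℤ.* (U ℤ.+ V))
    ≡⟨ cong (λ y → P ℤ.* ((u₀ ℤ.- v₀) ℤ.- + 2 ℤ.* t ℤ.* (u₀ ℤ.- v₀)) ℤ.+ (u₀ ℤ.- v₀) ℤ.* y)
         (product-differences (u ∘ Fin.suc) (v ∘ Fin.suc) t (u² ∘ Fin.suc) (v² ∘ Fin.suc)) ⟩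
  P ℤ.* ((u₀ ℤ.- v₀) ℤ.- + 2 ℤ.* t ℤ.* (u₀ ℤ.- v₀)) ℤ.+ (u₀ ℤ.- v₀) ℤ.* (P ℤ.* (+ d ℤ.* (+ 1 ℤ.- + 2 ℤ.* t)))
    ≡⟨ collect u₀ v₀ t P (+ d) ⟩
  (u₀ ℤ.- v₀) ℤ.* P ℤ.* (+ suc d ℤ.* (+ 1 ℤ.- + 2 ℤ.* t)) ∎
  where
  open ≡-Reasoning
  u₀ = u Fin.zero
  v₀ = v Fin.zero
  P = product (λ i → u (Fin.suc i) ℤ.- v (Fin.suc i))
  U = sum (λ i → u (Fin.suc i) ℤ.- t)
  V = sum (λ i → v (Fin.suc i) ℤ.- t)
  expand : ∀ u v t P U V → (u ℤ.- v) ℤ.* P ℤ.* ((u ℤ.- t ℤ.+ U) ℤ.+ (v ℤ.- t ℤ.+ V))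
    ≡ P ℤ.* ((u ℤ.* u ℤ.- v ℤ.* v) ℤ.- + 2 ℤ.* t ℤ.* (u ℤ.- v)) ℤ.+ (u ℤ.- v) ℤ.* (P ℤ.* (U ℤ.+ V))
  expand = solve-∀
  collect : ∀ u v t P d →
    P ℤ.* ((u ℤ.- v) ℤ.- + 2 ℤ.* t ℤ.* (u ℤ.- v)) ℤ.+ (u ℤ.- v) ℤ.* (P ℤ.* (d ℤ.* (+ 1 ℤ.- + 2 ℤ.* t)))
    ≡ (u ℤ.- v) ℤ.* P ℤ.* ((+ 1 ℤ.+ d) ℤ.* (+ 1 ℤ.- + 2 ℤ.* t))
  collect = solve-∀

-- The result of summing x_a - x_b over the admissible a < b. Each of the j earlier pairs removes
-- (x_{a_i} - x_b) + (x_{b_i} - x_b), which is 1 - 2x_b where exactly one bit of the pair is 1.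
localFactor : ∀ {n} → (Fin n → ℤ) → ℕ → Fin n → ℤ
localFactor x j b = sum (λ a → ⟦ a Fin.<? b ⟧ ℤ.* (x a ℤ.- x b)) ℤ.- + j ℤ.* (+ 1 ℤ.- + 2 ℤ.* x b)

product-∷ʳ : ∀ {A : Set} {d} (f : ℕ → A → ℤ) (B : Vec A d) b →
  product (λ i → f (toℕ i) (lookup (B ∷ʳ b) i)) ≡ product (λ i → f (toℕ i) (lookup B i)) ℤ.* f d b
product-∷ʳ f []      b = ℤ.*-comm (f 0 b) (+ 1)
product-∷ʳ f (c ∷ B) b = trans (cong (f 0 c ℤ.*_) (product-∷ʳ (f ∘ suc) B b)) (sym (ℤ.*-assoc (f 0 c) _ _))

module _ {n : ℕ} (x : Fin n → ℤ) where

  χ₂ℤ : ∀ {d} → (A B : Vec (Fin n) d) → ℤ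
  χ₂ℤ A B = product (λ i → x (lookup A i) ℤ.- x (lookup B i))

  χ₂ℤ-∷ʳ : ∀ {d} (A B : Vec (Fin n) d) a b → χ₂ℤ (A ∷ʳ a) (B ∷ʳ b) ≡ χ₂ℤ A B ℤ.* (x a ℤ.- x b)
  χ₂ℤ-∷ʳ []       []       a b = ℤ.*-comm (x a ℤ.- x b) (+ 1)
  χ₂ℤ-∷ʳ (a′ ∷ A) (b′ ∷ B) a b =
    trans (cong ((x a′ ℤ.- x b′) ℤ.*_) (χ₂ℤ-∷ʳ A B a b)) (sym (ℤ.*-assoc (x a′ ℤ.- x b′) (χ₂ℤ A B) (x a ℤ.- x b)))

  module _ (x² : ∀ i → x i ℤ.* x i ≡ x i) where

    -- The inner sum over `a` does depend on A; it becomes independent of A only in the product with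
    -- χ_{A,B}, by `product-differences`.
    χ₂ℤ-extend : ∀ {d} (A B : Vec (Fin n) d) b → Increasing B → (∀ i → lookup B i Fin.< b) → Below B A →
      χ₂ℤ A B ℤ.* sum (λ a → ⟦ a Fin.<? b ⟧ ℤ.* avoids a A ℤ.* avoids a B ℤ.* (x a ℤ.- x b))
        ≡ χ₂ℤ A B ℤ.* localFactor x d b
    χ₂ℤ-extend {d} A B b inc B<b (mkBelow unique disjoint smaller) = begin
      P ℤ.* sum (λ a → ⟦ a Fin.<? b ⟧ ℤ.* avoids a A ℤ.* avoids a B ℤ.* (x a ℤ.- x b))
        ≡⟨ cong (P ℤ.*_) (sum-avoiding₂ A B b unique (increasing⇒unique B inc)
             (λ i → All.lookup⁻ (λ j → disjoint j i ∘ sym))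
             (λ i → Fin.<-trans {i = lookup A i} {j = lookup B i} {k = b} (smaller i) (B<b i))
             B<b (λ a → x a ℤ.- x b)) ⟩
      P ℤ.* (T ℤ.- U ℤ.- V)
        ≡⟨ split P T U V ⟩
      P ℤ.* T ℤ.- P ℤ.* (U ℤ.+ V)
        ≡⟨ cong (λ y → P ℤ.* T ℤ.- y)
             (product-differences (x ∘ lookup A) (x ∘ lookup B) (x b) (x² ∘ lookup A) (x² ∘ lookup B)) ⟩
      P ℤ.* T ℤ.- P ℤ.* (+ d ℤ.* (+ 1 ℤ.- + 2 ℤ.* x b))
        ≡⟨ merge P T (+ d ℤ.* (+ 1 ℤ.- + 2 ℤ.* x b)) ⟩
      P ℤ.* localFactor x d b ∎
      where
      open ≡-Reasoning
      P = χ₂ℤ A B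
      T = sum (λ a → ⟦ a Fin.<? b ⟧ ℤ.* (x a ℤ.- x b))
      U = sum (λ i → x (lookup A i) ℤ.- x b)
      V = sum (λ i → x (lookup B i) ℤ.- x b)
      split : ∀ P T U V → P ℤ.* (T ℤ.- U ℤ.- V) ≡ P ℤ.* T ℤ.- P ℤ.* (U ℤ.+ V)
      split = solve-∀
      merge : ∀ P T U → P ℤ.* T ℤ.- P ℤ.* U ≡ P ℤ.* (T ℤ.- U)
      merge = solve-∀

    -- The factor from the last pair no longer depends on A, so it leaves the sum over A and the
    -- induction continues with B without its largest element.
    χℤ-product : ∀ d (B : Vec (Fin n) d) → Increasing B →
      sumOver (allVecs (List.allFin n) d) (λ A → ⟦ below? B A ⟧ ℤ.* χ₂ℤ A B)
        ≡ product (λ i → localFactor x (toℕ i) (lookup B i))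
    χℤ-product zero    []  _   = refl
    χℤ-product (suc d) B⁺ inc with initLast B⁺
    ... | B , b , refl with increasing-∷ʳ⁻ B b inc
    ... | incB , B<b = begin
      sumOver (allVecs (List.allFin n) (suc d)) (λ A → ⟦ below? (B ∷ʳ b) A ⟧ ℤ.* χ₂ℤ A (B ∷ʳ b))
        ≡⟨ ℤS.sumOver-∷ʳ (List.allFin n) d (λ A → ⟦ below? (B ∷ʳ b) A ⟧ ℤ.* χ₂ℤ A (B ∷ʳ b)) ⟩
      sumOver As (λ A → sumOver (List.allFin n) (λ a → ⟦ below? (B ∷ʳ b) (A ∷ʳ a) ⟧ ℤ.* χ₂ℤ (A ∷ʳ a) (B ∷ʳ b)))
        ≡⟨ ℤS.sumOver-cong As inner ⟩
      sumOver As (λ A → ⟦ below? B A ⟧ ℤ.* χ₂ℤ A B ℤ.* localFactor x d b)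
        ≡⟨ ℤS.sumOver-*ʳ As (localFactor x d b) (λ A → ⟦ below? B A ⟧ ℤ.* χ₂ℤ A B) ⟩
      sumOver As (λ A → ⟦ below? B A ⟧ ℤ.* χ₂ℤ A B) ℤ.* localFactor x d b
        ≡⟨ cong (ℤ._* localFactor x d b) (χℤ-product d B incB) ⟩
      product (λ i → localFactor x (toℕ i) (lookup B i)) ℤ.* localFactor x d b
        ≡⟨ product-∷ʳ (localFactor x) B b ⟨
      product (λ i → localFactor x (toℕ i) (lookup (B ∷ʳ b) i)) ∎
      where
      open ≡-Reasoning
      As = allVecs (List.allFin n) d
      w : Vec (Fin n) d → Fin n → ℤ
      w A a = ⟦ a Fin.<? b ⟧ ℤ.* avoids a A ℤ.* avoids a B
      regroup : ∀ p w P g → p ℤ.* w ℤ.* (P ℤ.* g) ≡ p ℤ.* P ℤ.* (w ℤ.* g)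
      regroup = solve-∀
      extend : ∀ A (B? : Dec (Below B A)) →
        ⟦ B? ⟧ ℤ.* χ₂ℤ A B ℤ.* sum (λ a → w A a ℤ.* (x a ℤ.- x b)) ≡ ⟦ B? ⟧ ℤ.* χ₂ℤ A B ℤ.* localFactor x d b
      extend A (yes p) = trans (ℤ.*-assoc (+ 1) (χ₂ℤ A B) _)
        (trans (cong (+ 1 ℤ.*_) (χ₂ℤ-extend A B b incB B<b p)) (sym (ℤ.*-assoc (+ 1) (χ₂ℤ A B) (localFactor x d b))))
      extend A (no _)  = refl
      inner : ∀ A → sumOver (List.allFin n) (λ a → ⟦ below? (B ∷ʳ b) (A ∷ʳ a) ⟧ ℤ.* χ₂ℤ (A ∷ʳ a) (B ∷ʳ b))
        ≡ ⟦ below? B A ⟧ ℤ.* χ₂ℤ A B ℤ.* localFactor x d b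
      inner A = begin
        sumOver (List.allFin n) (λ a → ⟦ below? (B ∷ʳ b) (A ∷ʳ a) ⟧ ℤ.* χ₂ℤ (A ∷ʳ a) (B ∷ʳ b))
          ≡⟨ ℤS.sumOver-cong (List.allFin n) (λ a → trans
               (cong₂ ℤ._*_ (below-indicator B A b a B<b) (χ₂ℤ-∷ʳ A B a b))
               (regroup ⟦ below? B A ⟧ (w A a) (χ₂ℤ A B) (x a ℤ.- x b))) ⟩
        sumOver (List.allFin n) (λ a → ⟦ below? B A ⟧ ℤ.* χ₂ℤ A B ℤ.* (w A a ℤ.* (x a ℤ.- x b)))
          ≡⟨ ℤS.sumOver-*ˡ (List.allFin n) (⟦ below? B A ⟧ ℤ.* χ₂ℤ A B) (λ a → w A a ℤ.* (x a ℤ.- x b)) ⟩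
        ⟦ below? B A ⟧ ℤ.* χ₂ℤ A B ℤ.* sumOver (List.allFin n) (λ a → w A a ℤ.* (x a ℤ.- x b))
          ≡⟨ cong (⟦ below? B A ⟧ ℤ.* χ₂ℤ A B ℤ.*_)
               (ℤS.sumOver-tabulate id (λ a → w A a ℤ.* (x a ℤ.- x b))) ⟩
        ⟦ below? B A ⟧ ℤ.* χ₂ℤ A B ℤ.* sum (λ a → w A a ℤ.* (x a ℤ.- x b))
          ≡⟨ extend A (below? B A) ⟩
        ⟦ below? B A ⟧ ℤ.* χ₂ℤ A B ℤ.* localFactor x d b ∎

-- A lower bound for the elements of a top set

module _ {n : ℕ} where

  sum-<? : ∀ {m} (b : Fin m) → sum (λ (a : Fin m) → ⟦ a Fin.<? b ⟧ ℤ.* + 1) ≡ + toℕ b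
  sum-<? {suc m} Fin.zero    = sum-zero {suc m} _ (λ a → cong (ℤ._* + 1) (⟦⟧-no (a Fin.<? Fin.zero {m}) (λ ())))
  sum-<? {suc m} (Fin.suc b) = cong (λ e → + 1 ℤ.+ e) (trans
    (sum-cong (λ (a : Fin m) → cong (ℤ._* + 1)
      (⟦⟧-cong (Fin.suc a Fin.<? Fin.suc b) (a Fin.<? b) (λ { (s≤s p) → p }) s≤s)))
    (sum-<? b))

  sum-const-1 : ∀ d → sum {d} (λ _ → + 1) ≡ + d
  sum-const-1 zero    = refl
  sum-const-1 (suc d) = cong (λ e → + 1 ℤ.+ e) (sum-const-1 d)

  sum-nonNeg : ∀ {m} (f : Vector ℤ m) → (∀ i → + 0 ℤ.≤ f i) → + 0 ℤ.≤ sum f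
  sum-nonNeg {zero}  f p = ℤ.≤-refl
  sum-nonNeg {suc m} f p = ℤ.+-mono-≤ (p Fin.zero) (sum-nonNeg (f ∘ Fin.suc) (p ∘ Fin.suc))

  *-nonNeg : ∀ {a b} → + 0 ℤ.≤ a → + 0 ℤ.≤ b → + 0 ℤ.≤ a ℤ.* b
  *-nonNeg {+ a} {+ b} _ _ = subst (+ 0 ℤ.≤_) (ℤ.pos-* a b) (ℤ.+≤+ z≤n)

  ⟦⟧-nonNeg : ∀ {P : Set} (P? : Dec P) → + 0 ℤ.≤ ⟦ P? ⟧
  ⟦⟧-nonNeg (yes _) = ℤ.+≤+ z≤n
  ⟦⟧-nonNeg (no _)  = ℤ.+≤+ z≤n

  avoids-nonNeg : ∀ {d} a (V : Vec (Fin n) d) → + 0 ℤ.≤ avoids a V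
  avoids-nonNeg a []      = ℤ.+≤+ z≤n
  avoids-nonNeg a (v ∷ V) = *-nonNeg {+ 1 ℤ.- ⟦ a Fin.≟ v ⟧} (lemma (a Fin.≟ v)) (avoids-nonNeg a V)
    where
    lemma : ∀ {P : Set} (P? : Dec P) → + 0 ℤ.≤ + 1 ℤ.- ⟦ P? ⟧
    lemma (yes _) = ℤ.+≤+ z≤n
    lemma (no _)  = ℤ.+≤+ z≤n

  -- `sum-avoiding₂` for the constant 1 counts the free elements below `b` as b - (d + e); a sum of
  -- nonnegative terms cannot be negative.
  avoided-count : ∀ {d e} (V : Vec (Fin n) d) (W : Vec (Fin n) e) (b : Fin n) → Unique V → Unique W →
    (∀ i → All (lookup W i ≢_) V) → (∀ i → lookup V i Fin.< b) → (∀ i → lookup W i Fin.< b) →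
    d ℕ.+ e ℕ.≤ toℕ b
  avoided-count {d} {e} V W b uV uW W∉V V<b W<b = ℤ.drop‿+≤+ (ℤ.0≤i-j⇒j≤i (subst (+ 0 ℤ.≤_) count≡
    (sum-nonNeg _ (λ a → *-nonNeg {⟦ a Fin.<? b ⟧ ℤ.* avoids a V ℤ.* avoids a W}
      (*-nonNeg {⟦ a Fin.<? b ⟧ ℤ.* avoids a V}
        (*-nonNeg {⟦ a Fin.<? b ⟧} (⟦⟧-nonNeg (a Fin.<? b)) (avoids-nonNeg a V)) (avoids-nonNeg a W))
      (ℤ.+≤+ z≤n)))))
    where
    regroup : ∀ a b c → a ℤ.- b ℤ.- c ≡ a ℤ.- (b ℤ.+ c)
    regroup = solve-∀
    count≡ : sum (λ a → ⟦ a Fin.<? b ⟧ ℤ.* avoids a V ℤ.* avoids a W ℤ.* + 1) ≡ + toℕ b ℤ.- + (d ℕ.+ e)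
    count≡ = trans (sum-avoiding₂ V W b uV uW W∉V V<b W<b (λ _ → + 1))
      (trans (cong₂ ℤ._-_ (cong₂ ℤ._-_ (sum-<? b) (sum-const-1 d)) (sum-const-1 e))
        (regroup (+ toℕ b) (+ d) (+ e)))

  -- With indices from 0, the i + 1 entries a_0, ..., a_i and the i entries of B before b_i are 2i +
  -- 1 distinct elements below b_i.
  below⇒large : ∀ d (B A : Vec (Fin n) d) → Increasing B → Below B A →
    ∀ i → suc (toℕ i ℕ.+ toℕ i) ℕ.≤ toℕ (lookup B i)
  below⇒large (suc d) B⁺ A⁺ inc below with initLast B⁺ | initLast A⁺
  ... | B , b , refl | A , a , refl with increasing-∷ʳ⁻ B b inc | below-∷ʳ⁻ B A b a below
  ... | incB , B<b | belowBA , a<b , a∉A , a∉B = last-or-inject₁ _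
    (λ i → ≡.subst₂ (λ j c → suc (j ℕ.+ j) ℕ.≤ toℕ c) (sym (Fin.toℕ-inject₁ i)) (sym (lookup-∷ʳ-inject₁ B b i))
      (below⇒large d B A incB belowBA i))
    (≡.subst₂ (λ j c → suc (j ℕ.+ j) ℕ.≤ toℕ c) (sym (Fin.toℕ-fromℕ d)) (sym (lookup-∷ʳ-fromℕ B b))
      (avoided-count (A ∷ʳ a) B b (Below.distinct below) (increasing⇒unique B incB)
        (λ i → All.lookup⁻ (λ j eq → Below.disjoint below j (inject₁ i)
          (trans (sym eq) (sym (lookup-∷ʳ-inject₁ B b i)))))
        (last-or-inject₁ _
          (λ i → subst (Fin._< b) (sym (lookup-∷ʳ-inject₁ A a i))
            (Fin.<-trans {i = lookup A i} {j = lookup B i} {k = b} (Below.smaller belowBA i) (B<b i)))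
          (subst (Fin._< b) (sym (lookup-∷ʳ-fromℕ A a)) a<b))
        B<b))

-- Increasing sequences as Boolean vectors

-- The head of the Boolean vector says whether the largest element of [n] belongs to B.
data Encodes : ∀ {n d} → Vec Bool n → Vec (Fin n) d → Set where
  nil  : Encodes [] []
  skip : ∀ {n d} {S : Vec Bool n} {B : Vec (Fin n) d} → Encodes S B →
         Encodes (false ∷ S) (Vec.map inject₁ B)
  take : ∀ {n d} {S : Vec Bool n} {B : Vec (Fin n) d} → Encodes S B →
         Encodes (true ∷ S) (Vec.map inject₁ B ∷ʳ Fin.fromℕ n)

card≡ : ∀ {n d} {S : Vec Bool n} {B : Vec (Fin n) d} → Encodes S B → card S ≡ d
card≡ nil      = refl
card≡ (skip e) = card≡ e
card≡ (take e) = cong suc (card≡ e)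

decode : ∀ {n} (S : Vec Bool n) → ∃₂ λ d (B : Vec (Fin n) d) → Encodes S B
decode []          = 0 , [] , nil
decode (false ∷ S) = let _ , _ , e = decode S in _ , _ , skip e
decode (true ∷ S)  = let _ , _ , e = decode S in _ , _ , take e

lookup-inject₁ : ∀ {n d} (B : Vec (Fin n) d) i → toℕ (lookup (Vec.map inject₁ B) i) ≡ toℕ (lookup B i)
lookup-inject₁ B i = trans (cong toℕ (Vec.lookup-map i inject₁ B)) (Fin.toℕ-inject₁ (lookup B i))

increasing-map⁻ : ∀ {n d} (B : Vec (Fin n) d) → Increasing (Vec.map inject₁ B) → Increasing B
increasing-map⁻ B inc i j i<j = ≡.subst₂ ℕ._<_ (lookup-inject₁ B i) (lookup-inject₁ B j) (inc i j i<j)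

increasing-map : ∀ {n d} (B : Vec (Fin n) d) → Increasing B → Increasing (Vec.map inject₁ B)
increasing-map B inc i j i<j = ≡.subst₂ ℕ._<_ (sym (lookup-inject₁ B i)) (sym (lookup-inject₁ B j)) (inc i j i<j)

increasing-∷ʳ : ∀ {n d} (B : Vec (Fin n) d) b → Increasing B → (∀ i → lookup B i Fin.< b) → Increasing (B ∷ʳ b)
increasing-∷ʳ {n} {d} B b inc B<b = last-or-inject₁ (λ i → ∀ j → i Fin.< j → lookup (B ∷ʳ b) i Fin.< lookup (B ∷ʳ b) j)
  (λ i → last-or-inject₁ _
    (λ j i<j → ≡.subst₂ Fin._<_ (sym (lookup-∷ʳ-inject₁ B b i)) (sym (lookup-∷ʳ-inject₁ B b j))
      (inc i j (≡.subst₂ ℕ._<_ (Fin.toℕ-inject₁ i) (Fin.toℕ-inject₁ j) i<j)))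
    (λ _ → ≡.subst₂ Fin._<_ (sym (lookup-∷ʳ-inject₁ B b i)) (sym (lookup-∷ʳ-fromℕ B b)) (B<b i)))
  (λ j d<j → contradiction (ℕ.≤-pred (Fin.toℕ<n j)) (ℕ.<⇒≱ (subst (ℕ._< toℕ j) (Fin.toℕ-fromℕ d) d<j)))

encodes⇒increasing : ∀ {n d} {S : Vec Bool n} {B : Vec (Fin n) d} → Encodes S B → Increasing B
encodes⇒increasing nil ()
encodes⇒increasing (skip {B = B} e) = increasing-map B (encodes⇒increasing e)
encodes⇒increasing (take {n} {B = B} e) = increasing-∷ʳ (Vec.map inject₁ B) (Fin.fromℕ n)
  (increasing-map B (encodes⇒increasing e))
  (λ i → ≡.subst₂ ℕ._<_ (sym (lookup-inject₁ B i)) (sym (Fin.toℕ-fromℕ n)) (Fin.toℕ<n (lookup B i)))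

lower : ∀ {n d} (B : Vec (Fin (suc n)) d) → (∀ i → toℕ (lookup B i) ℕ.< n) → ∃ λ L → B ≡ Vec.map inject₁ L
lower []      _  = [] , refl
lower (b ∷ B) B<n with lower B (B<n ∘ Fin.suc)
... | L , eq = Fin.lower₁ b n≢b ∷ L , cong₂ _∷_ (sym (Fin.inject₁-lower₁ b n≢b)) eq
  where n≢b = ℕ.<⇒≢ (B<n Fin.zero) ∘ sym

-- In an increasing sequence the largest element of [n] can occur only as the last entry, so
-- comparing that entry with it decides the head.
encode : ∀ n {d} (B : Vec (Fin n) d) → Increasing B → ∃ λ S → Encodes S B
encode zero    []  _   = [] , nil
encode (suc n) {zero} []  _   = let S , e = encode n [] (λ ()) in false ∷ S , skip e
encode (suc n) {suc d} B⁺ inc with initLast B⁺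
... | B , b , refl with increasing-∷ʳ⁻ B b inc | n ℕ.≟ toℕ b
... | incB , B<b | yes n≡b with lower B (λ i → subst (toℕ (lookup B i) ℕ.<_) (sym n≡b) (B<b i))
...   | L , refl rewrite Fin.toℕ-injective {i = b} {j = Fin.fromℕ n} (trans (sym n≡b) (sym (Fin.toℕ-fromℕ n))) =
  let S , e = encode n L (increasing-map⁻ L incB) in true ∷ S , take e
encode (suc n) {suc d} B⁺ inc | B , b , refl | incB , B<b | no n≢b
  with lower (B ∷ʳ b) (last-or-inject₁ _
    (λ i → subst (λ c → toℕ c ℕ.< n) (sym (lookup-∷ʳ-inject₁ B b i)) (ℕ.<-trans (B<b i) b<n))
    (subst (λ c → toℕ c ℕ.< n) (sym (lookup-∷ʳ-fromℕ B b)) b<n))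
  where
  b<n : toℕ b ℕ.< n
  b<n = ℕ.≤∧≢⇒< (ℕ.≤-pred (Fin.toℕ<n b)) (n≢b ∘ sym)
... | L , eq rewrite eq = let S , e = encode n L (increasing-map⁻ L inc) in false ∷ S , skip e

encodes-functional : ∀ {n d d′} {S : Vec Bool n} {B : Vec (Fin n) d} {B′ : Vec (Fin n) d′} →
  Encodes S B → Encodes S B′ → _≡_ {A = Σ ℕ (Vec (Fin n))} (d , B) (d′ , B′)
encodes-functional nil      nil       = refl
encodes-functional (skip e) (skip e′) = cong (λ (d , B) → d , Vec.map inject₁ B) (encodes-functional e e′)
encodes-functional {suc n} (take e) (take e′) =
  cong (λ (d , B) → suc d , Vec.map inject₁ B ∷ʳ Fin.fromℕ n) (encodes-functional e e′)

map-inject₁-injective : ∀ {n d} (B B′ : Vec (Fin n) d) → Vec.map inject₁ B ≡ Vec.map inject₁ B′ → B ≡ B′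
map-inject₁-injective []      []        _  = refl
map-inject₁-injective (b ∷ B) (b′ ∷ B′) eq =
  cong₂ _∷_ (Fin.inject₁-injective (Vec.∷-injectiveˡ eq)) (map-inject₁-injective B B′ (Vec.∷-injectiveʳ eq))

map-inject₁≢∷ʳ : ∀ {n d} (B : Vec (Fin n) (suc d)) (B′ : Vec (Fin n) d) →
  Vec.map inject₁ B ≢ Vec.map inject₁ B′ ∷ʳ Fin.fromℕ n
map-inject₁≢∷ʳ {n} {d} B B′ eq = Fin.fromℕ≢inject₁ (trans (sym (lookup-∷ʳ-fromℕ (Vec.map inject₁ B′) (Fin.fromℕ n)))
  (trans (cong (λ V → lookup V (Fin.fromℕ d)) (sym eq)) (Vec.lookup-map (Fin.fromℕ d) inject₁ B)))

encodes-injective : ∀ {n d} {S S′ : Vec Bool n} {B B′ : Vec (Fin n) d} →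
  Encodes S B → Encodes S′ B′ → B ≡ B′ → S ≡ S′
encodes-injective nil nil _ = refl
encodes-injective (skip e) (skip e′) eq =
  cong (false ∷_) (encodes-injective e e′ (map-inject₁-injective _ _ eq))
encodes-injective (skip e) (take e′) eq = contradiction eq (map-inject₁≢∷ʳ _ _)
encodes-injective (take e) (skip e′) eq = contradiction (sym eq) (map-inject₁≢∷ʳ _ _)
encodes-injective (take e) (take e′) eq =
  cong (true ∷_) (encodes-injective e e′ (map-inject₁-injective _ _ (Vec.∷ʳ-injectiveˡ _ _ eq)))

-- The ballot condition has to be checked only at elements of B, since an initial segment ending
-- outside B inherits it from a shorter one. At b_i the bound 2i + 1 ≤ `toℕ` b_i is the same as
-- 2(i+1) ≤ `toℕ` b_i + 1.
encodes⇒top : ∀ {n d} {S : Vec Bool n} {B : Vec (Fin n) d} → Encodes S B →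
  (∀ i → suc (toℕ i ℕ.+ toℕ i) ℕ.≤ toℕ (lookup B i)) → Top S
encodes⇒top nil _ = tt
encodes⇒top (skip {S = S} {B} e) large = top , ℕ.m≤n⇒m≤1+n (top⇒2card≤n S top)
  where
  top = encodes⇒top e (λ i → ℕ.≤-trans (large i) (ℕ.≤-reflexive (lookup-inject₁ B i)))
encodes⇒top (take {n} {d} {S} {B} e) large =
  encodes⇒top e (λ i → ≡.subst₂ (λ j b → suc (j ℕ.+ j) ℕ.≤ b) (Fin.toℕ-inject₁ i)
    (trans (cong toℕ (lookup-∷ʳ-inject₁ (Vec.map inject₁ B) (Fin.fromℕ n) i)) (lookup-inject₁ B i))
    (large (inject₁ i)))
  , s≤s (subst (ℕ._≤ n) (sym (ℕ.+-suc (card S) (card S))) last-large)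
  where
  last-large : suc (card S ℕ.+ card S) ℕ.≤ n
  last-large = ≡.subst₂ (λ j b → suc (j ℕ.+ j) ℕ.≤ b) (trans (Fin.toℕ-fromℕ d) (sym (card≡ e)))
    (trans (cong toℕ (lookup-∷ʳ-fromℕ (Vec.map inject₁ B) (Fin.fromℕ n))) (Fin.toℕ-fromℕ n))
    (large (Fin.fromℕ d))

-- From the product formula to characters of Boolean vectors

product-cong : ∀ {d} {f g : Vector ℤ d} → (∀ i → f i ≡ g i) → product f ≡ product g
product-cong = ΠP.sum-cong-≗

coordinatesℤ : ∀ {n} → Vec (Fin 2) n → Fin n → ℤ
coordinatesℤ x i = + toℕ (lookup x i)

localFactor-cong : ∀ {n} {x y : Fin n → ℤ} → (∀ i → x i ≡ y i) → ∀ j b → localFactor x j b ≡ localFactor y j b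
localFactor-cong {n} {x} {y} eq j b = cong₂ ℤ._-_
  (sum-cong {n} {λ a → ⟦ a Fin.<? b ⟧ ℤ.* (x a ℤ.- x b)} {λ a → ⟦ a Fin.<? b ⟧ ℤ.* (y a ℤ.- y b)}
    (λ a → cong₂ (λ u v → ⟦ a Fin.<? b ⟧ ℤ.* (u ℤ.- v)) (eq a) (eq b)))
  (cong (λ v → + j ℤ.* (+ 1 ℤ.- + 2 ℤ.* v)) (eq b))

localFactor-inject₁ : ∀ {n} (x : Fin (suc n) → ℤ) j b → localFactor x j (inject₁ b) ≡ localFactor (x ∘ inject₁) j b
localFactor-inject₁ {n} x j b = cong (λ e → e ℤ.- + j ℤ.* (+ 1 ℤ.- + 2 ℤ.* x (inject₁ b))) (begin
  sum (λ a → ⟦ a Fin.<? inject₁ b ⟧ ℤ.* (x a ℤ.- x (inject₁ b)))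
    ≡⟨ ΣP.sum-init-last (λ a → ⟦ a Fin.<? inject₁ b ⟧ ℤ.* (x a ℤ.- x (inject₁ b))) ⟩
  sum (λ a → ⟦ inject₁ a Fin.<? inject₁ b ⟧ ℤ.* (x (inject₁ a) ℤ.- x (inject₁ b)))
    ℤ.+ ⟦ Fin.fromℕ n Fin.<? inject₁ b ⟧ ℤ.* (x (Fin.fromℕ n) ℤ.- x (inject₁ b))
    ≡⟨ cong₂ ℤ._+_
         (sum-cong {n} {λ a → ⟦ inject₁ a Fin.<? inject₁ b ⟧ ℤ.* (x (inject₁ a) ℤ.- x (inject₁ b))}
           (λ a → cong (ℤ._* (x (inject₁ a) ℤ.- x (inject₁ b)))
           (⟦⟧-cong (inject₁ a Fin.<? inject₁ b) (a Fin.<? b)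
             (≡.subst₂ ℕ._<_ (Fin.toℕ-inject₁ a) (Fin.toℕ-inject₁ b))
             (≡.subst₂ ℕ._<_ (sym (Fin.toℕ-inject₁ a)) (sym (Fin.toℕ-inject₁ b))))))
         (cong (ℤ._* (x (Fin.fromℕ n) ℤ.- x (inject₁ b))) (⟦⟧-no (Fin.fromℕ n Fin.<? inject₁ b)
           (λ p → ℕ.<⇒≱ (Fin.toℕ<n b) (ℕ.<⇒≤ (≡.subst₂ ℕ._<_ (Fin.toℕ-fromℕ n) (Fin.toℕ-inject₁ b) p))))) ⟩
  T ℤ.+ + 0 ℤ.* (x (Fin.fromℕ n) ℤ.- x (inject₁ b))
    ≡⟨ cong (λ e → T ℤ.+ e) (ℤ.*-zeroˡ (x (Fin.fromℕ n) ℤ.- x (inject₁ b))) ⟩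
  T ℤ.+ + 0
    ≡⟨ ℤ.+-identityʳ T ⟩
  T ∎)
  where
  open ≡-Reasoning
  T = sum (λ a → ⟦ a Fin.<? b ⟧ ℤ.* (x (inject₁ a) ℤ.- x (inject₁ b)))

sum-minus-const : ∀ {n} (f : Fin n → ℤ) t → sum (λ a → f a ℤ.- t) ≡ sum f ℤ.- + n ℤ.* t
sum-minus-const {zero}  f t = refl
sum-minus-const {suc n} f t = trans (cong (λ e → f Fin.zero ℤ.- t ℤ.+ e) (sum-minus-const (f ∘ Fin.suc) t))
  (lemma (f Fin.zero) t (sum (f ∘ Fin.suc)) (+ n))
  where
  lemma : ∀ a t s n → a ℤ.- t ℤ.+ (s ℤ.- n ℤ.* t) ≡ a ℤ.+ s ℤ.- (+ 1 ℤ.+ n) ℤ.* t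
  lemma = solve-∀

localFactor-fromℕ : ∀ {n} (x : Fin (suc n) → ℤ) j → let t = x (Fin.fromℕ n) in
  localFactor x j (Fin.fromℕ n) ≡ sum (x ∘ inject₁) ℤ.- + n ℤ.* t ℤ.- + j ℤ.* (+ 1 ℤ.- + 2 ℤ.* t)
localFactor-fromℕ {n} x j = cong (λ e → e ℤ.- + j ℤ.* (+ 1 ℤ.- + 2 ℤ.* t)) (begin
  sum (λ a → ⟦ a Fin.<? Fin.fromℕ n ⟧ ℤ.* (x a ℤ.- t))
    ≡⟨ ΣP.sum-init-last (λ a → ⟦ a Fin.<? Fin.fromℕ n ⟧ ℤ.* (x a ℤ.- t)) ⟩
  sum (λ a → ⟦ inject₁ a Fin.<? Fin.fromℕ n ⟧ ℤ.* (x (inject₁ a) ℤ.- t))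
    ℤ.+ ⟦ Fin.fromℕ n Fin.<? Fin.fromℕ n ⟧ ℤ.* (t ℤ.- t)
    ≡⟨ cong₂ ℤ._+_
         (sum-cong {n} {λ a → ⟦ inject₁ a Fin.<? Fin.fromℕ n ⟧ ℤ.* (x (inject₁ a) ℤ.- t)}
           (λ a → trans (cong (ℤ._* (x (inject₁ a) ℤ.- t))
           (⟦⟧-yes (inject₁ a Fin.<? Fin.fromℕ n)
             (≡.subst₂ ℕ._<_ (sym (Fin.toℕ-inject₁ a)) (sym (Fin.toℕ-fromℕ n)) (Fin.toℕ<n a))))
             (ℤ.*-identityˡ (x (inject₁ a) ℤ.- t))))
         (trans (cong (⟦ Fin.fromℕ n Fin.<? Fin.fromℕ n ⟧ ℤ.*_) (ℤ.+-inverseʳ t))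
           (ℤ.*-zeroʳ ⟦ Fin.fromℕ n Fin.<? Fin.fromℕ n ⟧)) ⟩
  sum (λ a → x (inject₁ a) ℤ.- t) ℤ.+ + 0
    ≡⟨ ℤ.+-identityʳ _ ⟩
  sum (λ a → x (inject₁ a) ℤ.- t)
    ≡⟨ sum-minus-const (x ∘ inject₁) t ⟩
  sum (x ∘ inject₁) ℤ.- + n ℤ.* t ∎)
  where
  open ≡-Reasoning
  t = x (Fin.fromℕ n)

sum-coordinatesℤ : ∀ {n} (x : Vec (Fin 2) n) → sum (coordinatesℤ x) ≡ + ones x
sum-coordinatesℤ []      = refl
sum-coordinatesℤ (a ∷ x) = cong (λ e → + toℕ a ℤ.+ e) (sum-coordinatesℤ x)

ones-∷ʳ : ∀ {n} (x : Vec (Fin 2) n) a → ones (x ∷ʳ a) ≡ toℕ a ℕ.+ ones x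
ones-∷ʳ []      a = refl
ones-∷ʳ (c ∷ x) a = trans (cong (toℕ c ℕ.+_) (ones-∷ʳ x a)) (trans (sym (ℕ.+-assoc (toℕ c) (toℕ a) (ones x)))
  (trans (cong (ℕ._+ ones x) (ℕ.+-comm (toℕ c) (toℕ a))) (ℕ.+-assoc (toℕ a) (toℕ c) (ones x))))

ones-reverse : ∀ {n} (x : Vec (Fin 2) n) → ones (Vec.reverse x) ≡ ones x
ones-reverse []      = refl
ones-reverse (a ∷ x) = trans (cong ones (Vec.reverse-∷ a x))
  (trans (ones-∷ʳ (Vec.reverse x) a) (cong (toℕ a ℕ.+_) (ones-reverse x)))

product-localFactor-inject₁ : ∀ {n d} (B : Vec (Fin n) d) (x : Vec (Fin 2) n) a →
  product (λ i → localFactor (coordinatesℤ (x ∷ʳ a)) (toℕ i) (lookup (Vec.map inject₁ B) i))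
    ≡ product (λ i → localFactor (coordinatesℤ x) (toℕ i) (lookup B i))
product-localFactor-inject₁ B x a = product-cong (λ i →
  trans (cong (localFactor (coordinatesℤ (x ∷ʳ a)) (toℕ i)) (Vec.lookup-map i inject₁ B))
    (trans (localFactor-inject₁ (coordinatesℤ (x ∷ʳ a)) (toℕ i) (lookup B i))
      (localFactor-cong (λ j → cong (λ c → + toℕ c) (lookup-∷ʳ-inject₁ x a j)) (toℕ i) (lookup B i))))

localFactor-last : ∀ {n} (x : Vec (Fin 2) n) a j →
  localFactor (coordinatesℤ (x ∷ʳ a)) j (Fin.fromℕ n)
    ≡ + ones x ℤ.- + n ℤ.* + toℕ a ℤ.- + j ℤ.* (+ 1 ℤ.- + 2 ℤ.* + toℕ a)
localFactor-last {n} x a j = trans (localFactor-fromℕ (coordinatesℤ (x ∷ʳ a)) j)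
  (cong₂ (λ s t → s ℤ.- + n ℤ.* t ℤ.- + j ℤ.* (+ 1 ℤ.- + 2 ℤ.* t))
    (trans (sum-cong (λ i → cong (λ c → + toℕ c) (lookup-∷ʳ-inject₁ x a i))) (sum-coordinatesℤ x))
    (cong (λ c → + toℕ c) (lookup-∷ʳ-fromℕ x a)))

-- A coordinate affects only the factors at or after it, so the last one can be split off. The
-- reversal puts that coordinate at the head of `x`, where `character` looks for it.
product≡character : ∀ {n d} {S : Vec Bool n} {B : Vec (Fin n) d} → Encodes S B → (x : Vec (Fin 2) n) →
  product (λ i → localFactor (coordinatesℤ (Vec.reverse x)) (toℕ i) (lookup B i)) ≡ character x S
product≡character nil [] = refl
product≡character (skip {B = B} e) (a ∷ x) rewrite Vec.reverse-∷ a x =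
  trans (product-localFactor-inject₁ B (Vec.reverse x) a) (product≡character e x)
product≡character {suc n} (take {d = d} {S} {B} e) (a ∷ x) rewrite Vec.reverse-∷ a x = begin
  product (λ i → localFactor z (toℕ i) (lookup (Vec.map inject₁ B ∷ʳ Fin.fromℕ n) i))
    ≡⟨ product-∷ʳ (localFactor z) (Vec.map inject₁ B) (Fin.fromℕ n) ⟩
  product (λ i → localFactor z (toℕ i) (lookup (Vec.map inject₁ B) i)) ℤ.* localFactor z d (Fin.fromℕ n)
    ≡⟨ cong₂ ℤ._*_ (trans (product-localFactor-inject₁ B (Vec.reverse x) a) (product≡character e x)) last≡ ⟩
  character x S ℤ.* (+ ones x ℤ.- + n ℤ.* + toℕ a ℤ.- + card S ℤ.* (+ 1 ℤ.- + 2 ℤ.* + toℕ a))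
    ≡⟨ step a ⟩
  character (a ∷ x) (true ∷ S) ∎
  where
  open ≡-Reasoning
  z = coordinatesℤ (Vec.reverse x ∷ʳ a)
  last≡ : localFactor z d (Fin.fromℕ n)
    ≡ + ones x ℤ.- + n ℤ.* + toℕ a ℤ.- + card S ℤ.* (+ 1 ℤ.- + 2 ℤ.* + toℕ a)
  last≡ = trans (localFactor-last (Vec.reverse x) a d)
    (cong₂ (λ o j → + o ℤ.- + n ℤ.* + toℕ a ℤ.- + j ℤ.* (+ 1 ℤ.- + 2 ℤ.* + toℕ a)) (ones-reverse x) (sym (card≡ e)))
  zero-bit : ∀ y o n j → y ℤ.* (o ℤ.- n ℤ.* + 0 ℤ.- j ℤ.* (+ 1 ℤ.- + 2 ℤ.* + 0)) ≡ (o ℤ.- j) ℤ.* y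
  zero-bit = solve-∀
  one-bit : ∀ y o n j → y ℤ.* (o ℤ.- n ℤ.* + 1 ℤ.- j ℤ.* (+ 1 ℤ.- + 2 ℤ.* + 1)) ≡ (o ℤ.+ j ℤ.- n) ℤ.* y
  one-bit = solve-∀
  step : ∀ a → character x S ℤ.* (+ ones x ℤ.- + n ℤ.* + toℕ a ℤ.- + card S ℤ.* (+ 1 ℤ.- + 2 ℤ.* + toℕ a))
    ≡ character (a ∷ x) (true ∷ S)
  step 0# = zero-bit (character x S) (+ ones x) (+ n) (+ card S)
  step 1# = one-bit (character x S) (+ ones x) (+ n) (+ card S)

normFactor : ∀ {n} → ℕ → Fin n → ℤ
normFactor j b = (+ suc (toℕ b) ℤ.- + 2 ℤ.* + j) ℤ.* (+ suc (toℕ b) ℤ.- + 2 ℤ.* + j ℤ.- + 1)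

normFactor-cong : ∀ {m n} j (b : Fin m) (b′ : Fin n) → toℕ b ≡ toℕ b′ → normFactor j b ≡ normFactor j b′
normFactor-cong j b b′ = cong (λ t → (+ suc t ℤ.- + 2 ℤ.* + j) ℤ.* (+ suc t ℤ.- + 2 ℤ.* + j ℤ.- + 1))

normConst≡product : ∀ {n d} {S : Vec Bool n} {B : Vec (Fin n) d} → Encodes S B →
  product (λ i → normFactor (toℕ i) (lookup B i)) ≡ normConst S
normConst≡product nil = refl
normConst≡product (skip {B = B} e) = trans
  (product-cong (λ i → normFactor-cong (toℕ i) (lookup (Vec.map inject₁ B) i) (lookup B i) (lookup-inject₁ B i)))
  (normConst≡product e)
normConst≡product (take {n} {d} {S} {B} e) = begin
  product (λ i → normFactor (toℕ i) (lookup (Vec.map inject₁ B ∷ʳ Fin.fromℕ n) i))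
    ≡⟨ product-∷ʳ normFactor (Vec.map inject₁ B) (Fin.fromℕ n) ⟩
  product (λ i → normFactor (toℕ i) (lookup (Vec.map inject₁ B) i)) ℤ.* normFactor d (Fin.fromℕ n)
    ≡⟨ cong₂ ℤ._*_
         (trans (product-cong (λ i → normFactor-cong (toℕ i) (lookup (Vec.map inject₁ B) i) (lookup B i) (lookup-inject₁ B i)))
           (normConst≡product e))
         (cong₂ (λ j t → (+ suc t ℤ.- + 2 ℤ.* + j) ℤ.* (+ suc t ℤ.- + 2 ℤ.* + j ℤ.- + 1))
           (sym (card≡ e)) (Fin.toℕ-fromℕ n)) ⟩
  normConst S ℤ.* ((+ suc n ℤ.- + 2 ℤ.* + card S) ℤ.* (+ suc n ℤ.- + 2 ℤ.* + card S ℤ.- + 1))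
    ≡⟨ ℤ.*-comm (normConst S) _ ⟩
  normConst (true ∷ S) ∎
  where open ≡-Reasoning

open Defs
open FallingPowers

-- Expansion of functions on the slice

toℚ : ℤ → ℚ
toℚ z = z ℚ./ 1

fromℚᵘ-* : ∀ p q → ℚ.fromℚᵘ p ℚ.* ℚ.fromℚᵘ q ≡ ℚ.fromℚᵘ (p ℚᵘ.* q)
fromℚᵘ-* p q = ℚ.toℚᵘ-injective (ℚᵘ.≃-trans (ℚ.toℚᵘ-homo-* (ℚ.fromℚᵘ p) (ℚ.fromℚᵘ q))
  (ℚᵘ.≃-trans (ℚᵘ.*-cong (ℚ.toℚᵘ-fromℚᵘ p) (ℚ.toℚᵘ-fromℚᵘ q)) (ℚᵘ.≃-sym (ℚ.toℚᵘ-fromℚᵘ (p ℚᵘ.* q)))))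

toℚ-* : ∀ a b → toℚ (a ℤ.* b) ≡ toℚ a ℚ.* toℚ b
toℚ-* a b = sym (fromℚᵘ-* (mkℚᵘ a 0) (mkℚᵘ b 0))

toℚ-+ : ∀ a b → toℚ (a ℤ.+ b) ≡ toℚ a ℚ.+ toℚ b
toℚ-+ a b = sym (ℚ.toℚᵘ-injective (ℚᵘ.≃-trans (ℚ.toℚᵘ-homo-+ (toℚ a) (toℚ b))
  (ℚᵘ.≃-trans (ℚᵘ.+-cong (ℚ.toℚᵘ-fromℚᵘ (mkℚᵘ a 0)) (ℚ.toℚᵘ-fromℚᵘ (mkℚᵘ b 0)))
    (ℚᵘ.≃-trans (*≡* (lemma a b)) (ℚᵘ.≃-sym (ℚ.toℚᵘ-fromℚᵘ (mkℚᵘ (a ℤ.+ b) 0)))))))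
  where
  lemma : ∀ a b → (a ℤ.* + 1 ℤ.+ b ℤ.* + 1) ℤ.* + 1 ≡ (a ℤ.+ b) ℤ.* + 1
  lemma = solve-∀

toℚ-neg : ∀ a → toℚ (ℤ.- a) ≡ ℚ.- toℚ a
toℚ-neg a = sym (ℚ.toℚᵘ-injective (ℚᵘ.≃-trans (ℚ.toℚᵘ-homo‿- (toℚ a))
  (ℚᵘ.≃-trans (ℚᵘ.-‿cong (ℚ.toℚᵘ-fromℚᵘ (mkℚᵘ a 0))) (ℚᵘ.≃-sym (ℚ.toℚᵘ-fromℚᵘ (mkℚᵘ (ℤ.- a) 0))))))

toℚ-- : ∀ a b → toℚ (a ℤ.- b) ≡ toℚ a ℚ.- toℚ b
toℚ-- a b = trans (toℚ-+ a (ℤ.- b)) (cong (toℚ a ℚ.+_) (toℚ-neg b))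

/-cancel : ∀ a b → a ℚ./ suc b ℚ.* toℚ (+ suc b) ≡ toℚ a
/-cancel a b = trans (fromℚᵘ-* (mkℚᵘ a b) (mkℚᵘ (+ suc b) 0))
  (ℚ.fromℚᵘ-cong {mkℚᵘ a b ℚᵘ.* mkℚᵘ (+ suc b) 0} {mkℚᵘ a 0} (*≡* (lemma a (+ suc b))))
  where
  lemma : ∀ a b → a ℤ.* b ℤ.* + 1 ≡ a ℤ.* (b ℤ.* + 1)
  lemma = solve-∀

ι : ℤ → ℝ
ι z = fromℚ (toℚ z)

fromℚ-cong : ∀ {p q} → p ≡ q → fromℚ p ≈ fromℚ q
fromℚ-cong eq = pointwise⇒≈ (λ _ → eq)

module ℝS = ListSum ℝ-commutativeRing
module ℝR = CommutativeRing ℝ-commutativeRing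

bools : List Bool
bools = false ∷ true ∷ []

sum-bools : ∀ n (g : Vec Bool (suc n) → ℝ) →
  ℝS.sumOver (allVecs bools (suc n)) g ≈ ℝS.sumOver (allVecs bools n) (λ S → g (false ∷ S) + g (true ∷ S))
sum-bools n g = ≈-trans (ℝS.sumOver-product Vec._∷_ bools (allVecs bools n) g)
  (≈-trans (+-cong ≈-refl (ℝR.+-identityʳ _))
    (≈-sym (ℝS.sumOver-+ (allVecs bools n) (λ S → g (false ∷ S)) (λ S → g (true ∷ S)))))

-- Where the count of set elements first overtakes the count of ones, the coordinate is a 0 in the
-- set preceded by o = j ones, and `factor₀` is 0 there. Overtaking the zeros happens at a 1 in the
-- set with j zeros before it, where `factor₁` is 0.
character-vanishes : ∀ {n} (x : Vec (Fin 2) n) (S : Vec Bool n) →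
  ones x ℕ.< card S ⊎ n ℕ.< ones x ℕ.+ card S → character x S ≡ + 0
character-vanishes [] [] (inj₁ ())
character-vanishes [] [] (inj₂ ())
character-vanishes (0# ∷ x) (false ∷ S) (inj₁ p) = character-vanishes x S (inj₁ p)
character-vanishes (0# ∷ x) (false ∷ S) (inj₂ p) = character-vanishes x S (inj₂ (ℕ.<-trans (ℕ.n<1+n _) p))
character-vanishes (1# ∷ x) (false ∷ S) (inj₁ p) = character-vanishes x S (inj₁ (ℕ.<-trans (ℕ.n<1+n _) p))
character-vanishes (1# ∷ x) (false ∷ S) (inj₂ p) = character-vanishes x S (inj₂ (ℕ.≤-pred p))
character-vanishes {suc n} (0# ∷ x) (true ∷ S) (inj₁ (s≤s p)) with ℕ.m≤n⇒m<n∨m≡n p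
... | inj₁ q = trans (cong (factor₀ n (ones x) (card S) ℤ.*_) (character-vanishes x S (inj₁ q)))
                 (ℤ.*-zeroʳ (factor₀ n (ones x) (card S)))
... | inj₂ e = trans (cong (ℤ._* character x S) (trans (cong (λ o → factor₀ n o (card S)) e) (ℤ.+-inverseʳ (+ card S))))
                 (ℤ.*-zeroˡ (character x S))
character-vanishes {suc n} (0# ∷ x) (true ∷ S) (inj₂ p) =
  trans (cong (factor₀ n (ones x) (card S) ℤ.*_)
          (character-vanishes x S (inj₂ (ℕ.≤-pred (subst (suc n ℕ.<_) (ℕ.+-suc (ones x) (card S)) p)))))
    (ℤ.*-zeroʳ (factor₀ n (ones x) (card S)))
character-vanishes {suc n} (1# ∷ x) (true ∷ S) (inj₁ (s≤s p)) =
  trans (cong (factor₁ n (ones x) (card S) ℤ.*_) (character-vanishes x S (inj₁ p)))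
    (ℤ.*-zeroʳ (factor₁ n (ones x) (card S)))
character-vanishes {suc n} (1# ∷ x) (true ∷ S) (inj₂ (s≤s p))
  with ℕ.m≤n⇒m<n∨m≡n (ℕ.≤-pred (subst (suc n ℕ.≤_) (ℕ.+-suc (ones x) (card S)) p))
... | inj₁ q = trans (cong (factor₁ n (ones x) (card S) ℤ.*_) (character-vanishes x S (inj₂ q)))
                 (ℤ.*-zeroʳ (factor₁ n (ones x) (card S)))
... | inj₂ e = trans (cong (ℤ._* character x S) (trans (cong (λ o → + o ℤ.- + n) (sym e)) (ℤ.+-inverseʳ (+ n))))
                 (ℤ.*-zeroˡ (character x S))

character-vanishes-large : ∀ {n} (x : Vec (Fin 2) n) (S : Vec Bool n) → n ℕ.< card S ℕ.+ card S → character x S ≡ + 0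
character-vanishes-large {n} x S p with ℕ.<-≤-connex (ones x) (card S)
... | inj₁ q = character-vanishes x S (inj₁ q)
... | inj₂ q = character-vanishes x S (inj₂ (ℕ.<-≤-trans p (ℕ.+-monoˡ-≤ (card S) q)))

-- Let C ⊆ [n], j = |C|, and let e₀, e₁ be χ_C restricted to x_{n+1} = 0 and to x_{n+1} = 1.
-- Then χ_C = e₀ + e₁ and χ_{C ∪ {n+1}} = B e₀ - A e₁ with A + B = n + 1 - 2j,
-- and the coefficients α come from solving for e₀ and e₁.
module SpanStep (n s : ℕ) (α₀ α₁ : Vec Bool n → ℝ) where

  A B : ℕ → ℤ
  A j = + suc n ℤ.- + s ℤ.- + j
  B j = + s ℤ.- + j

  r : ℕ → ℝ
  r j = fromℚ (1 ÷ (suc n ℕ.∸ (j ℕ.+ j)))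

  α : Vec Bool (suc n) → ℝ
  α (false ∷ S) = r (card S) * (ι (A (card S)) * α₀ S + ι (B (card S)) * α₁ S)
  α (true ∷ S)  = r (card S) * (α₀ S - α₁ S)

  r-inverse : ∀ j → j ℕ.+ j ℕ.≤ n →
    (1 ÷ (suc n ℕ.∸ (j ℕ.+ j))) ℚ.* (toℚ (A j) ℚ.+ toℚ (B j)) ≡ 1ℚ
  r-inverse j p = begin
    (1 ÷ (suc n ℕ.∸ (j ℕ.+ j))) ℚ.* (toℚ (A j) ℚ.+ toℚ (B j))
      ≡⟨ cong ((1 ÷ (suc n ℕ.∸ (j ℕ.+ j))) ℚ.*_) (toℚ-+ (A j) (B j)) ⟨
    (1 ÷ (suc n ℕ.∸ (j ℕ.+ j))) ℚ.* toℚ (A j ℤ.+ B j)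
      ≡⟨ cong₂ (λ a b → (1 ÷ a) ℚ.* toℚ b) (ℕ.+-∸-assoc 1 p) (sum≡ (+ s)) ⟩
    (1 ÷ suc m) ℚ.* toℚ (+ suc m)
      ≡⟨ /-cancel (+ 1) m ⟩
    1ℚ ∎
    where
    open ≡-Reasoning
    m = n ℕ.∸ (j ℕ.+ j)
    regroup : ∀ j m s → (+ 1 ℤ.+ (j ℤ.+ j ℤ.+ m) ℤ.- s ℤ.- j) ℤ.+ (s ℤ.- j) ≡ + 1 ℤ.+ m
    regroup = solve-∀
    sum≡ : ∀ t → (+ suc n ℤ.- t ℤ.- + j) ℤ.+ (t ℤ.- + j) ≡ + suc m
    sum≡ t = trans (cong (λ a → (+ suc a ℤ.- t ℤ.- + j) ℤ.+ (t ℤ.- + j)) (sym (ℕ.m+[n∸m]≡n p)))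
      (regroup (+ j) (+ m) t)

  term₀ : ∀ x S → ones x ≡ s →
    α₀ S * ι (character x S) ≈ α (false ∷ S) * ι (character x S) + α (true ∷ S) * ι (factor₀ n (ones x) (card S) ℤ.* character x S)
  term₀ x S refl with ℕ.≤-<-connex (card S ℕ.+ card S) n
  ... | inj₁ p = pointwise⇒≈ (λ i → begin
      seq (α₀ S) i ℚ.* toℚ (character x S)
        ≡⟨ cong (ℚ._* toℚ (character x S)) (ℚ.*-identityˡ (seq (α₀ S) i)) ⟨
      1ℚ ℚ.* seq (α₀ S) i ℚ.* toℚ (character x S)
        ≡⟨ cong (λ a → a ℚ.* seq (α₀ S) i ℚ.* toℚ (character x S)) (r-inverse j p) ⟨
      ρ ℚ.* (toℚ (A j) ℚ.+ toℚ (B j)) ℚ.* seq (α₀ S) i ℚ.* toℚ (character x S)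
        ≡⟨ lemma ρ (toℚ (A j)) (toℚ (B j)) (seq (α₀ S) i) (seq (α₁ S) i) (toℚ (character x S)) ⟩
      ρ ℚ.* (toℚ (A j) ℚ.* seq (α₀ S) i ℚ.+ toℚ (B j) ℚ.* seq (α₁ S) i) ℚ.* toℚ (character x S)
        ℚ.+ ρ ℚ.* (seq (α₀ S) i ℚ.- seq (α₁ S) i) ℚ.* (toℚ (B j) ℚ.* toℚ (character x S))
        ≡⟨ cong (λ a → ρ ℚ.* (toℚ (A j) ℚ.* seq (α₀ S) i ℚ.+ toℚ (B j) ℚ.* seq (α₁ S) i) ℚ.* toℚ (character x S)
             ℚ.+ ρ ℚ.* (seq (α₀ S) i ℚ.- seq (α₁ S) i) ℚ.* a) (toℚ-* (B j) (character x S)) ⟨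
      ρ ℚ.* (toℚ (A j) ℚ.* seq (α₀ S) i ℚ.+ toℚ (B j) ℚ.* seq (α₁ S) i) ℚ.* toℚ (character x S)
        ℚ.+ ρ ℚ.* (seq (α₀ S) i ℚ.- seq (α₁ S) i) ℚ.* toℚ (B j ℤ.* character x S) ∎)
    where
    open ≡-Reasoning
    open +-*-Solver
    j = card S
    ρ = 1 ÷ (suc n ℕ.∸ (j ℕ.+ j))
    lemma : ∀ ρ A B a b x → ρ ℚ.* (A ℚ.+ B) ℚ.* a ℚ.* x
      ≡ ρ ℚ.* (A ℚ.* a ℚ.+ B ℚ.* b) ℚ.* x ℚ.+ ρ ℚ.* (a ℚ.- b) ℚ.* (B ℚ.* x)
    lemma = solve 6 (λ ρ A B a b x → ρ :* (A :+ B) :* a :* x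
      := ρ :* (A :* a :+ B :* b) :* x :+ ρ :* (a :- b) :* (B :* x)) refl
  -- For 2j > n the truncated denominator is 0, but the character vanishes at `x`, so both sides are
  -- 0.
  ... | inj₂ p rewrite character-vanishes-large x S p | ℤ.*-zeroʳ (factor₀ n s (card S)) =
    ≈-trans (ℝR.zeroʳ _) (≈-sym (≈-trans (+-cong (ℝR.zeroʳ _) (ℝR.zeroʳ _)) (ℝR.+-identityˡ 0ℝ)))

  term₁ : ∀ x S → suc (ones x) ≡ s →
    α₁ S * ι (character x S) ≈ α (false ∷ S) * ι (character x S) + α (true ∷ S) * ι (factor₁ n (ones x) (card S) ℤ.* character x S)
  term₁ x S refl with ℕ.≤-<-connex (card S ℕ.+ card S) n
  ... | inj₁ p = pointwise⇒≈ (λ i → begin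
      seq (α₁ S) i ℚ.* toℚ (character x S)
        ≡⟨ cong (ℚ._* toℚ (character x S)) (ℚ.*-identityˡ (seq (α₁ S) i)) ⟨
      1ℚ ℚ.* seq (α₁ S) i ℚ.* toℚ (character x S)
        ≡⟨ cong (λ a → a ℚ.* seq (α₁ S) i ℚ.* toℚ (character x S)) (r-inverse j p) ⟨
      ρ ℚ.* (toℚ (A j) ℚ.+ toℚ (B j)) ℚ.* seq (α₁ S) i ℚ.* toℚ (character x S)
        ≡⟨ lemma ρ (toℚ (A j)) (toℚ (B j)) (seq (α₀ S) i) (seq (α₁ S) i) (toℚ (character x S)) ⟩
      ρ ℚ.* (toℚ (A j) ℚ.* seq (α₀ S) i ℚ.+ toℚ (B j) ℚ.* seq (α₁ S) i) ℚ.* toℚ (character x S)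
        ℚ.+ ρ ℚ.* (seq (α₀ S) i ℚ.- seq (α₁ S) i) ℚ.* (ℚ.- toℚ (A j) ℚ.* toℚ (character x S))
        ≡⟨ cong (λ a → ρ ℚ.* (toℚ (A j) ℚ.* seq (α₀ S) i ℚ.+ toℚ (B j) ℚ.* seq (α₁ S) i) ℚ.* toℚ (character x S)
             ℚ.+ ρ ℚ.* (seq (α₀ S) i ℚ.- seq (α₁ S) i) ℚ.* a) factor≡ ⟩
      ρ ℚ.* (toℚ (A j) ℚ.* seq (α₀ S) i ℚ.+ toℚ (B j) ℚ.* seq (α₁ S) i) ℚ.* toℚ (character x S)
        ℚ.+ ρ ℚ.* (seq (α₀ S) i ℚ.- seq (α₁ S) i) ℚ.* toℚ (factor₁ n (ones x) j ℤ.* character x S) ∎)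
    where
    open ≡-Reasoning
    open +-*-Solver
    j = card S
    ρ = 1 ÷ (suc n ℕ.∸ (j ℕ.+ j))
    lemma : ∀ ρ A B a b x → ρ ℚ.* (A ℚ.+ B) ℚ.* b ℚ.* x
      ≡ ρ ℚ.* (A ℚ.* a ℚ.+ B ℚ.* b) ℚ.* x ℚ.+ ρ ℚ.* (a ℚ.- b) ℚ.* (ℚ.- A ℚ.* x)
    lemma = solve 6 (λ ρ A B a b x → ρ :* (A :+ B) :* b :* x
      := ρ :* (A :* a :+ B :* b) :* x :+ ρ :* (a :- b) :* (:- A :* x)) refl
    negate : ∀ n o j → ℤ.- (+ 1 ℤ.+ n ℤ.- (+ 1 ℤ.+ o) ℤ.- j) ≡ o ℤ.+ j ℤ.- n
    negate = solve-∀
    factor≡ : ℚ.- toℚ (A j) ℚ.* toℚ (character x S) ≡ toℚ (factor₁ n (ones x) j ℤ.* character x S)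
    factor≡ = begin
      ℚ.- toℚ (A j) ℚ.* toℚ (character x S)              ≡⟨ cong (ℚ._* toℚ (character x S)) (toℚ-neg (A j)) ⟨
      toℚ (ℤ.- A j) ℚ.* toℚ (character x S)              ≡⟨ toℚ-* (ℤ.- A j) (character x S) ⟨
      toℚ (ℤ.- A j ℤ.* character x S)                    ≡⟨ cong (λ a → toℚ (a ℤ.* character x S)) (negate (+ n) (+ ones x) (+ j)) ⟩
      toℚ (factor₁ n (ones x) j ℤ.* character x S)       ∎
  ... | inj₂ p rewrite character-vanishes-large x S p | ℤ.*-zeroʳ (factor₁ n (ones x) (card S)) =
    ≈-trans (ℝR.zeroʳ _) (≈-sym (≈-trans (+-cong (ℝR.zeroʳ _) (ℝR.zeroʳ _)) (ℝR.+-identityˡ 0ℝ)))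

-- The two halves of the level are expanded separately by induction, and `SpanStep` merges their
-- coefficients set by set. The sum runs over all Boolean vectors, top or not.
expansion : ∀ n s (f : Vec (Fin 2) n → ℝ) → Σ (Vec Bool n → ℝ) λ α →
  ∀ x → ones x ≡ s → f x ≈ ℝS.sumOver (allVecs bools n) (λ S → α S * ι (character x S))
expansion zero s f = (λ _ → f []) , λ { [] _ →
  ≈-sym (≈-trans (ℝR.+-identityʳ _) (ℝR.*-identityʳ (f []))) }
-- At s = 0 the predecessor is 0 again; no point of that level has head bit 1.
expansion (suc n) s f with expansion n s (f ∘ (0# ∷_)) | expansion n (ℕ.pred s) (f ∘ (1# ∷_))
... | α₀ , expand₀ | α₁ , expand₁ = α , expand
  where
  open SpanStep n s α₀ α₁
  expand : ∀ x → ones x ≡ s → f x ≈ ℝS.sumOver (allVecs bools (suc n)) (λ S → α S * ι (character x S))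
  expand (0# ∷ x) e = ≈-trans (expand₀ x e)
    (≈-trans (ℝS.sumOver-cong (allVecs bools n) (λ S → term₀ x S e))
      (≈-sym (sum-bools n (λ S → α S * ι (character (0# ∷ x) S)))))
  expand (1# ∷ x) e = ≈-trans (expand₁ x (cong ℕ.pred e))
    (≈-trans (ℝS.sumOver-cong (allVecs bools n) (λ S → term₁ x S e))
      (≈-sym (sum-bools n (λ S → α S * ι (character (1# ∷ x) S)))))

-- Orthogonality and independence

module ≈R = SetoidReasoning ℝR.setoid

ι-+ : ∀ a b → ι (a ℤ.+ b) ≈ ι a + ι b
ι-+ a b = pointwise⇒≈ (λ _ → toℚ-+ a b)

ι-* : ∀ a b → ι (a ℤ.* b) ≈ ι a * ι b
ι-* a b = pointwise⇒≈ (λ _ → toℚ-* a b)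

ι-- : ∀ a b → ι (a ℤ.- b) ≈ ι a - ι b
ι-- a b = pointwise⇒≈ (λ _ → toℚ-- a b)

ι-sumOver : ∀ {A : Set} (xs : List A) f → ι (ℤS.sumOver xs f) ≈ ℝS.sumOver xs (ι ∘ f)
ι-sumOver []       f = ≈-refl
ι-sumOver (x ∷ xs) f = ≈-trans (ι-+ (f x) _) (+-cong ≈-refl (ι-sumOver xs f))

ι-product : ∀ {d} (f : Vector ℤ d) (g : Vector ℝ d) → (∀ i → g i ≈ ι (f i)) → ℝ-Ops.product g ≈ ι (ℤS.product f)
ι-product {zero}  f g eq = ≈-refl
ι-product {suc d} f g eq = ≈-trans (*-cong (eq Fin.zero) (ι-product (f ∘ Fin.suc) (g ∘ Fin.suc) (eq ∘ Fin.suc)))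
  (≈-sym (ι-* (f Fin.zero) _))

∑≡sumOver : ∀ {A : Set} (xs : List A) f → ∑ xs f ≡ ℝS.sumOver xs f
∑≡sumOver = ℝS.sum-lookup

bit-idempotent : ∀ (a : Fin 2) → + toℕ a ℤ.* + toℕ a ≡ + toℕ a
bit-idempotent 0# = refl
bit-idempotent 1# = refl

-- Stated for any encoded sequence, top set or not: `classify` applies it in the case where the
-- filtered list is empty.
χ-eval : ∀ {n d} {S : Vec Bool n} {B : Vec (Fin n) d} → Encodes S B → (v : Vec (Fin 2) n) →
  ∑ (List.filter (below? B) (allVecs (List.allFin n) d)) (λ A → χ₂ A B (ι ∘ coordinatesℤ v)) ≈ ι (character (Vec.reverse v) S)
χ-eval {n} {d} {S} {B} e v = begin
  ∑ (List.filter (below? B) As) (λ A → χ₂ A B (ι ∘ x))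
    ≡⟨ ∑≡sumOver (List.filter (below? B) As) _ ⟩
  ℝS.sumOver (List.filter (below? B) As) (λ A → χ₂ A B (ι ∘ x))
    ≈⟨ ℝS.sumOver-filter (below? B) As (λ A → χ₂ A B (ι ∘ x)) ⟩
  ℝS.sumOver As (λ A → if does (below? B A) then χ₂ A B (ι ∘ x) else 0ℝ)
    ≈⟨ ℝS.sumOver-cong As (λ A → term A (below? B A)) ⟩
  ℝS.sumOver As (λ A → ι (⟦ below? B A ⟧ ℤ.* χ₂ℤ x A B))
    ≈⟨ ι-sumOver As (λ A → ⟦ below? B A ⟧ ℤ.* χ₂ℤ x A B) ⟨
  ι (ℤS.sumOver As (λ A → ⟦ below? B A ⟧ ℤ.* χ₂ℤ x A B))
    ≡⟨ cong ι (χℤ-product x (λ i → bit-idempotent (lookup v i)) d B (encodes⇒increasing e)) ⟩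
  ι (ℤS.product (λ i → localFactor x (toℕ i) (lookup B i)))
    ≡⟨ cong (λ u → ι (ℤS.product (λ i → localFactor (coordinatesℤ u) (toℕ i) (lookup B i)))) (Vec.reverse-involutive v) ⟨
  ι (ℤS.product (λ i → localFactor (coordinatesℤ (Vec.reverse (Vec.reverse v))) (toℕ i) (lookup B i)))
    ≡⟨ cong ι (product≡character e (Vec.reverse v)) ⟩
  ι (character (Vec.reverse v) S) ∎
  where
  open ≈R
  As = allVecs (List.allFin n) d
  x = coordinatesℤ v
  term : ∀ A (B? : Dec (Below B A)) →
    (if does B? then χ₂ A B (ι ∘ x) else 0ℝ) ≈ ι (⟦ B? ⟧ ℤ.* χ₂ℤ x A B)
  term A (yes _) = ≈-trans (ι-product (λ i → x (lookup A i) ℤ.- x (lookup B i)) _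
      (λ i → ≈-sym (ι-- (x (lookup A i)) (x (lookup B i)))))
    (≈-sym (fromℚ-cong (cong toℚ (ℤ.*-identityˡ (χ₂ℤ x A B)))))
  term A (no _) = ≈-sym (fromℚ-cong (cong toℚ (ℤ.*-zeroˡ (χ₂ℤ x A B))))

-- Summation over the slice

sumOver-level : ∀ n s (f : Vec (Fin 2) n → ℤ) →
  ℤS.sumOver (allVecs (List.allFin 2) n) (λ v → ⟦ ones v ℕ.≟ s ⟧ ℤ.* f v) ≡ levelSum n s f
sumOver-level zero    zero    f = trans (ℤ.+-identityʳ (+ 1 ℤ.* f [])) (ℤ.*-identityˡ (f []))
sumOver-level zero    (suc s) f = refl
sumOver-level (suc n) zero    f = begin
  ℤS.sumOver (allVecs (List.allFin 2) (suc n)) (λ v → ⟦ ones v ℕ.≟ 0 ⟧ ℤ.* f v)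
    ≡⟨ ℤS.sumOver-product Vec._∷_ (List.allFin 2) (allVecs (List.allFin 2) n) (λ v → ⟦ ones v ℕ.≟ 0 ⟧ ℤ.* f v) ⟩
  ℤS.sumOver (allVecs (List.allFin 2) n) (λ v → ⟦ ones v ℕ.≟ 0 ⟧ ℤ.* f (0# ∷ v))
    ℤ.+ (ℤS.sumOver (allVecs (List.allFin 2) n) (λ v → + 0 ℤ.* f (1# ∷ v)) ℤ.+ + 0)
    ≡⟨ cong₂ (λ a b → a ℤ.+ (b ℤ.+ + 0)) (sumOver-level n 0 (f ∘ (0# ∷_)))
         (trans (ℤS.sumOver-cong (allVecs (List.allFin 2) n) (λ v → ℤ.*-zeroˡ (f (1# ∷ v))))
           (ℤS.sumOver-0 (allVecs (List.allFin 2) n))) ⟩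
  levelSum n 0 (f ∘ (0# ∷_)) ℤ.+ + 0
    ≡⟨ ℤ.+-identityʳ _ ⟩
  levelSum (suc n) 0 f ∎
  where open ≡-Reasoning
sumOver-level (suc n) (suc s) f = begin
  ℤS.sumOver (allVecs (List.allFin 2) (suc n)) (λ v → ⟦ ones v ℕ.≟ suc s ⟧ ℤ.* f v)
    ≡⟨ ℤS.sumOver-product Vec._∷_ (List.allFin 2) (allVecs (List.allFin 2) n) (λ v → ⟦ ones v ℕ.≟ suc s ⟧ ℤ.* f v) ⟩
  ℤS.sumOver (allVecs (List.allFin 2) n) (λ v → ⟦ ones v ℕ.≟ suc s ⟧ ℤ.* f (0# ∷ v))
    ℤ.+ (ℤS.sumOver (allVecs (List.allFin 2) n) (λ v → ⟦ ones v ℕ.≟ s ⟧ ℤ.* f (1# ∷ v)) ℤ.+ + 0)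
    ≡⟨ cong₂ ℤ._+_ (sumOver-level n (suc s) (f ∘ (0# ∷_)))
         (trans (ℤ.+-identityʳ _) (sumOver-level n s (f ∘ (1# ∷_)))) ⟩
  levelSum (suc n) (suc s) f ∎
  where open ≡-Reasoning

sumOver-slice : ∀ n k (g : Vec (Fin 2) n → ℤ) →
  ℤS.sumOver (slicePoints n k) (g ∘ value) ≡ levelSum n k (g ∘ Vec.reverse)
sumOver-slice n k g = begin
  ℤS.sumOver (slicePoints n k) (g ∘ value)
    ≡⟨ ℤS.sumOver-mapMaybe (toSlice k) vs (g ∘ value) ⟩
  ℤS.sumOver vs (λ v → maybe (g ∘ value) (+ 0) (toSlice k v))
    ≡⟨ ℤS.sumOver-cong vs term ⟩
  ℤS.sumOver vs (λ v → ⟦ ones v ℕ.≟ k ⟧ ℤ.* g v)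
    ≡⟨ ℤS.sumOver-reverse (List.allFin 2) n (λ v → ⟦ ones v ℕ.≟ k ⟧ ℤ.* g v) ⟩
  ℤS.sumOver vs (λ v → ⟦ ones (Vec.reverse v) ℕ.≟ k ⟧ ℤ.* g (Vec.reverse v))
    ≡⟨ ℤS.sumOver-cong vs (λ v → cong (λ o → ⟦ o ℕ.≟ k ⟧ ℤ.* g (Vec.reverse v)) (ones-reverse v)) ⟩
  ℤS.sumOver vs (λ v → ⟦ ones v ℕ.≟ k ⟧ ℤ.* g (Vec.reverse v))
    ≡⟨ sumOver-level n k (g ∘ Vec.reverse) ⟩
  levelSum n k (g ∘ Vec.reverse) ∎
  where
  open ≡-Reasoning
  vs = allVecs (List.allFin 2) n
  term : ∀ v → maybe (g ∘ value) (+ 0) (toSlice k v) ≡ ⟦ ones v ℕ.≟ k ⟧ ℤ.* g v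
  term v with ones v ℕ.≟ k
  ... | yes p = sym (trans (cong (ℤ._* g v) (⟦⟧-yes (ones v ℕ.≟ k) p)) (ℤ.*-identityˡ (g v)))
  ... | no ¬p = sym (trans (cong (ℤ._* g v) (⟦⟧-no (ones v ℕ.≟ k) ¬p)) (ℤ.*-zeroˡ (g v)))

-- Boolean codes of top sets

increasing? : ∀ {n d} (B : Vec (Fin n) d) → Dec (Increasing B)
increasing? B = Fin.all? (λ i → Fin.all? (λ j → (i Fin.<? j) →-dec (lookup B i Fin.<? lookup B j)))

top? : ∀ {n} (S : Vec Bool n) → Dec (Top S)
top? []                = yes tt
top? {suc n} S@(_ ∷ T) = top? T ×-dec (card S ℕ.+ card S ℕ.≤? suc n)

record Code {n d : ℕ} (B : Vec (Fin n) d) : Set where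
  constructor mkCode
  field
    subset  : Vec Bool n
    encodes : Encodes subset B
    top     : Top subset

-- The proof that `B` is a top set is irrelevant, so no sequence A can be extracted from it. Its
-- decidable consequences `Increasing` and `Top` are recovered by `recompute`.
code : ∀ {n d} (B : TopSet n d) → Code (value B)
code {n} {d} (B Refinement., [ p ]) = mkCode (proj₁ S) (proj₂ S) (recompute (top? (proj₁ S)) (isTop p))
  where
  S = encode n B (recompute (increasing? B) (proj₁ p))
  isTop : IsTopSet B → Top (proj₁ S)
  isTop (inc , A , below) = encodes⇒top (proj₂ S) (below⇒large d B A inc below)

module _ {n d k : ℕ} (B : TopSet n d) where
  open Code (code B)

  χ-code : ∀ (x : Slice n k) → restrict {n} {k} (χ B) x ≈ ι (character (Vec.reverse (value x)) subset)
  χ-code x = χ-eval encodes (value x)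

inner : ∀ {n d d′ k} (B : TopSet n d) (B′ : TopSet n d′) →
  ∑ (slicePoints n k) (λ x → restrict {n} {k} (χ B) x * restrict {n} {k} (χ B′) x)
    ≈ ι (gram k (Code.subset (code B)) (Code.subset (code B′)))
inner {n} {d} {d′} {k} B B′ = begin
  ∑ (slicePoints n k) (λ x → restrict {n} {k} (χ B) x * restrict {n} {k} (χ B′) x)
    ≡⟨ ∑≡sumOver (slicePoints n k) _ ⟩
  ℝS.sumOver (slicePoints n k) (λ x → restrict {n} {k} (χ B) x * restrict {n} {k} (χ B′) x)
    ≈⟨ ℝS.sumOver-cong (slicePoints n k) (λ x → ≈-trans (*-cong (χ-code B x) (χ-code B′ x))
         (≈-sym (ι-* (character (Vec.reverse (value x)) S) (character (Vec.reverse (value x)) S′)))) ⟩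
  ℝS.sumOver (slicePoints n k) (λ x → ι (g (value x)))
    ≈⟨ ι-sumOver (slicePoints n k) (g ∘ value) ⟨
  ι (ℤS.sumOver (slicePoints n k) (g ∘ value))
    ≡⟨ cong ι (trans (sumOver-slice n k g) (levelSum-cong n k (λ x _ →
         cong (λ u → character u S ℤ.* character u S′) (Vec.reverse-involutive x)))) ⟩
  ι (gram k S S′) ∎
  where
  open ≈R
  S = Code.subset (code B)
  S′ = Code.subset (code B′)
  g : Vec (Fin 2) n → ℤ
  g v = character (Vec.reverse v) S ℤ.* character (Vec.reverse v) S′

topSetUpTo-≡ : ∀ {n k} (B B′ : TopSetUpTo n k) → let open TopSetUpTo in
  _≡_ {A = Σ ℕ (Vec (Fin n))} (d B , value (topSet B)) (d B′ , value (topSet B′)) → B ≡ B′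
topSetUpTo-≡ (mkTopSetUpTo d _ (B Refinement., _)) (mkTopSetUpTo _ _ (_ Refinement., _)) refl = refl

subset : ∀ {n k} → TopSetUpTo n k → Vec Bool n
subset B = Code.subset (code (TopSetUpTo.topSet B))

subset-injective : ∀ {n k} (B B′ : TopSetUpTo n k) → subset B ≡ subset B′ → B ≡ B′
subset-injective B B′ eq = topSetUpTo-≡ B B′ (encodes-functional
  (Code.encodes (code (TopSetUpTo.topSet B)))
  (subst (λ S → Encodes S (value (TopSetUpTo.topSet B′))) (sym eq) (Code.encodes (code (TopSetUpTo.topSet B′)))))

unnormalised-orthogonal : ∀ {n k} (B B′ : TopSetUpTo n k) → B ≢ B′ →
  ∑ (slicePoints n k) (λ x → χ-family n k B x * χ-family n k B′ x) ≈ 0ℝ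
unnormalised-orthogonal {n} {k} B B′ B≢B′ = ≈-trans (inner (TopSetUpTo.topSet B) (TopSetUpTo.topSet B′))
  (fromℚ-cong (cong toℚ (gram-off-diagonal (subset B) (subset B′)
    (Code.top (code (TopSetUpTo.topSet B))) (Code.top (code (TopSetUpTo.topSet B′)))
    (B≢B′ ∘ subset-injective B B′) k)))

orthogonal : ∀ n k → Orthogonal (χ-family n k)
orthogonal n k {B} {B′} B≢B′ = ≈-trans (*-cong ≈-refl (unnormalised-orthogonal B B′ B≢B′)) (ℝR.zeroʳ _)

-- For an element preceded by j others, the ballot condition gives 2(j+1) ≤ n + 1, so the factors n
-- + 1 - 2j and n - 2j are at least 2 and 1.
normConst-positive : ∀ {n} (S : Vec Bool n) → Top S → ∃ λ p → normConst S ≡ + suc p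
normConst-positive []          _         = 0 , refl
normConst-positive (false ∷ S) (top , _) = normConst-positive S top
normConst-positive {suc n} (true ∷ S) (top , 2j≤n) with normConst-positive S top
... | p , eq = _ , cong₂ ℤ._*_ (cong₂ ℤ._*_ first (cong (ℤ._- + 1) first)) eq
  where
  j = card S
  m = suc n ℕ.∸ (suc j ℕ.+ suc j)
  first : + suc n ℤ.- + 2 ℤ.* + j ≡ + suc (suc m)
  first = trans (cong (λ a → + a ℤ.- + 2 ℤ.* + j) (sym (ℕ.m+[n∸m]≡n 2j≤n))) (lemma (+ j) (+ m))
    where
    lemma : ∀ j m → (+ 1 ℤ.+ j ℤ.+ (+ 1 ℤ.+ j) ℤ.+ m) ℤ.- + 2 ℤ.* j ≡ + 2 ℤ.+ m
    lemma = solve-∀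

-- d ≤ k ≤ n - d is the range in which binom(n-2d, k-d) does not vanish.
gram-positive : ∀ {n} (S : Vec Bool n) → Top S → ∀ k → card S ℕ.≤ k → k ℕ.+ card S ℕ.≤ n → ∃ λ p → gram k S S ≡ + suc p
gram-positive {n} S top k d≤k k+d≤n with normConst-positive S top | shifted (card S) m k in eq | shifted-positive (card S) m k d≤k k≤d+m
  where
  d = card S
  m = n ℕ.∸ (d ℕ.+ d)
  k≤d+m : k ℕ.≤ d ℕ.+ m
  k≤d+m = ℕ.+-cancelˡ-≤ d k (d ℕ.+ m) (ℕ.≤-trans (ℕ.≤-reflexive (ℕ.+-comm d k)) (ℕ.≤-trans k+d≤n
    (ℕ.≤-reflexive (trans (sym (ℕ.m+[n∸m]≡n (top⇒2card≤n S top))) (ℕ.+-assoc d d m)))))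
... | p , norm≡ | suc q | _ = _ , trans (gram-diagonal S top _ k (sym (ℕ.m+[n∸m]≡n (top⇒2card≤n S top))))
  (cong₂ (λ a b → a ℤ.* + b) norm≡ eq)

sumOver-zero : ∀ {A : Set} (xs : List A) {f : A → ℝ} → ListAll.All (λ x → f x ≈ 0ℝ) xs → ℝS.sumOver xs f ≈ 0ℝ
sumOver-zero []       []       = ≈-refl
sumOver-zero (x ∷ xs) (p ∷ ps) = ≈-trans (+-cong p (sumOver-zero xs ps)) (ℝR.+-identityˡ 0ℝ)

sumOver-single : ∀ {A : Set} (xs : List A) {f : A → ℝ} {a} → ListUnique.Unique xs → a ∈ xs →
  (∀ x → x ≢ a → f x ≈ 0ℝ) → ℝS.sumOver xs f ≈ f a
sumOver-single (x ∷ xs) (x∉xs ∷ _) (here refl) zero-off =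
  ≈-trans (+-cong ≈-refl (sumOver-zero xs (ListAll.map (λ x≢y → zero-off _ (x≢y ∘ sym)) x∉xs))) (ℝR.+-identityʳ _)
sumOver-single (x ∷ xs) (x∉xs ∷ u) (there a∈xs) zero-off =
  ≈-trans (+-cong (zero-off x (ListAll.lookup x∉xs a∈xs)) (sumOver-single xs u a∈xs zero-off)) (ℝR.+-identityˡ _)

cancel-ι : ∀ {x} p → x * ι (+ suc p) ≈ 0ℝ → x ≈ 0ℝ
cancel-ι {x} p eq = begin
  x                                  ≈⟨ ℝR.*-identityʳ x ⟨
  x * 1ℝ                             ≈⟨ *-cong ≈-refl (pointwise⇒≈ (λ _ → trans (ℚ.*-comm (toℚ (+ suc p)) (1 ÷ suc p)) (/-cancel (+ 1) p))) ⟨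
  x * (ι (+ suc p) * fromℚ (1 ÷ suc p)) ≈⟨ ℝR.*-assoc x _ _ ⟨
  x * ι (+ suc p) * fromℚ (1 ÷ suc p)   ≈⟨ *-cong eq ≈-refl ⟩
  0ℝ * fromℚ (1 ÷ suc p)             ≈⟨ ℝR.zeroˡ _ ⟩
  0ℝ ∎
  where open ≈R

independent : ∀ n k → 2 ℕ.* k ℕ.≤ n → LinearlyIndependent (χ-family n k)
independent n k 2k≤n is unique c vanishes {B} B∈is = cancel-ι p (begin
  c B * ι (+ suc p)
    ≡⟨ cong (λ a → c B * ι a) gram≡ ⟨
  c B * ι (gram k (subset B) (subset B))
    ≈⟨ *-cong ≈-refl (inner (TopSetUpTo.topSet B) (TopSetUpTo.topSet B)) ⟨
  c B * ∑ (slicePoints n k) (λ x → e B x * e B x)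
    ≈⟨ sumOver-single is unique B∈is (λ B′ B′≢B →
         ≈-trans (*-cong ≈-refl (unnormalised-orthogonal B′ B B′≢B)) (ℝR.zeroʳ (c B′))) ⟨
  ℝS.sumOver is (λ B′ → c B′ * ∑ (slicePoints n k) (λ x → e B′ x * e B x))
    ≈⟨ ℝS.sumOver-cong is (λ B′ → ≈-trans (*-cong ≈-refl (ℝR.reflexive (∑≡sumOver (slicePoints n k) _)))
         (≈-sym (ℝS.sumOver-*ˡ (slicePoints n k) (c B′) (λ x → e B′ x * e B x)))) ⟩
  ℝS.sumOver is (λ B′ → ℝS.sumOver (slicePoints n k) (λ x → c B′ * (e B′ x * e B x)))
    ≈⟨ ℝS.sumOver-swap is (slicePoints n k) (λ B′ x → c B′ * (e B′ x * e B x)) ⟩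
  ℝS.sumOver (slicePoints n k) (λ x → ℝS.sumOver is (λ B′ → c B′ * (e B′ x * e B x)))
    ≈⟨ ℝS.sumOver-cong (slicePoints n k) (λ x → row x) ⟩
  ℝS.sumOver (slicePoints n k) (λ _ → 0ℝ)
    ≈⟨ ℝS.sumOver-0 (slicePoints n k) ⟩
  0ℝ ∎)
  where
  open ≈R
  e = χ-family n k
  d≤k : card (subset B) ℕ.≤ k
  d≤k = recompute (card (subset B) ℕ.≤? k) (lemma B)
    where
    lemma : ∀ (B : TopSetUpTo n k) → card (subset B) ℕ.≤ k
    lemma (mkTopSetUpTo d d≤k B) = ℕ.≤-trans (ℕ.≤-reflexive (card≡ (Code.encodes (code B)))) (recompute (d ℕ.≤? k) d≤k)
  positive = gram-positive (subset B) (Code.top (code (TopSetUpTo.topSet B))) k d≤k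
    (ℕ.≤-trans (ℕ.+-monoʳ-≤ k (ℕ.≤-trans d≤k (ℕ.≤-reflexive (sym (ℕ.+-identityʳ k))))) 2k≤n)
  p = proj₁ positive
  gram≡ = proj₂ positive
  row : ∀ x → ℝS.sumOver is (λ B′ → c B′ * (e B′ x * e B x)) ≈ 0ℝ
  row x = begin
    ℝS.sumOver is (λ B′ → c B′ * (e B′ x * e B x))   ≈⟨ ℝS.sumOver-cong is (λ B′ → ℝR.*-assoc (c B′) (e B′ x) (e B x)) ⟨
    ℝS.sumOver is (λ B′ → c B′ * e B′ x * e B x)     ≈⟨ ℝS.sumOver-*ʳ is (e B x) (λ B′ → c B′ * e B′ x) ⟩
    ℝS.sumOver is (λ B′ → c B′ * e B′ x) * e B x     ≈⟨ *-cong (≈-trans (ℝR.reflexive (sym (∑≡sumOver is _))) (vanishes x)) ≈-refl ⟩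
    0ℝ * e B x                                       ≈⟨ ℝR.zeroˡ (e B x) ⟩
    0ℝ ∎

open import Data.Nat.Combinatorics using (_P_)

-- Spanning

toSlice-value : ∀ {n k} (x : Slice n k) → toSlice k (value x) ≡ just x
toSlice-value {n} {k} (v Refinement., [ p ]) with ones v ℕ.≟ k
... | yes _ = refl
... | no ¬p = contradiction (recompute (ones v ℕ.≟ k) p) ¬p

ones-value : ∀ {n k} (x : Slice n k) → ones (value x) ≡ k
ones-value {k = k} (v Refinement., [ p ]) = recompute (ones v ℕ.≟ k) p

-- If no A lies below B then the sum defining χ_B is empty, so a set that is not a top set
-- gives the zero function; no counting criterion for top sets is needed here.
classify : ∀ {n} k (S : Vec Bool n) →
  (Σ (TopSetUpTo n k) λ B → subset B ≡ S) ⊎ (∀ (x : Slice n k) → ι (character (Vec.reverse (value x)) S) ≈ 0ℝ)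
classify {n} k S with decode S
... | d , B , e with d ℕ.≤? k
...   | no d≰k = inj₂ (λ x → fromℚ-cong (cong toℚ (character-vanishes (Vec.reverse (value x)) S
          (inj₁ (≡.subst₂ ℕ._<_ (sym (trans (ones-reverse (value x)) (ones-value x))) (sym (card≡ e)) (ℕ.≰⇒> d≰k))))))
...   | yes d≤k = go (List.filter (below? B) (allVecs (List.allFin n) d)) refl
  where
  go : ∀ As → List.filter (below? B) (allVecs (List.allFin n) d) ≡ As →
    (Σ (TopSetUpTo n k) λ B → subset B ≡ S) ⊎ (∀ (x : Slice n k) → ι (character (Vec.reverse (value x)) S) ≈ 0ℝ)
  go []      eq = inj₂ (λ x → ≈-trans (≈-sym (χ-eval e (value x)))
    (ℝR.reflexive (cong (λ As → ∑ As (λ A → χ₂ A B (ι ∘ coordinatesℤ (value x)))) eq)))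
  go (A ∷ _) eq = inj₁ (mkTopSetUpTo d d≤k topSet
    , encodes-injective (Code.encodes (code topSet)) e refl)
    where
    below : Below B A
    below = proj₂ (∈-filter⁻ (below? B) {xs = allVecs (List.allFin n) d} (subst (A ∈_) (sym eq) (here refl)))
    topSet : TopSet n d
    topSet = B Refinement., [ encodes⇒increasing e , A , below ]

spanning : ∀ n k → Spanning (χ-family n k)
spanning n k f = is , (α ∘ subset) , (λ x → begin
    f x
      ≡⟨ cong (maybe f 0ℝ) (toSlice-value x) ⟨
    extended (value x)
      ≡⟨ cong extended (Vec.reverse-involutive (value x)) ⟨
    extended (Vec.reverse (Vec.reverse (value x)))
      ≈⟨ expand (Vec.reverse (value x)) (trans (ones-reverse (value x)) (ones-value x)) ⟩
    ℝS.sumOver (allVecs bools n) (λ S → α S * ι (character (Vec.reverse (value x)) S))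
      ≈⟨ ℝS.sumOver-cong (allVecs bools n) (λ S → term x S (classify k S)) ⟨
    ℝS.sumOver (allVecs bools n) (λ S → maybe (λ B → α (subset B) * χ-family n k B x) 0ℝ (choose (classify k S)))
      ≈⟨ ℝS.sumOver-mapMaybe (λ S → choose (classify k S)) (allVecs bools n) (λ B → α (subset B) * χ-family n k B x) ⟨
    ℝS.sumOver is (λ B → α (subset B) * χ-family n k B x)
      ≡⟨ ∑≡sumOver is _ ⟨
    ∑ is (λ B → α (subset B) * χ-family n k B x) ∎)
  where
  open ≈R
  -- Points of the slice carry a proof about all their coordinates; extension by 0 to every 0/1
  -- vector lets `expansion` split off coordinates.
  extended : Vec (Fin 2) n → ℝ
  extended v = maybe f 0ℝ (toSlice k v)
  expanded = expansion n k (extended ∘ Vec.reverse)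
  α = proj₁ expanded
  expand = proj₂ expanded
  Classified : Vec Bool n → Set
  Classified S = (Σ (TopSetUpTo n k) λ B → subset B ≡ S) ⊎ (∀ (x : Slice n k) → ι (character (Vec.reverse (value x)) S) ≈ 0ℝ)
  choose : ∀ {S} → Classified S → Maybe (TopSetUpTo n k)
  choose (inj₁ (B , _)) = just B
  choose (inj₂ _)       = nothing
  is = List.mapMaybe (λ S → choose (classify k S)) (allVecs bools n)
  term : ∀ x S (C : Classified S) →
    maybe (λ B → α (subset B) * χ-family n k B x) 0ℝ (choose C) ≈ α S * ι (character (Vec.reverse (value x)) S)
  term x S (inj₁ (B , refl)) = *-cong ≈-refl (χ-code (TopSetUpTo.topSet B) x)
  term x S (inj₂ vanishes)   = ≈-sym (≈-trans (*-cong ≈-refl (vanishes x)) (ℝR.zeroʳ (α S)))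

-- Norms

nat : ℕ → ℚ
nat a = a ÷ 1

nat-* : ∀ a b → nat (a ℕ.* b) ≡ nat a ℚ.* nat b
nat-* a b = trans (cong toℚ (ℤ.pos-* a b)) (toℚ-* (+ a) (+ b))

nat-+ : ∀ a b → nat (a ℕ.+ b) ≡ nat a ℚ.+ nat b
nat-+ a b = toℚ-+ (+ a) (+ b)

÷-cancel : ∀ a {b} → 1 ℕ.≤ b → (a ÷ b) ℚ.* nat b ≡ nat a
÷-cancel a {suc b} _ = /-cancel (+ a) b

levelSum-binomial : ∀ n k → levelSum n k (λ _ → + 1) ≡ + binomial n k
levelSum-binomial zero    zero    = refl
levelSum-binomial zero    (suc k) = refl
levelSum-binomial (suc n) zero    = levelSum-binomial n zero
levelSum-binomial (suc n) (suc k) = trans (cong₂ ℤ._+_ (levelSum-binomial n (suc k)) (levelSum-binomial n k))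
  (ℤ.+-comm (+ binomial n (suc k)) (+ binomial n k))

length≡binomial : ∀ n k → List.length (slicePoints n k) ≡ binomial n k
length≡binomial n k = ℤ.+-injective (trans (count (slicePoints n k))
  (trans (sumOver-slice n k (λ _ → + 1)) (levelSum-binomial n k)))
  where
  count : ∀ {A : Set} (xs : List A) → + List.length xs ≡ ℤS.sumOver xs (λ _ → + 1)
  count []       = refl
  count (x ∷ xs) = cong (λ a → + 1 ℤ.+ a) (count xs)

product-halves : ∀ {d} (f : Vector ℤ d) →
  ℚ-Ops.product (λ i → f i ℚ./ 2) ℚ.* nat (2 ℕ.^ d) ≡ toℚ (ℤS.product f)
product-halves {zero}  f = refl
product-halves {suc d} f = begin
  (f₀ ℚ./ 2) ℚ.* Q ℚ.* nat (2 ℕ.* 2 ℕ.^ d)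
    ≡⟨ cong ((f₀ ℚ./ 2) ℚ.* Q ℚ.*_) (nat-* 2 (2 ℕ.^ d)) ⟩
  (f₀ ℚ./ 2) ℚ.* Q ℚ.* (nat 2 ℚ.* nat (2 ℕ.^ d))
    ≡⟨ interchange (f₀ ℚ./ 2) Q (nat 2) (nat (2 ℕ.^ d)) ⟩
  ((f₀ ℚ./ 2) ℚ.* nat 2) ℚ.* (Q ℚ.* nat (2 ℕ.^ d))
    ≡⟨ cong₂ ℚ._*_ (/-cancel f₀ 1) (product-halves (f ∘ Fin.suc)) ⟩
  toℚ f₀ ℚ.* toℚ (ℤS.product (f ∘ Fin.suc))
    ≡⟨ toℚ-* f₀ (ℤS.product (f ∘ Fin.suc)) ⟨
  toℚ (ℤS.product f) ∎
  where
  open ≡-Reasoning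
  open +-*-Solver
  f₀ = f Fin.zero
  Q = ℚ-Ops.product (λ i → f (Fin.suc i) ℚ./ 2)
  interchange : ∀ a b c d → a ℚ.* b ℚ.* (c ℚ.* d) ≡ (a ℚ.* c) ℚ.* (b ℚ.* d)
  interchange = solve 4 (λ a b c d → a :* b :* (c :* d) := (a :* c) :* (b :* d)) refl

c-normConst : ∀ {n d} (B : TopSet n d) → c B ℚ.* nat (2 ℕ.^ d) ≡ toℚ (normConst (Code.subset (code B)))
c-normConst B = trans (product-halves (λ i → normFactor (toℕ i) (lookup (value B) i)))
  (cong toℚ (normConst≡product (Code.encodes (code B))))

-- `gram-diagonal` divided by the number binom(n,k) of points, with `normConst` read as 2^d c_B and
-- the quotient of binomial coefficients rewritten by `shifted-falling`.
norm-value : ∀ {n d k} (B : TopSet n d) → d ℕ.≤ k → 2 ℕ.* k ℕ.≤ n →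
  ‖ restrict {n} {k} (χ B) ‖² ≈ fromℚ (c B ℚ.* ((2 ℕ.^ d ℕ.* (k P d) ℕ.* ((n ℕ.∸ k) P d)) ÷ (n P (2 ℕ.* d))))
norm-value {n} {d} {k} B d≤k 2k≤n = ≈-trans (*-cong ≈-refl (inner {k = k} B B)) (pointwise⇒≈ (λ _ → value≡))
  where
  open ≡-Reasoning
  S = Code.subset (code B)
  l = n ℕ.∸ k
  k≤n : k ℕ.≤ n
  k≤n = ℕ.≤-trans (ℕ.m≤m+n k _) 2k≤n
  k+l≡n : k ℕ.+ l ≡ n
  k+l≡n = ℕ.m+[n∸m]≡n k≤n
  k≤l : k ℕ.≤ l
  k≤l = ℕ.+-cancelˡ-≤ k k l (ℕ.≤-trans (ℕ.≤-trans (ℕ.≤-reflexive (cong (k ℕ.+_) (sym (ℕ.+-identityʳ k)))) 2k≤n)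
    (ℕ.≤-reflexive (sym k+l≡n)))
  d≤l : d ℕ.≤ l
  d≤l = ℕ.≤-trans d≤k k≤l
  2d≤n : d ℕ.+ d ℕ.≤ n
  2d≤n = ℕ.≤-trans (ℕ.+-mono-≤ d≤k d≤l) (ℕ.≤-reflexive k+l≡n)
  m = n ℕ.∸ (d ℕ.+ d)
  n≡ : n ≡ d ℕ.+ d ℕ.+ m
  n≡ = sym (ℕ.m+[n∸m]≡n 2d≤n)
  2*d≤n : 2 ℕ.* d ℕ.≤ n
  2*d≤n = ℕ.≤-trans (ℕ.≤-reflexive (cong (d ℕ.+_) (ℕ.+-identityʳ d))) 2d≤n
  gram≡ : gram k S S ≡ normConst S ℤ.* + shifted d m k
  gram≡ = trans (gram-diagonal S (Code.top (code B)) m k (trans n≡ (cong (λ j → j ℕ.+ j ℕ.+ m) (sym card≡d))))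
    (cong (λ j → normConst S ℤ.* + shifted j m k) card≡d)
    where card≡d = card≡ (Code.encodes (code B))
  len = List.length (slicePoints n k)
  D = n P (2 ℕ.* d)
  counting : nat (shifted d m k) ℚ.* nat D ≡ nat len ℚ.* (nat (k P d) ℚ.* nat (l P d))
  counting = begin
    nat (shifted d m k) ℚ.* nat D
      ≡⟨ nat-* (shifted d m k) D ⟨
    nat (shifted d m k ℕ.* D)
      ≡⟨ cong nat (≡.trans (cong (shifted d m k ℕ.*_) (P≡P′ 2*d≤n))
           (≡.subst₂ (λ a b → shifted d m k ℕ.* (a P′ (2 ℕ.* d)) ≡ b ℕ.* ((k P′ d) ℕ.* (l P′ d)))
             k+l≡n (trans (cong (λ a → binomial a k) k+l≡n) (sym (length≡binomial n k)))
             (shifted-falling d m k l d≤k d≤l (trans k+l≡n n≡)))) ⟩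
    nat (len ℕ.* ((k P′ d) ℕ.* (l P′ d)))
      ≡⟨ cong₂ (λ a b → nat (len ℕ.* (a ℕ.* b))) (P≡P′ d≤k) (P≡P′ d≤l) ⟨
    nat (len ℕ.* ((k P d) ℕ.* (l P d)))
      ≡⟨ trans (nat-* len _) (cong (nat len ℚ.*_) (nat-* (k P d) (l P d))) ⟩
    nat len ℚ.* (nat (k P d) ℚ.* nat (l P d)) ∎
  len-positive : 1 ℕ.≤ len
  len-positive = ℕ.≤-trans (shifted-positive 0 n k z≤n k≤n) (ℕ.≤-reflexive (sym (length≡binomial n k)))
  D-positive : 1 ℕ.≤ D
  D-positive = ℕ.≤-trans (P′-positive n (2 ℕ.* d) 2*d≤n) (ℕ.≤-reflexive (sym (P≡P′ 2*d≤n)))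
  a = 1 ÷ len
  e = 1 ÷ D
  t = nat (2 ℕ.^ d)
  x = nat (k P d)
  y = nat (l P d)
  s = nat (shifted d m k)
  q = (2 ℕ.^ d ℕ.* (k P d) ℕ.* (l P d)) ÷ D
  q≡ : t ℚ.* x ℚ.* y ≡ q ℚ.* nat D
  q≡ = sym (trans (÷-cancel (2 ℕ.^ d ℕ.* (k P d) ℕ.* (l P d)) D-positive)
    (trans (nat-* (2 ℕ.^ d ℕ.* (k P d)) (l P d)) (cong (ℚ._* y) (nat-* (2 ℕ.^ d) (k P d)))))
  value≡ : a ℚ.* toℚ (gram k S S) ≡ c B ℚ.* q
  value≡ = begin
    a ℚ.* toℚ (gram k S S)
      ≡⟨ cong (a ℚ.*_) (trans (cong toℚ gram≡) (trans (toℚ-* (normConst S) (+ shifted d m k))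
           (cong (ℚ._* s) (sym (c-normConst B))))) ⟩
    a ℚ.* (c B ℚ.* t ℚ.* s)
      ≡⟨ ℚ.*-identityʳ _ ⟨
    a ℚ.* (c B ℚ.* t ℚ.* s) ℚ.* 1ℚ
      ≡⟨ cong (a ℚ.* (c B ℚ.* t ℚ.* s) ℚ.*_) (÷-cancel 1 D-positive) ⟨
    a ℚ.* (c B ℚ.* t ℚ.* s) ℚ.* (e ℚ.* nat D)
      ≡⟨ regroup₁ a (c B) t s e (nat D) ⟩
    a ℚ.* c B ℚ.* t ℚ.* (s ℚ.* nat D) ℚ.* e
      ≡⟨ cong (λ z → a ℚ.* c B ℚ.* t ℚ.* z ℚ.* e) counting ⟩
    a ℚ.* c B ℚ.* t ℚ.* (nat len ℚ.* (x ℚ.* y)) ℚ.* e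
      ≡⟨ regroup₂ a (c B) t (nat len) x y e ⟩
    (a ℚ.* nat len) ℚ.* c B ℚ.* (t ℚ.* x ℚ.* y) ℚ.* e
      ≡⟨ cong₂ (λ u v → u ℚ.* c B ℚ.* v ℚ.* e) (÷-cancel 1 len-positive) q≡ ⟩
    1ℚ ℚ.* c B ℚ.* (q ℚ.* nat D) ℚ.* e
      ≡⟨ regroup₃ (c B) q (nat D) e ⟩
    c B ℚ.* q ℚ.* (e ℚ.* nat D)
      ≡⟨ cong (c B ℚ.* q ℚ.*_) (÷-cancel 1 D-positive) ⟩
    c B ℚ.* q ℚ.* 1ℚ
      ≡⟨ ℚ.*-identityʳ _ ⟩
    c B ℚ.* q ∎
    where
    open +-*-Solver
    regroup₁ : ∀ a c t s e D → a ℚ.* (c ℚ.* t ℚ.* s) ℚ.* (e ℚ.* D) ≡ a ℚ.* c ℚ.* t ℚ.* (s ℚ.* D) ℚ.* e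
    regroup₁ = solve 6 (λ a c t s e D → a :* (c :* t :* s) :* (e :* D) := a :* c :* t :* (s :* D) :* e) refl
    regroup₂ : ∀ a c t l x y e → a ℚ.* c ℚ.* t ℚ.* (l ℚ.* (x ℚ.* y)) ℚ.* e ≡ (a ℚ.* l) ℚ.* c ℚ.* (t ℚ.* x ℚ.* y) ℚ.* e
    regroup₂ = solve 7 (λ a c t l x y e → a :* c :* t :* (l :* (x :* y)) :* e := (a :* l) :* c :* (t :* x :* y) :* e) refl
    regroup₃ : ∀ c q D e → 1ℚ ℚ.* c ℚ.* (q ℚ.* D) ℚ.* e ≡ c ℚ.* q ℚ.* (e ℚ.* D)
    regroup₃ = solve 4 (λ c q D e → con 1ℚ :* c :* (q :* D) :* e := c :* q :* (e :* D)) refl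

-- The asymptotic estimate over the rationals

0≤nat : ∀ a → 0ℚ ℚ.≤ nat a
0≤nat a = ℚ.nonNegative⁻¹ (nat a) {{ℚ.normalize-nonNeg a 1}}

nat-positive : ∀ {a} → 1 ℕ.≤ a → ℚ.Positive (nat a)
nat-positive {suc a} _ = ℚ.normalize-pos (suc a) 1

nat-mono : ∀ {a b} → a ℕ.≤ b → nat a ℚ.≤ nat b
nat-mono {a} {b} a≤b = ℚ.≤-trans (ℚ.≤-reflexive (sym (ℚ.+-identityʳ (nat a))))
  (ℚ.≤-trans (ℚ.+-monoʳ-≤ (nat a) (0≤nat (b ℕ.∸ a)))
    (ℚ.≤-reflexive (trans (sym (nat-+ a (b ℕ.∸ a))) (cong nat (ℕ.m+[n∸m]≡n a≤b)))))

nat-∸ : ∀ a b → nat a ℚ.- nat b ℚ.≤ nat (a ℕ.∸ b)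
nat-∸ a b = ℚ.≤-trans
  (ℚ.+-monoˡ-≤ (ℚ.- nat b) (ℚ.≤-trans (nat-mono (ℕ.m≤n+m∸n a b)) (ℚ.≤-reflexive (nat-+ b (a ℕ.∸ b)))))
  (ℚ.≤-reflexive (cancel (nat b) (nat (a ℕ.∸ b))))
  where
  open +-*-Solver
  cancel : ∀ x y → x ℚ.+ y ℚ.- x ≡ y
  cancel = solve 2 (λ x y → x :+ y :- x := y) refl

0÷ : ∀ b → 0 ÷ b ≡ 0ℚ
0÷ zero    = refl
0÷ (suc b) = ℚ.0/n≡0 (suc b)

0≤÷ : ∀ a b → 0ℚ ℚ.≤ a ÷ b
0≤÷ a zero    = ℚ.≤-refl
0≤÷ a (suc b) = ℚ.nonNegative⁻¹ _ {{ℚ.normalize-nonNeg a (suc b)}}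

*-mono-0≤ : ∀ {p q} r → 0ℚ ℚ.≤ r → p ℚ.≤ q → p ℚ.* r ℚ.≤ q ℚ.* r
*-mono-0≤ r 0≤r p≤q = ℚ.*-monoʳ-≤-nonNeg r {{ℚ.nonNegative 0≤r}} p≤q

0≤* : ∀ {p q} → 0ℚ ℚ.≤ p → 0ℚ ℚ.≤ q → 0ℚ ℚ.≤ p ℚ.* q
0≤* {p} {q} 0≤p 0≤q = subst (ℚ._≤ p ℚ.* q) (ℚ.*-zeroˡ q) (*-mono-0≤ q 0≤q 0≤p)

inverse : ℚ → ℚ
inverse p with p ℚ.≟ 0ℚ
... | yes _  = 0ℚ
... | no p≢0 = ℚ.1/_ p {{ℚ.≢-nonZero p≢0}}

inverse-* : ∀ p → p ≢ 0ℚ → inverse p ℚ.* p ≡ 1ℚ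
inverse-* p p≢0 with p ℚ.≟ 0ℚ
... | yes p≡0 = contradiction p≡0 p≢0
... | no p≢0′ = ℚ.*-inverseˡ p {{ℚ.≢-nonZero p≢0′}}

0≤inverse : ∀ p → 0ℚ ℚ.≤ p → 0ℚ ℚ.≤ inverse p
0≤inverse p 0≤p with p ℚ.≟ 0ℚ
... | yes _  = ℚ.≤-refl
... | no p≢0 = ℚ.<⇒≤ (ℚ.positive⁻¹ _ {{ℚ.1/pos⇒pos p {{ℚ.nonNeg∧nonZero⇒pos p {{ℚ.nonNegative 0≤p}} {{ℚ.≢-nonZero p≢0}}}}}})

-- The 4 comes from the upper bound 1 + 4d²/n, the inverse from the lower bound 1 - d²/k = 1 - (1/p)
-- d²/n. At p = 0 the inverse is set to 0; then k = 0 and only d = 0 occurs.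
constant : ℚ → ℚ
constant p = nat 4 ℚ.+ inverse p

module Asymptotic (k l d : ℕ) (1≤n : 1 ℕ.≤ k ℕ.+ l) (k≤l : k ℕ.≤ l) (d≤k : d ℕ.≤ k) where

  n = k ℕ.+ l
  p = k ÷ n
  δ = (d ℕ.* d) ÷ n
  C = constant p

  exact approx : ℚ
  exact = (2 ℕ.^ d ℕ.* (k P d) ℕ.* (l P d)) ÷ (n P (2 ℕ.* d))
  approx = ((2 ÷ 1) ℚ.* p ℚ.* (1ℚ ℚ.- p)) ℚ-Ops.^ d

  d≤l : d ℕ.≤ l
  d≤l = ℕ.≤-trans d≤k k≤l

  2d≤n : 2 ℕ.* d ℕ.≤ n
  2d≤n = ℕ.+-mono-≤ d≤k (ℕ.≤-trans (ℕ.≤-reflexive (ℕ.+-identityʳ d)) d≤l)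

  p*n : p ℚ.* nat n ≡ nat k
  p*n = ÷-cancel k 1≤n

  δ*n : δ ℚ.* nat n ≡ nat (d ℕ.* d)
  δ*n = ÷-cancel (d ℕ.* d) 1≤n

  variance : (2 ÷ 1) ℚ.* p ℚ.* (1ℚ ℚ.- p) ℚ.* nat (n ℕ.* n) ≡ nat 2 ℚ.* nat (k ℕ.* l)
  variance = begin
    nat 2 ℚ.* p ℚ.* (1ℚ ℚ.- p) ℚ.* nat (n ℕ.* n)
      ≡⟨ cong (nat 2 ℚ.* p ℚ.* (1ℚ ℚ.- p) ℚ.*_) (nat-* n n) ⟩
    nat 2 ℚ.* p ℚ.* (1ℚ ℚ.- p) ℚ.* (nat n ℚ.* nat n)
      ≡⟨ regroup (nat 2) p (nat n) ⟩
    nat 2 ℚ.* ((p ℚ.* nat n) ℚ.* (nat n ℚ.- p ℚ.* nat n))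
      ≡⟨ cong₂ (λ a b → nat 2 ℚ.* (a ℚ.* (b ℚ.- a))) p*n (nat-+ k l) ⟩
    nat 2 ℚ.* (nat k ℚ.* (nat k ℚ.+ nat l ℚ.- nat k))
      ≡⟨ cancel (nat 2) (nat k) (nat l) ⟩
    nat 2 ℚ.* (nat k ℚ.* nat l)
      ≡⟨ cong (nat 2 ℚ.*_) (nat-* k l) ⟨
    nat 2 ℚ.* nat (k ℕ.* l) ∎
    where
    open ≡-Reasoning
    open +-*-Solver
    regroup : ∀ t p n → t ℚ.* p ℚ.* (1ℚ ℚ.- p) ℚ.* (n ℚ.* n) ≡ t ℚ.* ((p ℚ.* n) ℚ.* (n ℚ.- p ℚ.* n))
    regroup = solve 3 (λ t p n → t :* p :* (con 1ℚ :- p) :* (n :* n) := t :* ((p :* n) :* (n :- p :* n))) refl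
    cancel : ∀ t k l → t ℚ.* (k ℚ.* (k ℚ.+ l ℚ.- k)) ≡ t ℚ.* (k ℚ.* l)
    cancel = solve 3 (λ t k l → t :* (k :* (k :+ l :- k)) := t :* (k :* l)) refl

  variance^ : ∀ d → ((2 ÷ 1) ℚ.* p ℚ.* (1ℚ ℚ.- p)) ℚ-Ops.^ d ℚ.* nat ((n ℕ.* n) ℕ.^ d)
    ≡ nat (2 ℕ.^ d) ℚ.* nat ((k ℕ.* l) ℕ.^ d)
  variance^ zero    = refl
  variance^ (suc d) = begin
    y ℚ.* Y ℚ.* nat (n ℕ.* n ℕ.* (n ℕ.* n) ℕ.^ d)
      ≡⟨ cong (y ℚ.* Y ℚ.*_) (nat-* (n ℕ.* n) ((n ℕ.* n) ℕ.^ d)) ⟩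
    y ℚ.* Y ℚ.* (nat (n ℕ.* n) ℚ.* nat ((n ℕ.* n) ℕ.^ d))
      ≡⟨ interchange y Y (nat (n ℕ.* n)) (nat ((n ℕ.* n) ℕ.^ d)) ⟩
    (y ℚ.* nat (n ℕ.* n)) ℚ.* (Y ℚ.* nat ((n ℕ.* n) ℕ.^ d))
      ≡⟨ cong₂ ℚ._*_ variance (variance^ d) ⟩
    (nat 2 ℚ.* nat (k ℕ.* l)) ℚ.* (nat (2 ℕ.^ d) ℚ.* nat ((k ℕ.* l) ℕ.^ d))
      ≡⟨ interchange (nat 2) (nat (k ℕ.* l)) (nat (2 ℕ.^ d)) (nat ((k ℕ.* l) ℕ.^ d)) ⟩
    (nat 2 ℚ.* nat (2 ℕ.^ d)) ℚ.* (nat (k ℕ.* l) ℚ.* nat ((k ℕ.* l) ℕ.^ d))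
      ≡⟨ cong₂ ℚ._*_ (nat-* 2 (2 ℕ.^ d)) (nat-* (k ℕ.* l) ((k ℕ.* l) ℕ.^ d)) ⟨
    nat (2 ℕ.^ suc d) ℚ.* nat ((k ℕ.* l) ℕ.^ suc d) ∎
    where
    open ≡-Reasoning
    open +-*-Solver
    y = (2 ÷ 1) ℚ.* p ℚ.* (1ℚ ℚ.- p)
    Y = y ℚ-Ops.^ d
    interchange : ∀ a b c d → a ℚ.* b ℚ.* (c ℚ.* d) ≡ (a ℚ.* c) ℚ.* (b ℚ.* d)
    interchange = solve 4 (λ a b c d → a :* b :* (c :* d) := (a :* c) :* (b :* d)) refl

  -- `D` clears the denominator of `exact` and `E` that of `approx`; over the common denominator `M`
  -- they become `t` times `falling` and `t` times `powers`.
  D = n P′ (2 ℕ.* d)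
  E = (n ℕ.* n) ℕ.^ d
  M = D ℕ.* E
  t = 2 ℕ.^ d

  M-positive : ℚ.Positive (nat M)
  M-positive = nat-positive (ℕ.*-mono-≤ (P′-positive n (2 ℕ.* d) 2d≤n) (ℕ.m^n>0 (n ℕ.* n) {{n²≢0}} d))
    where
    n²≢0 : ℕ.NonZero (n ℕ.* n)
    n²≢0 = ℕ.>-nonZero (ℕ.*-mono-≤ 1≤n 1≤n)

  exact*M : exact ℚ.* nat M ≡ nat (t ℕ.* falling k l d)
  exact*M = begin
    exact ℚ.* nat M
      ≡⟨ cong (exact ℚ.*_) (nat-* D E) ⟩
    exact ℚ.* (nat D ℚ.* nat E)
      ≡⟨ ℚ.*-assoc exact (nat D) (nat E) ⟨
    exact ℚ.* nat D ℚ.* nat E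
      ≡⟨ cong (λ a → exact ℚ.* nat a ℚ.* nat E) (P≡P′ 2d≤n) ⟨
    exact ℚ.* nat (n P (2 ℕ.* d)) ℚ.* nat E
      ≡⟨ cong (ℚ._* nat E) (÷-cancel (t ℕ.* (k P d) ℕ.* (l P d))
           (ℕ.≤-trans (P′-positive n (2 ℕ.* d) 2d≤n) (ℕ.≤-reflexive (sym (P≡P′ 2d≤n))))) ⟩
    nat (t ℕ.* (k P d) ℕ.* (l P d)) ℚ.* nat E
      ≡⟨ nat-* (t ℕ.* (k P d) ℕ.* (l P d)) E ⟨
    nat (t ℕ.* (k P d) ℕ.* (l P d) ℕ.* E)
      ≡⟨ cong₂ (λ a b → nat (t ℕ.* a ℕ.* b ℕ.* E)) (P≡P′ d≤k) (P≡P′ d≤l) ⟩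
    nat (t ℕ.* (k P′ d) ℕ.* (l P′ d) ℕ.* E)
      ≡⟨ cong nat (trans (cong (ℕ._* E) (ℕ.*-assoc t (k P′ d) (l P′ d))) (ℕ.*-assoc t ((k P′ d) ℕ.* (l P′ d)) E)) ⟩
    nat (t ℕ.* falling k l d) ∎
    where open ≡-Reasoning

  approx*M : approx ℚ.* nat M ≡ nat (t ℕ.* powers k l d)
  approx*M = begin
    approx ℚ.* nat M
      ≡⟨ cong (approx ℚ.*_) (trans (cong nat (ℕ.*-comm D E)) (nat-* E D)) ⟩
    approx ℚ.* (nat E ℚ.* nat D)
      ≡⟨ ℚ.*-assoc approx (nat E) (nat D) ⟨
    approx ℚ.* nat E ℚ.* nat D
      ≡⟨ cong (ℚ._* nat D) (trans (variance^ d) (sym (nat-* t ((k ℕ.* l) ℕ.^ d)))) ⟩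
    nat (t ℕ.* (k ℕ.* l) ℕ.^ d) ℚ.* nat D
      ≡⟨ nat-* (t ℕ.* (k ℕ.* l) ℕ.^ d) D ⟨
    nat (t ℕ.* (k ℕ.* l) ℕ.^ d ℕ.* D)
      ≡⟨ cong nat (ℕ.*-assoc t ((k ℕ.* l) ℕ.^ d) D) ⟩
    nat (t ℕ.* powers k l d) ∎
    where open ≡-Reasoning

  compare : ∀ {x y} a b X Y → x ℚ.* nat M ≡ nat (t ℕ.* X) → y ℚ.* nat M ≡ nat (t ℕ.* Y) →
    a ℕ.* X ℕ.≤ b ℕ.* Y → nat a ℚ.* x ℚ.≤ nat b ℚ.* y
  compare {x} {y} a b X Y x*M y*M aX≤bY = ℚ.*-cancelʳ-≤-pos (nat M) {{M-positive}} (begin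
    nat a ℚ.* x ℚ.* nat M     ≡⟨ expand a X x*M ⟩
    nat (t ℕ.* (a ℕ.* X))     ≤⟨ nat-mono (ℕ.*-monoʳ-≤ t aX≤bY) ⟩
    nat (t ℕ.* (b ℕ.* Y))     ≡⟨ expand b Y y*M ⟨
    nat b ℚ.* y ℚ.* nat M     ∎)
    where
    open ℚ.≤-Reasoning
    expand : ∀ {x} a X → x ℚ.* nat M ≡ nat (t ℕ.* X) → nat a ℚ.* x ℚ.* nat M ≡ nat (t ℕ.* (a ℕ.* X))
    expand {x} a X x*M = trans (ℚ.*-assoc (nat a) x (nat M)) (trans (cong (nat a ℚ.*_) x*M)
      (trans (sym (nat-* a (t ℕ.* X))) (cong nat (trans (sym (ℕ.*-assoc a t X))
        (trans (cong (ℕ._* X) (ℕ.*-comm a t)) (ℕ.*-assoc t a X))))))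

  0≤approx : 0ℚ ℚ.≤ approx
  0≤approx = ℚ.*-cancelʳ-≤-pos (nat M) {{M-positive}}
    (subst (0ℚ ℚ.* nat M ℚ.≤_) (sym approx*M)
      (ℚ.≤-trans (ℚ.≤-reflexive (ℚ.*-zeroˡ (nat M))) (0≤nat (t ℕ.* powers k l d))))

  upper : exact ℚ.≤ (1ℚ ℚ.+ C ℚ.* δ) ℚ.* approx
  upper = ℚ.*-cancelˡ-≤-pos (nat n) {{nat-positive 1≤n}} (begin
    nat n ℚ.* exact
      ≤⟨ compare n (n ℕ.+ 4 ℕ.* (d ℕ.* d)) (falling k l d) (powers k l d) exact*M approx*M (falling-upper′ k l d d≤k d≤l) ⟩
    nat (n ℕ.+ 4 ℕ.* (d ℕ.* d)) ℚ.* approx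
      ≡⟨ cong (ℚ._* approx) (trans (nat-+ n (4 ℕ.* (d ℕ.* d))) (cong (nat n ℚ.+_) (nat-* 4 (d ℕ.* d)))) ⟩
    (nat n ℚ.+ nat 4 ℚ.* nat (d ℕ.* d)) ℚ.* approx
      ≤⟨ *-mono-0≤ approx 0≤approx (ℚ.+-monoʳ-≤ (nat n) (*-mono-0≤ (nat (d ℕ.* d)) (0≤nat (d ℕ.* d)) 4≤C)) ⟩
    (nat n ℚ.+ C ℚ.* nat (d ℕ.* d)) ℚ.* approx
      ≡⟨ cong (λ a → (nat n ℚ.+ C ℚ.* a) ℚ.* approx) δ*n ⟨
    (nat n ℚ.+ C ℚ.* (δ ℚ.* nat n)) ℚ.* approx
      ≡⟨ regroup (nat n) C δ approx ⟩
    nat n ℚ.* ((1ℚ ℚ.+ C ℚ.* δ) ℚ.* approx) ∎)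
    where
    open ℚ.≤-Reasoning
    open +-*-Solver
    4≤C : nat 4 ℚ.≤ C
    4≤C = ℚ.≤-trans (ℚ.≤-reflexive (sym (ℚ.+-identityʳ (nat 4)))) (ℚ.+-monoʳ-≤ (nat 4) (0≤inverse p (0≤÷ k n)))
    regroup : ∀ n C δ a → (n ℚ.+ C ℚ.* (δ ℚ.* n)) ℚ.* a ≡ n ℚ.* ((1ℚ ℚ.+ C ℚ.* δ) ℚ.* a)
    regroup = solve 4 (λ n C δ a → (n :+ C :* (δ :* n)) :* a := n :* ((con 1ℚ :+ C :* δ) :* a)) refl

  -- After multiplication by k the part (1/p) δ of C δ is exactly d², because k/n = p. The
  -- difference k - d² may be negative; `nat-∸` bounds it by its truncation, the form in
  -- `falling-lower′`.
  lower-positive : 1 ℕ.≤ k → (1ℚ ℚ.- C ℚ.* δ) ℚ.* approx ℚ.≤ exact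
  lower-positive 1≤k = ℚ.*-cancelˡ-≤-pos (nat k) {{nat-positive 1≤k}} (begin
    nat k ℚ.* ((1ℚ ℚ.- C ℚ.* δ) ℚ.* approx)
      ≡⟨ regroup (nat k) (nat 4) (inverse p) δ approx ⟩
    (nat k ℚ.- (nat 4 ℚ.* δ ℚ.* nat k ℚ.+ inverse p ℚ.* δ ℚ.* nat k)) ℚ.* approx
      ≤⟨ *-mono-0≤ approx 0≤approx (ℚ.+-monoʳ-≤ (nat k) (ℚ.neg-antimono-≤ d²≤)) ⟩
    (nat k ℚ.- nat (d ℕ.* d)) ℚ.* approx
      ≤⟨ *-mono-0≤ approx 0≤approx (nat-∸ k (d ℕ.* d)) ⟩
    nat (k ℕ.∸ d ℕ.* d) ℚ.* approx
      ≤⟨ compare (k ℕ.∸ d ℕ.* d) k (powers k l d) (falling k l d) approx*M exact*M (falling-lower′ k l k≤l d d≤k) ⟩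
    nat k ℚ.* exact ∎)
    where
    open ℚ.≤-Reasoning
    open +-*-Solver
    regroup : ∀ k f i δ a → k ℚ.* ((1ℚ ℚ.- (f ℚ.+ i) ℚ.* δ) ℚ.* a) ≡ (k ℚ.- (f ℚ.* δ ℚ.* k ℚ.+ i ℚ.* δ ℚ.* k)) ℚ.* a
    regroup = solve 5 (λ k f i δ a → k :* ((con 1ℚ :- (f :+ i) :* δ) :* a) := (k :- (f :* δ :* k :+ i :* δ :* k)) :* a) refl
    p≢0 : p ≢ 0ℚ
    p≢0 p≡0 = ℚ.<⇒≢ (ℚ.positive⁻¹ (nat k) {{nat-positive 1≤k}})
      (trans (sym (ℚ.*-zeroˡ (nat n))) (trans (cong (ℚ._* nat n) (sym p≡0)) p*n))
    inverse≡ : inverse p ℚ.* δ ℚ.* nat k ≡ nat (d ℕ.* d)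
    inverse≡ = begin-equality
      inverse p ℚ.* δ ℚ.* nat k              ≡⟨ cong (inverse p ℚ.* δ ℚ.*_) p*n ⟨
      inverse p ℚ.* δ ℚ.* (p ℚ.* nat n)      ≡⟨ interchange (inverse p) δ p (nat n) ⟩
      (inverse p ℚ.* p) ℚ.* (δ ℚ.* nat n)    ≡⟨ cong₂ ℚ._*_ (inverse-* p p≢0) δ*n ⟩
      1ℚ ℚ.* nat (d ℕ.* d)                   ≡⟨ ℚ.*-identityˡ _ ⟩
      nat (d ℕ.* d)                          ∎
      where
      interchange : ∀ a b c d → a ℚ.* b ℚ.* (c ℚ.* d) ≡ (a ℚ.* c) ℚ.* (b ℚ.* d)
      interchange = solve 4 (λ a b c d → a :* b :* (c :* d) := (a :* c) :* (b :* d)) refl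
    d²≤ : nat (d ℕ.* d) ℚ.≤ nat 4 ℚ.* δ ℚ.* nat k ℚ.+ inverse p ℚ.* δ ℚ.* nat k
    d²≤ = begin
      nat (d ℕ.* d)                                        ≡⟨ ℚ.+-identityˡ _ ⟨
      0ℚ ℚ.+ nat (d ℕ.* d)                                 ≤⟨ ℚ.+-mono-≤ (0≤* (0≤* (0≤nat 4) (0≤÷ (d ℕ.* d) n)) (0≤nat k))
                                                                (ℚ.≤-reflexive (sym inverse≡)) ⟩
      nat 4 ℚ.* δ ℚ.* nat k ℚ.+ inverse p ℚ.* δ ℚ.* nat k  ∎

asymptotic-lower : ∀ k l d (1≤n : 1 ℕ.≤ k ℕ.+ l) (k≤l : k ℕ.≤ l) (d≤k : d ℕ.≤ k) →
  let open Asymptotic k l d 1≤n k≤l d≤k in (1ℚ ℚ.- C ℚ.* δ) ℚ.* approx ℚ.≤ exact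
asymptotic-lower (suc k) l d    1≤n k≤l d≤k = Asymptotic.lower-positive (suc k) l d 1≤n k≤l d≤k (s≤s z≤n)
-- Here p = 0, and d ≤ k leaves only d = 0: δ is 0, and both `exact` and `approx` are 1.
asymptotic-lower zero    l zero 1≤n k≤l z≤n = ℚ.≤-reflexive (trans (ℚ.*-identityʳ _)
  (trans (cong (λ a → 1ℚ ℚ.- C ℚ.* a) δ≡0) (cong (λ a → 1ℚ ℚ.- a) (ℚ.*-zeroʳ C))))
  where
  open Asymptotic zero l zero 1≤n k≤l z≤n
  δ≡0 : δ ≡ 0ℚ
  δ≡0 = 0÷ l

-- The rational bounds are multiplied by c_B, so its sign matters; it is inherited from the positive
-- integer 2^d c_B.
0≤c : ∀ {n d} (B : TopSet n d) → 0ℚ ℚ.≤ c B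
0≤c {n} {d} B = ℚ.*-cancelʳ-≤-pos (nat (2 ℕ.^ d)) {{nat-positive (ℕ.m^n>0 2 d)}}
  (subst₂-≤ (sym (ℚ.*-zeroˡ (nat (2 ℕ.^ d)))) (sym c≡) (0≤nat (suc m)))
  where
  subst₂-≤ : ∀ {p q p′ q′} → p ≡ p′ → q ≡ q′ → p ℚ.≤ q → p′ ℚ.≤ q′
  subst₂-≤ refl refl p≤q = p≤q
  positive = normConst-positive (Code.subset (code B)) (Code.top (code B))
  m = proj₁ positive
  c≡ : c B ℚ.* nat (2 ℕ.^ d) ≡ nat (suc m)
  c≡ = trans (c-normConst B) (cong toℚ (proj₂ positive))

-- Transfer of the bounds to real numbers

p≤∣p∣ : ∀ p → p ℚ.≤ ℚ.∣ p ∣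
p≤∣p∣ p with ℚ.≤-total 0ℚ p
... | inj₁ 0≤p = ℚ.≤-reflexive (sym (ℚ.0≤p⇒∣p∣≡p 0≤p))
... | inj₂ p≤0 = ℚ.≤-trans p≤0 (ℚ.0≤∣p∣ p)

-- The norm is a Cauchy sequence that is merely equivalent to a rational constant; eventual
-- closeness within ε is precisely the slack in the order on ℝ.
≤-≈ : ∀ {x y q r} → (∀ i → seq x i ≡ r) → y ≈ fromℚ q → r ℚ.≤ q → x ≤ y
≤-≈ {x} {y} {q} {r} x≡r y≈q r≤q = mk≤ (λ ε ε>0 → let N , close = un≈ y≈q ε ε>0 in N , λ i N≤i → begin
  seq x i                               ≡⟨ x≡r i ⟩
  r                                     ≤⟨ r≤q ⟩
  q                                     ≡⟨ split (seq y i) q ⟩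
  seq y i ℚ.+ ℚ.- (seq y i ℚ.- q)       ≤⟨ ℚ.+-monoʳ-≤ (seq y i) (p≤∣p∣ (ℚ.- (seq y i ℚ.- q))) ⟩
  seq y i ℚ.+ ℚ.∣ ℚ.- (seq y i ℚ.- q) ∣ ≡⟨ cong (seq y i ℚ.+_) (ℚ.∣-p∣≡∣p∣ (seq y i ℚ.- q)) ⟩
  seq y i ℚ.+ ℚ.∣ seq y i ℚ.- q ∣       ≤⟨ ℚ.+-monoʳ-≤ (seq y i) (ℚ.<⇒≤ (close i N≤i)) ⟩
  seq y i ℚ.+ ε                         ∎)
  where
  open ℚ.≤-Reasoning
  open +-*-Solver
  split : ∀ y q → q ≡ y ℚ.+ ℚ.- (y ℚ.- q)
  split = solve 2 (λ y q → q := y :+ :- (y :- q)) refl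

≈-≤ : ∀ {x y q r} → x ≈ fromℚ q → (∀ i → seq y i ≡ r) → q ℚ.≤ r → x ≤ y
≈-≤ {x} {y} {q} {r} x≈q y≡r q≤r = mk≤ (λ ε ε>0 → let N , close = un≈ x≈q ε ε>0 in N , λ i N≤i → begin
  seq x i                           ≡⟨ split (seq x i) q ⟩
  q ℚ.+ (seq x i ℚ.- q)             ≤⟨ ℚ.+-monoʳ-≤ q (p≤∣p∣ (seq x i ℚ.- q)) ⟩
  q ℚ.+ ℚ.∣ seq x i ℚ.- q ∣         ≤⟨ ℚ.+-mono-≤ q≤r (ℚ.<⇒≤ (close i N≤i)) ⟩
  r ℚ.+ ε                           ≡⟨ cong (ℚ._+ ε) (y≡r i) ⟨
  seq y i ℚ.+ ε                     ∎)
  where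
  open ℚ.≤-Reasoning
  open +-*-Solver
  split : ∀ x q → x ≡ q ℚ.+ (x ℚ.- q)
  split = solve 2 (λ x q → x := q :+ (x :- q)) refl

norm-asymptotics : ∀ {n d k} (B : TopSet n d) → 1 ℕ.≤ n → d ℕ.≤ k → 2 ℕ.* k ℕ.≤ n →
  let p = k ÷ n in
  ‖ restrict {n} {k} (χ B) ‖² ≈ fromℚ (c B ℚ.* (((2 ÷ 1) ℚ.* p ℚ.* (1ℚ ℚ.- p)) ℚ-Ops.^ d))
    [1± fromℚ (constant p) * fromℚ ((d ℕ.* d) ÷ n) ]
norm-asymptotics {n} {d} {k} B 1≤n d≤k 2k≤n =
  ≤-≈ (λ _ → refl) norm (subst (ℚ._≤ c B ℚ.* exactₙ) (swap (1ℚ ℚ.- Cₙ ℚ.* δₙ) (c B) approxₙ)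
    (ℚ.*-monoˡ-≤-nonNeg (c B) {{ℚ.nonNegative (0≤c B)}} (proj₁ bounds)))
  , ≈-≤ norm (λ _ → refl) (subst (c B ℚ.* exactₙ ℚ.≤_) (swap (1ℚ ℚ.+ Cₙ ℚ.* δₙ) (c B) approxₙ)
    (ℚ.*-monoˡ-≤-nonNeg (c B) {{ℚ.nonNegative (0≤c B)}} (proj₂ bounds)))
  where
  open +-*-Solver
  norm = norm-value B d≤k 2k≤n
  exactₙ = (2 ℕ.^ d ℕ.* (k P d) ℕ.* ((n ℕ.∸ k) P d)) ÷ (n P (2 ℕ.* d))
  Cₙ = constant (k ÷ n)
  δₙ = (d ℕ.* d) ÷ n
  approxₙ = ((2 ÷ 1) ℚ.* (k ÷ n) ℚ.* (1ℚ ℚ.- (k ÷ n))) ℚ-Ops.^ d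
  swap : ∀ a c y → c ℚ.* (a ℚ.* y) ≡ a ℚ.* (c ℚ.* y)
  swap = solve 3 (λ a c y → c :* (a :* y) := a :* (c :* y)) refl
  l = n ℕ.∸ k
  k+l≡n : k ℕ.+ l ≡ n
  k+l≡n = ℕ.m+[n∸m]≡n (ℕ.≤-trans (ℕ.m≤m+n k _) 2k≤n)
  k≤l : k ℕ.≤ l
  k≤l = ℕ.+-cancelˡ-≤ k k l (ℕ.≤-trans (ℕ.≤-trans (ℕ.≤-reflexive (cong (k ℕ.+_) (sym (ℕ.+-identityʳ k)))) 2k≤n)
    (ℕ.≤-reflexive (sym k+l≡n)))
  1≤k+l = ℕ.≤-trans 1≤n (ℕ.≤-reflexive (sym k+l≡n))
  -- The estimates have k + l in place of `n`; abstracting this one number allows transport along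
  -- `k+l≡n` while `l` stays fixed.
  Bounds : ℕ → Set
  Bounds m = let p = k ÷ m
                 δ = (d ℕ.* d) ÷ m
                 exact = (2 ℕ.^ d ℕ.* (k P d) ℕ.* (l P d)) ÷ (m P (2 ℕ.* d))
                 approx = ((2 ÷ 1) ℚ.* p ℚ.* (1ℚ ℚ.- p)) ℚ-Ops.^ d in
    ((1ℚ ℚ.- constant p ℚ.* δ) ℚ.* approx ℚ.≤ exact) × (exact ℚ.≤ (1ℚ ℚ.+ constant p ℚ.* δ) ℚ.* approx)
  bounds : Bounds n
  bounds = subst Bounds k+l≡n (asymptotic-lower k l d 1≤k+l k≤l d≤k , Asymptotic.upper k l d 1≤k+l k≤l d≤k)

theorem4p1 : Σ (ℚ → ℝ) λ C →
    (n k : ℕ) → 1 ℕ.≤ n → 2 ℕ.* k ℕ.≤ n →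
    let p = k ÷ n in
    IsOrthogonalBasis (χ-family n k)
    × ((d : ℕ) → d ℕ.≤ k → (B : TopSet n d) →
    let N = ‖ restrict {n} {k} (χ B) ‖² in
    (N ≈ fromℚ (c B ℚ.* ((2 ℕ.^ d ℕ.* (k P d) ℕ.* ((n ℕ.∸ k) P d)) ÷ (n P (2 ℕ.* d)))))
    × (N ≈ fromℚ (c B ℚ.* (((2 ÷ 1) ℚ.* p ℚ.* (1ℚ ℚ.- p)) ℚ-Ops.^ d)) [1± C p * fromℚ ((d ℕ.* d) ÷ n) ]))
theorem4p1 = (λ p → fromℚ (constant p)) , λ n k 1≤n 2k≤n →
  (independent n k 2k≤n , spanning n k , orthogonal n k)
  , λ d d≤k B → norm-value B d≤k 2k≤n , norm-asymptotics B 1≤n d≤k 2k≤n
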